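{- Let $n,k,m$ be positive integers with $k+m\le n$, let $\omega\in S_n$, and let $r[k,m]$ denote the $(m+1)$-cycle $(k+m\ \ k+m-1\ \ \ldots\ \ k+1\ \ k)$. Let $r[k,m]\cdot\mathcal T_\omega$ be the set of those labelled tower diagrams in $k_{(m)}\cdot\mathcal T_\omega$, with labels $(1,a_1,b_1),\ldots,(m,a_m,b_m)$, such that (i) $a_1\ge a_2\ge\cdots\ge a_m$, and (ii) no two labelled cells lie in the same tower of the diagram. Then $$\mathfrak S_\omega\,\mathfrak S_{r[k,m]}=\sum_{\mathcal T\in r[k,m]\cdot\mathcal T_\omega}\mathfrak S_{\omega_{\mathcal T}},$$ where $\omega_{\mathcal T}$ is the permutation whose tower diagram is the underlying diagram of $\mathcal T$.
   Context: $\mathfrak S_w$ denotes the Schubert polynomial of a permutation $w$. Permutations are composed as functions, $(\sigma\tau)(x)=\sigma(\tau(x))$; $t_{a,b}$ is the transposition exchanging $a$ and $b$; $\ell$ is Coxeter length; a cycle $(c_1\,c_2\,\ldots\,c_p)$ maps $c_1\mapsto c_2\mapsto\cdots\mapsto c_p\mapsto c_1$. Tower diagrams: a tower diagram is a sequence $\mathcal T=(\mathcal T_1,\mathcal T_2,\ldots)$ of nonnegative integers, almost all zero; $\mathcal T_p$ is the height of the $p$-th tower. A cell is identified with the south-east corner $(a,b)$ of the unit square $[a-1,a]\times[b,b+1]$; the cell $(a,b)$ belongs to $\mathcal T$ iff $0\le b<\mathcal T_a$. The slide of $(a,b)$ is $a+b$. Sliding a positive integer $i$ into $\mathcal T$ produces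 a diagram $i\searrow\mathcal T$: set $s:=i$ and examine towers $p=1,2,\ldots$ in order, with $h=\mathcal T_p$: if $s>p+h$ go to the next tower; if $s=p+h$ increase $\mathcal T_p$ by one and stop; if $h\ge1$ and $s=p+h-1$ decrease $\mathcal T_p$ by one and stop; if $s<p+h-1$ replace $s$ by $s+1$ and go to the next tower. For a word $\alpha=\alpha_1\cdots\alpha_l$, $\alpha\searrow\mathcal T=\alpha_l\searrow(\cdots(\alpha_1\searrow\mathcal T))$. For a permutation $w$ with reduced word $\alpha$ (i.e. $w=s_{\alpha_1}\cdots s_{\alpha_l}$, $l=\ell(w)$, $s_p=t_{p,p+1}$), its tower diagram is $\mathcal T_w:=\alpha\searrow\varnothing$ (independent of the reduced word); $w\mapsto\mathcal T_w$ is a bijection, with inverse $\mathcal T\mapsto\omega_{\mathcal T}$. Saturated chains: fix $k$. A saturated $k$-Bruhat chain of length $m$ from $\omega$ is a sequence $(a_1,b_1),\ldots,(a_m,b_m)$ of pairs of positive integers with $a_q\le k<b_q$ and $\ell(\omega^{(q)})=\ell(\omega^{(q-1)})+1$ for all $q$, where $\omega^{(0)}=\omega$ and $\omega^{(q)}=\omega^{(q-1)}t_{a_q,b_q}$. It is known that in this situation $\mathcal T_{\omega^{(q)}}$ is obtained from $D:=\mathcal T_{\omega^{(q-1)}}$ by raising tower $s=\omega^{(q-1)}(a_q)$ by $r+1$ cells and lowering tower $l=\omega^{(q-1)}(b_q)$ by $r$ cells for some $r\ge0$, other towers unchanged. The set $k_{(m)}\cdot\mathcal T_\omega$ consists, for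 each such chain, of the diagram $\mathcal T_{\omega^{(m)}}$ together with the labels $(1,a_1,b_1),\ldots,(m,a_m,b_m)$ (different chains give different elements even if the diagrams coincide). Each label is attached to a cell, tracked as follows: at step $q$, label $(q,a_q,b_q)$ is attached to the cell $(s,D_s)$ (the lowest new cell of the raised tower); previously labelled cells keep their positions, except that a labelled cell among the removed cells $(l,D_l-r+u)$, $0\le u<r$, is carried to the cell $(s,D_s+1+u)$. -}

module Defs where

open import Data.Bool using (Bool; true; false; _∧_; if_then_else_)
open import Data.Nat using (ℕ; zero; suc; _+_; _*_; _∸_; _≤_; _<_; _≥_; _≡ᵇ_; _<ᵇ_; _≤ᵇ_; _⊔_)
open import Data.Integer as ℤ using (ℤ)
open import Data.List using (List; []; _∷_; _++_; map; concatMap; upTo; length; foldl; [_])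
open import Data.Maybe using (Maybe; just; nothing)
open import Data.Product using (_×_; _,_; proj₁; proj₂)
open import Data.Unit using (⊤)
open import Relation.Binary.PropositionalEquality using (_≡_)
open import Data.List.Relation.Unary.Unique.Propositional using (Unique)
open import Data.List.Relation.Unary.Linked using (Linked)
open import Data.List.Relation.Binary.Permutation.Propositional using (_↭_)

range : ℕ → ℕ → List ℕ
range from count = map (from +_) (upTo count)

lookupD : ℕ → List ℕ → ℕ → ℕ
lookupD d []       _       = d
lookupD d (x ∷ xs) zero    = x
lookupD d (x ∷ xs) (suc i) = lookupD d xs i

setAt : List ℕ → ℕ → ℕ → List ℕ
setAt []       zero    v = v ∷ []
setAt []       (suc i) v = 0 ∷ setAt [] i v
setAt (x ∷ xs) zero    v = v ∷ xs
setAt (x ∷ xs) (suc i) v = x ∷ setAt xs i v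

-- Permutations of the positive integers with finite support, in one-line
-- notation: the list [w(1), ..., w(N)], with w(i) = i for i > N.

Perm : Set
Perm = List ℕ

IsPerm : ℕ → Perm → Set
IsPerm n w = w ↭ range 1 n

app : Perm → ℕ → ℕ
app w zero    = zero
app w (suc i) = lookupD (suc i) w i

transp : ℕ → ℕ → ℕ → ℕ
transp a b j = if j ≡ᵇ a then b else (if j ≡ᵇ b then a else j)

pad : Perm → ℕ → Perm
pad w N = w ++ range (suc (length w)) (N ∸ length w)

mulT : Perm → ℕ → ℕ → Perm
mulT w a b = let w' = pad w (a ⊔ b) in map (λ j → app w' (transp a b j)) (range 1 (length w'))

countBelow : ℕ → List ℕ → ℕ
countBelow x []       = 0
countBelow x (y ∷ ys) = (if y <ᵇ x then 1 else 0) + countBelow x ys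

len : Perm → ℕ
len []       = 0
len (x ∷ xs) = countBelow x xs + len xs

firstDescentFrom : ℕ → List ℕ → Maybe ℕ
firstDescentFrom i []           = nothing
firstDescentFrom i (x ∷ [])     = nothing
firstDescentFrom i (x ∷ y ∷ ys) = if y <ᵇ x then just i else firstDescentFrom (suc i) (y ∷ ys)

firstAscentFrom : ℕ → List ℕ → Maybe ℕ
firstAscentFrom i []           = nothing
firstAscentFrom i (x ∷ [])     = nothing
firstAscentFrom i (x ∷ y ∷ ys) = if x <ᵇ y then just i else firstAscentFrom (suc i) (y ∷ ys)

-- a reduced word α of w, i.e. w = s_{α_1} ⋯ s_{α_l}, l = len w
-- (peel off right descents: w = (w s_i) s_i when w(i) > w(i+1));
-- the fuel len w is exactly the number of steps needed.
redWordF : ℕ → Perm → List ℕ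
redWordF zero    w = []
redWordF (suc f) w with firstDescentFrom 1 w
... | nothing = []
... | just i  = redWordF f (mulT w i (suc i)) ++ [ i ]

redWord : Perm → List ℕ
redWord w = redWordF (len w) w

-- Tower diagrams: list of tower heights, T_p at 0-based index p-1.

TowerDiagram : Set
TowerDiagram = List ℕ

height : TowerDiagram → ℕ → ℕ
height T p = lookupD 0 T (p ∸ 1)

-- slideFrom s p T : slide with current value s, currently examining
-- tower p, where T is the list of towers p, p+1, ... (beyond the end all
-- heights are 0).
slideFrom : ℕ → ℕ → TowerDiagram → TowerDiagram
slideFrom s p [] = map (λ _ → 0) (upTo (s ∸ p)) ++ [ 1 ]
slideFrom s p (h ∷ T) =
  if (p + h) <ᵇ s then h ∷ slideFrom s (suc p) T
  else if s ≡ᵇ (p + h) then suc h ∷ T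
  else if (1 ≤ᵇ h) ∧ (suc s ≡ᵇ (p + h)) then (h ∸ 1) ∷ T
  else h ∷ slideFrom (suc s) (suc p) T

slide : ℕ → TowerDiagram → TowerDiagram
slide i T = slideFrom i 1 T

slideWord : List ℕ → TowerDiagram → TowerDiagram
slideWord α T = foldl (λ D i → slide i D) T α

tower : Perm → TowerDiagram
tower w = slideWord (redWord w) []

-- Polynomials in x_1, x_2, ... with integer coefficients.
-- A monomial is an exponent list (index j-1 = exponent of x_j, missing = 0);
-- a polynomial is a finite formal sum of terms (coefficient, monomial).

Mono : Set
Mono = List ℕ

Poly : Set
Poly = List (ℤ × Mono)

monoEq : Mono → Mono → Bool
monoEq []       []       = true
monoEq []       (y ∷ f)  = (y ≡ᵇ 0) ∧ monoEq [] f
monoEq (x ∷ e)  []       = (x ≡ᵇ 0) ∧ monoEq e []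
monoEq (x ∷ e)  (y ∷ f)  = (x ≡ᵇ y) ∧ monoEq e f

coeff : Poly → Mono → ℤ
coeff []            e = ℤ.0ℤ
coeff ((c , f) ∷ p) e = (if monoEq e f then c else ℤ.0ℤ) ℤ.+ coeff p e

_≈P_ : Poly → Poly → Set
p ≈P q = ∀ e → coeff p e ≡ coeff q e

infix 4 _≈P_

addMono : Mono → Mono → Mono
addMono []      f       = f
addMono (x ∷ e) []      = x ∷ e
addMono (x ∷ e) (y ∷ f) = (x + y) ∷ addMono e f

_*P_ : Poly → Poly → Poly
p *P q = concatMap (λ t → map (λ u → (proj₁ t ℤ.* proj₁ u , addMono (proj₂ t) (proj₂ u))) q) p

infixl 7 _*P_

sumP : List Poly → Poly
sumP ps = concatMap (λ p → p) ps

-- divided difference ∂_i f = (f - s_i f)/(x_i - x_{i+1}), written out on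
-- monomials: for a = exponent of x_i, b = exponent of x_{i+1},
--   a ≥ b :  ∂_i(x_i^a x_{i+1}^b) =   Σ_{j<a-b} x_i^{a-1-j} x_{i+1}^{b+j}
--   a < b :  ∂_i(x_i^a x_{i+1}^b) = - Σ_{j<b-a} x_i^{b-1-j} x_{i+1}^{a+j}
ddTerm : ℕ → ℤ × Mono → Poly
ddTerm i (c , e) =
  let a = lookupD 0 e (i ∸ 1)
      b = lookupD 0 e i
      put : ℕ → ℕ → Mono
      put u v = setAt (setAt e (i ∸ 1) u) i v
  in if b ≤ᵇ a
     then map (λ j → (c , put (a ∸ suc j) (b + j))) (upTo (a ∸ b))
     else map (λ j → (ℤ.- c , put (b ∸ suc j) (a + j))) (upTo (b ∸ a))

∂ : ℕ → Poly → Poly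
∂ i p = concatMap (ddTerm i) p

staircase : ℕ → Poly
staircase N = [ (ℤ.1ℤ , map (λ j → N ∸ suc j) (upTo N)) ]

-- Schubert polynomials by divided differences, regarding w ∈ S_N with
-- N = length of the one-line notation:  𝔖_{w₀} = x^δ, and
-- 𝔖_w = ∂_i 𝔖_{w s_i} whenever w(i) < w(i+1).
-- The fuel suc (N * N) exceeds the needed number ℓ(w₀) - ℓ(w) + 1 of steps.
schubF : ℕ → Perm → Poly
schubF zero    w = []
schubF (suc f) w with firstAscentFrom 1 w
... | nothing = staircase (length w)
... | just i  = ∂ i (schubF f (mulT w i (suc i)))

schub : Perm → Poly
schub w = schubF (suc (length w * length w)) w

rcyc : ℕ → ℕ → ℕ → Perm
rcyc n k m = map f (range 1 n)
  where
  f : ℕ → ℕ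
  f j = if j ≡ᵇ k then k + m else (if (k <ᵇ j) ∧ (j ≤ᵇ k + m) then j ∸ 1 else j)

Chain : Set
Chain = List (ℕ × ℕ)

SatChain : ℕ → Perm → Chain → Set
SatChain k w []            = ⊤
SatChain k w ((a , b) ∷ c) =
  (1 ≤ a) × (a ≤ k) × (k < b) × (len (mulT w a b) ≡ suc (len w)) × SatChain k (mulT w a b) c

endPerm : Perm → Chain → Perm
endPerm w []            = w
endPerm w ((a , b) ∷ c) = endPerm (mulT w a b) c

-- Cells (x , y) carrying the labels 1, ..., q (in this order), tracked as in
-- the definition of k_(m)·T_ω.
Cell : Set
Cell = ℕ × ℕ

labelStep : Perm → ℕ → ℕ → List Cell → List Cell
labelStep w a b cells =
  let w' = mulT w a b
      D  = height (tower w)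
      D' = height (tower w')
      s  = app w a
      l  = app w b
      r  = D l ∸ D' l
      move : Cell → Cell
      move (x , y) =
        if (x ≡ᵇ l) ∧ ((D l ∸ r) ≤ᵇ y) ∧ (y <ᵇ D l)
        then (s , D s + 1 + (y ∸ (D l ∸ r)))
        else (x , y)
  in map move cells ++ [ (s , D s) ]

labelCellsFrom : Perm → List Cell → Chain → List Cell
labelCellsFrom w cells []            = cells
labelCellsFrom w cells ((a , b) ∷ c) = labelCellsFrom (mulT w a b) (labelStep w a b cells) c

labelCells : Perm → Chain → List Cell
labelCells w c = labelCellsFrom w [] c

-- membership in r[k,m]·T_ω: a saturated k-Bruhat chain of length m from ω
-- with (i) a_1 ≥ a_2 ≥ ⋯ ≥ a_m and (ii) labelled cells in distinct towers.
InRChain : ℕ → ℕ → Perm → Chain → Set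
InRChain k m w c =
  SatChain k w c × length c ≡ m
  × Linked _≥_ (map proj₁ c)
  × Unique (map proj₁ (labelCells w c))

{-# OPTIONS --safe #-}
-- Evaluate polynomials at integer points with distinct coordinates: a polynomial vanishing at
-- all of them is zero, and ∂ᵢ f is determined there by (xᵢ - xᵢ₊₁) ∂ᵢ f = f - sᵢ f.
-- Monk's rule xₖ 𝔖_w = Σ_{j>k} 𝔖_{w t_kj} - Σ_{i<k} 𝔖_{w t_ik} (over length-increasing t) passes
-- from w sᵢ to w by applying ∂ᵢ, and for the longest element both sides are dominant monomials.
-- The operators [a b], taking w to w t_ab if the length increases by one and to 0 otherwise,
-- satisfy the Fomin–Kirillov relations. These give the sum over the chains with a₁ ≥ ⋯ ≥ aₘ and
-- distinct bᵢ the recursion h_m(k) = h_m(k-1) + xₖ h_{m-1}(k) of the complete homogeneous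
-- polynomials in x₁, …, xₖ, so this sum is h_m(k) 𝔖_ω; and 𝔖_{r[k,m]} = h_m(k).
-- Finally tower w(j) has height #{t < j : w(t) > w(j)}, from which the label of step q
-- is seen to end up in tower ω⁽ᵐ⁾(b_q). Hence (ii) says that the b_q are distinct.
module Submission where

open import Defs
open import Data.Bool using (Bool; true; false; _∧_; if_then_else_; T)
open import Data.Empty using (⊥; ⊥-elim)
open import Data.Unit using (tt)
open import Data.Nat
open import Data.Nat.Properties
open import Data.Integer as ℤ using (ℤ; 0ℤ; 1ℤ)
import Data.Integer.Properties as ℤP
open import Algebra.Properties.CommutativeSemigroup +-commutativeSemigroup
  using () renaming (x∙yz≈y∙xz to +-exchange)
open import Algebra.Properties.CommutativeSemigroup ℤP.+-commutativeSemigroup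
  using () renaming (x∙yz≈y∙xz to +ℤ-exchange; interchange to +ℤ-interchange)
open import Algebra.Properties.CommutativeSemigroup ℤP.*-commutativeSemigroup
  using () renaming (x∙yz≈y∙xz to *-exchange; interchange to *-interchange)
open import Data.Integer.Tactic.RingSolver using (solve-∀)
open import Data.List hiding (lookup; sum; product; head; tail; last)
import Data.List.Properties as LP
open import Data.List.Membership.Propositional using (_∈_; _∉_)
open import Data.List.Membership.Propositional.Properties using (∈-map⁺; ∈-map⁻; ∈-upTo⁺; ∈-upTo⁻; ∈-++⁺ˡ; ∈-++⁺ʳ; ∈-++⁻)
open import Data.List.Relation.Unary.Any using (here; there)
open import Data.List.Relation.Unary.All as All using (All; []; _∷_)
open import Data.List.Relation.Unary.AllPairs as AllPairs using (AllPairs; []; _∷_)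
open import Data.List.Relation.Unary.Unique.Propositional using (Unique)
open import Data.List.Relation.Unary.All.Properties using (++⁻ˡ)
import Data.List.Relation.Unary.Unique.Propositional.Properties as Unique
open import Data.List.Relation.Unary.Linked as Linked using (Linked; []; [-]; _∷_)
open import Data.List.Relation.Unary.Linked.Properties using (Linked⇒AllPairs)
open import Data.List.Relation.Binary.Pointwise.Base using (Pointwise; []; _∷_)
open import Data.List.Relation.Binary.Permutation.Propositional using (↭-sym; ↭⇒↭ₛ)
open import Data.List.Relation.Binary.Permutation.Propositional.Properties using (↭-length; ∈-resp-↭)
import Data.List.Relation.Binary.Permutation.Setoid.Properties as Permutationₛ
open import Data.Maybe using (just; nothing)
open import Data.Product using (_×_; _,_; proj₁; proj₂; ∃-syntax)
open import Data.Sum using (_⊎_; inj₁; inj₂)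
open import Function using (_∘_)
open import Function.Bundles using (_⇔_; mk⇔; Equivalence)
open import Relation.Nullary using (¬_; Dec; yes; no)
open import Relation.Binary.Definitions using (tri<; tri≈; tri>)
open import Relation.Binary.PropositionalEquality

-- The definitions shape the proof in three ways. A `Poly` is a formal sum, so ring laws hold only
-- up to coefficients; values in ℤ obey them strictly, and there the factors xᵢ - xᵢ₊₁ left by
-- clearing divided differences can be cancelled. `schub` descends along first ascents only, so ∂ᵢ
-- 𝔖_{w sᵢ} = 𝔖_w has to be extended to every ascent before an identity can be differentiated at
-- will. Lists are finite: Monk's sum over positions up to N is complete only if the last position
-- is fixed, and each step of a chain can use up one fixed position; hence the computation in
-- S_{n+m}.
--
-- The recursion of h has no direct counterpart on chains, since lowering k to k - 1 forbids k as a
-- first position and at the same time allows it as a second one. Sums over chains therefore carry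
-- both lists of positions as parameters. The resulting recursion holds for arbitrary functions of
-- permutations; Schubert polynomials enter only through Monk's rule.
--
-- For the labels, (i) ensures that the cells removed by a later step at position b reach down at
-- least to the label belonging to b, so this label moves whenever b is used again.

T⇒true : ∀ {b} → T b → b ≡ true
T⇒true {true} _ = refl

¬T⇒false : ∀ {b} → ¬ T b → b ≡ false
¬T⇒false {false} _ = refl
¬T⇒false {true} n = ⊥-elim (n tt)

<ᵇ-yes : ∀ {m n} → m < n → (m <ᵇ n) ≡ true
<ᵇ-yes p = T⇒true (<⇒<ᵇ p)

<ᵇ-no : ∀ {m n} → n ≤ m → (m <ᵇ n) ≡ false
<ᵇ-no {m} {n} p = ¬T⇒false (λ t → <⇒≱ (<ᵇ⇒< m n t) p)

≡ᵇ-yes : ∀ {m n} → m ≡ n → (m ≡ᵇ n) ≡ true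
≡ᵇ-yes {m} {n} p = T⇒true (≡⇒≡ᵇ m n p)

≡ᵇ-no : ∀ {m n} → m ≢ n → (m ≡ᵇ n) ≡ false
≡ᵇ-no {m} {n} p = ¬T⇒false (λ t → p (≡ᵇ⇒≡ m n t))

≤ᵇ-yes : ∀ {m n} → m ≤ n → (m ≤ᵇ n) ≡ true
≤ᵇ-yes p = T⇒true (≤⇒≤ᵇ p)

≤ᵇ-no : ∀ {m n} → n < m → (m ≤ᵇ n) ≡ false
≤ᵇ-no {m} {n} p = ¬T⇒false (λ t → <⇒≱ p (≤ᵇ⇒≤ m n t))

-- Transpositions of positions

transp-a : ∀ a b → transp a b a ≡ b
transp-a a b rewrite ≡ᵇ-yes {a} {a} refl = refl

transp-b : ∀ a b → transp a b b ≡ a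
transp-b a b with b ≟ a
... | yes refl rewrite ≡ᵇ-yes {a} {a} refl = refl
... | no n rewrite ≡ᵇ-no n | ≡ᵇ-yes {b} {b} refl = refl

transp-o : ∀ {a b j} → j ≢ a → j ≢ b → transp a b j ≡ j
transp-o n m rewrite ≡ᵇ-no n | ≡ᵇ-no m = refl

data TranspView (a b j : ℕ) : ℕ → Set where
  at-a : j ≡ a → TranspView a b j b
  at-b : j ≡ b → TranspView a b j a
  off  : j ≢ a → j ≢ b → TranspView a b j j

transp-view : ∀ a b j → TranspView a b j (transp a b j)
transp-view a b j with j ≟ a
... | yes refl = subst (TranspView a b j) (sym (transp-a a b)) (at-a refl)
... | no n with j ≟ b
...   | yes refl = subst (TranspView a b j) (sym (transp-b a b)) (at-b refl)
...   | no m = subst (TranspView a b j) (sym (transp-o n m)) (off n m)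

transp-invol : ∀ a b j → transp a b (transp a b j) ≡ j
transp-invol a b j with transp a b j | transp-view a b j
... | _ | at-a refl = transp-b a b
... | _ | at-b refl = transp-a a b
... | _ | off n m = transp-o n m

transp-inj : ∀ a b {i j} → transp a b i ≡ transp a b j → i ≡ j
transp-inj a b {i} {j} p = trans (sym (transp-invol a b i)) (trans (cong (transp a b) p) (transp-invol a b j))

-- The common source of two facts: with σ a transposition it is conjugation, with σ = `suc` it is
-- the shift between one-based positions and zero-based list indices.
transp-nat : ∀ (σ : ℕ → ℕ) → (∀ {i j} → σ i ≡ σ j → i ≡ j) → ∀ a b j
  → σ (transp a b j) ≡ transp (σ a) (σ b) (σ j)
transp-nat σ inj a b j with transp a b j | transp-view a b j
... | _ | at-a refl = sym (transp-a (σ a) (σ b))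
... | _ | at-b refl = sym (transp-b (σ a) (σ b))
... | _ | off n m = sym (transp-o (n ∘ inj) (m ∘ inj))

transp-conj : ∀ c d a b j → transp c d (transp a b j) ≡ transp (transp c d a) (transp c d b) (transp c d j)
transp-conj c d = transp-nat (transp c d) (transp-inj c d)

transp-suc : ∀ a b j → suc (transp a b j) ≡ transp (suc a) (suc b) (suc j)
transp-suc = transp-nat suc suc-injective

transp-comm : ∀ {a b c d} → a ≢ c → a ≢ d → b ≢ c → b ≢ d → ∀ j
  → transp a b (transp c d j) ≡ transp c d (transp a b j)
transp-comm {a} {b} {c} {d} p q r s j =
  trans (transp-conj a b c d j)
        (cong₂ (λ x y → transp x y (transp a b j)) (transp-o (p ∘ sym) (r ∘ sym)) (transp-o (q ∘ sym) (s ∘ sym)))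

-- Evaluation of polynomials at integer points

-- The variable x_j takes the value at index j; evaluation reads no coordinate at 0.
Point : Set
Point = ℕ → ℤ

swapP : ℕ → Point → Point
swapP i r = r ∘ transp i (suc i)

evM : Mono → Point → ℤ
evM [] r = 1ℤ
evM (x ∷ e) r = r 1 ℤ.^ x ℤ.* evM e (r ∘ suc)

ev : Poly → Point → ℤ
ev [] r = 0ℤ
ev ((c , e) ∷ p) r = c ℤ.* evM e r ℤ.+ ev p r

evM-cong : ∀ e {r r' : Point} → (∀ j → r (suc j) ≡ r' (suc j)) → evM e r ≡ evM e r'
evM-cong [] h = refl
evM-cong (x ∷ e) {r} {r'} h = cong₂ (λ u v → u ℤ.^ x ℤ.* v) (h 0) (evM-cong e {r ∘ suc} {r' ∘ suc} (λ j → h (suc j)))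

ev-cong : ∀ p {r r' : Point} → (∀ j → r (suc j) ≡ r' (suc j)) → ev p r ≡ ev p r'
ev-cong [] h = refl
ev-cong ((c , e) ∷ p) {r} {r'} h = cong₂ (λ u v → c ℤ.* u ℤ.+ v) (evM-cong e {r} {r'} h) (ev-cong p {r} {r'} h)

ev-++ : ∀ p q r → ev (p ++ q) r ≡ ev p r ℤ.+ ev q r
ev-++ [] q r = sym (ℤP.+-identityˡ _)
ev-++ ((c , e) ∷ p) q r rewrite ev-++ p q r = sym (ℤP.+-assoc (c ℤ.* evM e r) (ev p r) (ev q r))

evM-addMono : ∀ e f r → evM (addMono e f) r ≡ evM e r ℤ.* evM f r
evM-addMono [] f r = sym (ℤP.*-identityˡ _)
evM-addMono (x ∷ e) [] r = sym (ℤP.*-identityʳ _)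
evM-addMono (x ∷ e) (y ∷ f) r
  rewrite evM-addMono e f (r ∘ suc) | ℤP.^-distribˡ-+-* (r 1) x y
  = *-interchange (r 1 ℤ.^ x) (r 1 ℤ.^ y) (evM e (r ∘ suc)) (evM f (r ∘ suc))

ev-*P : ∀ p q r → ev (p *P q) r ≡ ev p r ℤ.* ev q r
ev-*P [] q r = refl
ev-*P ((c , e) ∷ p) q r =
  trans (ev-++ (map (λ u → (c ℤ.* proj₁ u , addMono e (proj₂ u))) q) (p *P q) r)
  (trans (cong₂ ℤ._+_ (term q) (ev-*P p q r))
         (sym (ℤP.*-distribʳ-+ (ev q r) (c ℤ.* evM e r) (ev p r))))
  where
  lem : ∀ c d x y z → (c ℤ.* d) ℤ.* (x ℤ.* y) ℤ.+ (c ℤ.* x) ℤ.* z ≡ (c ℤ.* x) ℤ.* (d ℤ.* y ℤ.+ z)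
  lem = solve-∀
  term : ∀ q → ev (map (λ u → (c ℤ.* proj₁ u , addMono e (proj₂ u))) q) r ≡ (c ℤ.* evM e r) ℤ.* ev q r
  term [] = sym (ℤP.*-zeroʳ (c ℤ.* evM e r))
  term ((d , f) ∷ q) rewrite term q | evM-addMono e f r = lem c d (evM e r) (evM f r) (ev q r)

sumℤ : List ℤ → ℤ
sumℤ = foldr ℤ._+_ 0ℤ

ev-sumP : ∀ ps r → ev (sumP ps) r ≡ sumℤ (map (λ p → ev p r) ps)
ev-sumP [] r = refl
ev-sumP (p ∷ ps) r rewrite ev-++ p (sumP ps) r | ev-sumP ps r = refl

negP : Poly → Poly
negP = map (λ t → (ℤ.- proj₁ t , proj₂ t))

ev-negP : ∀ p r → ev (negP p) r ≡ ℤ.- ev p r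
ev-negP [] r = refl
ev-negP ((c , e) ∷ p) r rewrite ev-negP p r = lem c (evM e r) (ev p r)
  where
  lem : ∀ c x y → (ℤ.- c) ℤ.* x ℤ.+ (ℤ.- y) ≡ ℤ.- (c ℤ.* x ℤ.+ y)
  lem = solve-∀

coeff-++ : ∀ p q e → coeff (p ++ q) e ≡ coeff p e ℤ.+ coeff q e
coeff-++ [] q e = sym (ℤP.+-identityˡ _)
coeff-++ ((c , f) ∷ p) q e rewrite coeff-++ p q e =
  sym (ℤP.+-assoc (if monoEq e f then c else 0ℤ) (coeff p e) (coeff q e))

coeff-negP : ∀ p e → coeff (negP p) e ≡ ℤ.- coeff p e
coeff-negP [] e = refl
coeff-negP ((c , f) ∷ p) e rewrite coeff-negP p e with monoEq e f
... | true = sym (ℤP.neg-distrib-+ c (coeff p e))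
... | false = trans (ℤP.+-identityˡ _) (cong ℤ.-_ (sym (ℤP.+-identityˡ (coeff p e))))

-- Divided differences

-- What remains of a monomial without the powers of the two variables that a divided difference
-- touches, x_{i+1} and x_{i+2} for the zero-based index i.
restM : ℕ → Mono → Point → ℤ
restM zero (x ∷ y ∷ e) r = evM e (r ∘ suc ∘ suc)
restM zero _ r = 1ℤ
restM (suc i) [] r = 1ℤ
restM (suc i) (x ∷ e) r = r 1 ℤ.^ x ℤ.* restM i e (r ∘ suc)

restM-cong : ∀ i e {r r' : Point} → (∀ j → j ≢ suc i → j ≢ 2+ i → r j ≡ r' j) → restM i e r ≡ restM i e r'
restM-cong zero [] h = refl
restM-cong zero (x ∷ []) h = refl
restM-cong zero (x ∷ y ∷ e) {r} {r'} h =
  evM-cong e {r ∘ suc ∘ suc} {r' ∘ suc ∘ suc} (λ j → h (suc (2+ j)) (λ ()) (λ ()))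
restM-cong (suc i) [] h = refl
restM-cong (suc i) (x ∷ e) h =
  cong₂ (λ u v → u ℤ.^ x ℤ.* v) (h 1 (λ ()) (λ ()))
        (restM-cong i e (λ j p q → h (suc j) (p ∘ suc-injective) (q ∘ suc-injective)))

*-rotate : ∀ a b c d → a ℤ.* (b ℤ.* (c ℤ.* d)) ≡ b ℤ.* (c ℤ.* (a ℤ.* d))
*-rotate = solve-∀

evM-split : ∀ i e r → evM e r ≡ r (suc i) ℤ.^ lookupD 0 e i ℤ.* (r (2+ i) ℤ.^ lookupD 0 e (suc i) ℤ.* restM i e r)
evM-split zero [] r = refl
evM-split zero (x ∷ []) r = refl
evM-split zero (x ∷ y ∷ e) r = refl
evM-split (suc i) [] r = refl
evM-split (suc i) (x ∷ e) r rewrite evM-split i e (r ∘ suc) =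
  *-rotate (r 1 ℤ.^ x) (r (2+ i) ℤ.^ lookupD 0 e i) (r (suc (2+ i)) ℤ.^ lookupD 0 e (suc i)) (restM i e (r ∘ suc))

evM-put : ∀ i e u v r → evM (setAt (setAt e i u) (suc i) v) r ≡ r (suc i) ℤ.^ u ℤ.* (r (2+ i) ℤ.^ v ℤ.* restM i e r)
evM-put zero [] u v r = refl
evM-put zero (x ∷ []) u v r = refl
evM-put zero (x ∷ y ∷ e) u v r = refl
evM-put (suc i) [] u v r rewrite evM-put i [] u v (r ∘ suc) = trans (ℤP.*-identityˡ _) (cong (λ z → r (2+ i) ℤ.^ u ℤ.* (r (suc (2+ i)) ℤ.^ v ℤ.* z)) (restM-[] i))
  where
  restM-[] : ∀ i → restM i [] (r ∘ suc) ≡ 1ℤ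
  restM-[] zero = refl
  restM-[] (suc i) = refl
evM-put (suc i) (x ∷ e) u v r rewrite evM-put i e u v (r ∘ suc) =
  *-rotate (r 1 ℤ.^ x) (r (2+ i) ℤ.^ u) (r (suc (2+ i)) ℤ.^ v) (restM i e (r ∘ suc))

ev-telescope : ∀ d (g : ℕ → ℤ × Mono) (t : ℕ → ℤ) X r
  → (∀ j → j < d → X ℤ.* (proj₁ (g j) ℤ.* evM (proj₂ (g j)) r) ≡ t j ℤ.- t (suc j))
  → X ℤ.* ev (applyUpTo g d) r ≡ t 0 ℤ.- t d
ev-telescope zero g t X r h = trans (ℤP.*-zeroʳ X) (sym (ℤP.+-inverseʳ (t 0)))
ev-telescope (suc d) g t X r h =
  trans (ℤP.*-distribˡ-+ X (proj₁ (g 0) ℤ.* evM (proj₂ (g 0)) r) (ev (applyUpTo (g ∘ suc) d) r))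
  (trans (cong₂ ℤ._+_ (h 0 z<s) (ev-telescope d (g ∘ suc) (t ∘ suc) X r (λ j p → h (suc j) (s<s p))))
         (lem (t 0) (t 1) (t (suc d))))
  where
  lem : ∀ a b c → (a ℤ.- b) ℤ.+ (b ℤ.- c) ≡ a ℤ.- c
  lem = solve-∀

-- The explicit formula for ∂ on a monomial is a geometric sum, which telescopes after
-- multiplication by x - y. The larger exponent is written d + b so that the number of terms is a
-- variable.
ev-geom : ∀ d b c x y R (put : ℕ → ℕ → Mono) r
  → (∀ u v → evM (put u v) r ≡ x ℤ.^ u ℤ.* (y ℤ.^ v ℤ.* R))
  → (x ℤ.- y) ℤ.* ev (map (λ j → (c , put ((d + b) ∸ suc j) (b + j))) (upTo d)) r
    ≡ c ℤ.* (x ℤ.^ (d + b) ℤ.* (y ℤ.^ b ℤ.* R)) ℤ.- c ℤ.* (x ℤ.^ b ℤ.* (y ℤ.^ (d + b) ℤ.* R))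
ev-geom d b c x y R put r h =
  trans (cong (λ l → (x ℤ.- y) ℤ.* ev l r) (LP.map-upTo _ d))
  (trans (ev-telescope d _ t (x ℤ.- y) r step)
  (cong₂ ℤ._-_ (cong (λ m → c ℤ.* (x ℤ.^ (d + b) ℤ.* (y ℤ.^ m ℤ.* R))) (+-identityʳ b))
               (cong₂ (λ m n → c ℤ.* (x ℤ.^ m ℤ.* (y ℤ.^ n ℤ.* R))) (m+n∸m≡n d b) (+-comm b d))))
  where
  t : ℕ → ℤ
  t j = c ℤ.* (x ℤ.^ ((d + b) ∸ j) ℤ.* (y ℤ.^ (b + j) ℤ.* R))
  lem : ∀ c x y p q R → (x ℤ.- y) ℤ.* (c ℤ.* (p ℤ.* (q ℤ.* R)))
      ≡ c ℤ.* ((x ℤ.* p) ℤ.* (q ℤ.* R)) ℤ.- c ℤ.* (p ℤ.* ((y ℤ.* q) ℤ.* R))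
  lem = solve-∀
  step : ∀ j → j < d → (x ℤ.- y) ℤ.* (c ℤ.* evM (put ((d + b) ∸ suc j) (b + j)) r) ≡ t j ℤ.- t (suc j)
  step j p rewrite h ((d + b) ∸ suc j) (b + j) | +-suc b j
    | +-∸-assoc 1 {d + b} {suc j} (≤-trans p (m≤m+n d b)) =
    lem c x y (x ℤ.^ ((d + b) ∸ suc j)) (y ℤ.^ (b + j)) R

ddTerm-spec : ∀ i c e r
  → (r (suc i) ℤ.- r (2+ i)) ℤ.* ev (ddTerm (suc i) (c , e)) r
    ≡ c ℤ.* evM e r ℤ.- c ℤ.* evM e (swapP (suc i) r)
ddTerm-spec i c e r = trans body (cong₂ (λ u v → c ℤ.* u ℤ.- c ℤ.* v) (sym (evM-split i e r)) (sym swapped))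
  where
  a = lookupD 0 e i
  b = lookupD 0 e (suc i)
  x = r (suc i)
  y = r (2+ i)
  R = restM i e r
  put : ℕ → ℕ → Mono
  put u v = setAt (setAt e i u) (suc i) v
  swapped : evM e (swapP (suc i) r) ≡ x ℤ.^ b ℤ.* (y ℤ.^ a ℤ.* R)
  swapped rewrite evM-split i e (swapP (suc i) r)
    | transp-a (suc i) (2+ i) | transp-b (suc i) (2+ i)
    | restM-cong i e {swapP (suc i) r} {r} (λ j p q → cong r (transp-o p q)) = *-exchange (y ℤ.^ a) (x ℤ.^ b) R
  larger : b ≤ a → (x ℤ.- y) ℤ.* ev (map (λ j → (c , put (a ∸ suc j) (b + j))) (upTo (a ∸ b))) r
    ≡ c ℤ.* (x ℤ.^ a ℤ.* (y ℤ.^ b ℤ.* R)) ℤ.- c ℤ.* (x ℤ.^ b ℤ.* (y ℤ.^ a ℤ.* R))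
  larger p = subst (λ z → (x ℤ.- y) ℤ.* ev (map (λ j → (c , put (z ∸ suc j) (b + j))) (upTo (a ∸ b))) r
    ≡ c ℤ.* (x ℤ.^ z ℤ.* (y ℤ.^ b ℤ.* R)) ℤ.- c ℤ.* (x ℤ.^ b ℤ.* (y ℤ.^ z ℤ.* R)))
    (m∸n+n≡m p) (ev-geom (a ∸ b) b c x y R put r (λ u v → evM-put i e u v r))
  small : a ≤ b → (x ℤ.- y) ℤ.* ev (map (λ j → (ℤ.- c , put (b ∸ suc j) (a + j))) (upTo (b ∸ a))) r
    ≡ (ℤ.- c) ℤ.* (x ℤ.^ b ℤ.* (y ℤ.^ a ℤ.* R)) ℤ.- (ℤ.- c) ℤ.* (x ℤ.^ a ℤ.* (y ℤ.^ b ℤ.* R))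
  small p = subst (λ z → (x ℤ.- y) ℤ.* ev (map (λ j → (ℤ.- c , put (z ∸ suc j) (a + j))) (upTo (b ∸ a))) r
    ≡ (ℤ.- c) ℤ.* (x ℤ.^ z ℤ.* (y ℤ.^ a ℤ.* R)) ℤ.- (ℤ.- c) ℤ.* (x ℤ.^ a ℤ.* (y ℤ.^ z ℤ.* R)))
    (m∸n+n≡m p) (ev-geom (b ∸ a) a (ℤ.- c) x y R put r (λ u v → evM-put i e u v r))
  flip : ∀ c p q → (ℤ.- c) ℤ.* p ℤ.- (ℤ.- c) ℤ.* q ≡ c ℤ.* q ℤ.- c ℤ.* p
  flip = solve-∀
  body : (x ℤ.- y) ℤ.* ev (ddTerm (suc i) (c , e)) r
    ≡ c ℤ.* (x ℤ.^ a ℤ.* (y ℤ.^ b ℤ.* R)) ℤ.- c ℤ.* (x ℤ.^ b ℤ.* (y ℤ.^ a ℤ.* R))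
  body with b ≤? a
  ... | yes p rewrite ≤ᵇ-yes p = larger p
  ... | no p rewrite ≤ᵇ-no (≰⇒> p) = trans (small (<⇒≤ (≰⇒> p))) (flip c _ _)

∂-spec : ∀ i p r → (r (suc i) ℤ.- r (2+ i)) ℤ.* ev (∂ (suc i) p) r ≡ ev p r ℤ.- ev p (swapP (suc i) r)
∂-spec i [] r = ℤP.*-zeroʳ (r (suc i) ℤ.- r (2+ i))
∂-spec i ((c , e) ∷ p) r =
  trans (cong ((r (suc i) ℤ.- r (2+ i)) ℤ.*_) (ev-++ (ddTerm (suc i) (c , e)) (∂ (suc i) p) r))
  (trans (ℤP.*-distribˡ-+ (r (suc i) ℤ.- r (2+ i)) (ev (ddTerm (suc i) (c , e)) r) (ev (∂ (suc i) p) r))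
  (trans (cong₂ ℤ._+_ (ddTerm-spec i c e r) (∂-spec i p r))
         (lem (c ℤ.* evM e r) (c ℤ.* evM e (swapP (suc i) r)) (ev p r) (ev p (swapP (suc i) r)))))
  where
  lem : ∀ a b c d → (a ℤ.- b) ℤ.+ (c ℤ.- d) ≡ (a ℤ.+ c) ℤ.- (b ℤ.+ d)
  lem = solve-∀

-- Vanishing at all points with distinct coordinates

-- Only adjacent differences are ever denominators, but distinctness of all K coordinates, unlike
-- that of neighbours, survives permuting them.
Distinct : ℕ → Point → Set
Distinct K r = ∀ i j → 1 ≤ i → i < j → j ≤ K → r i ≢ r j

-- Horner form of the polynomial in x with coefficients g 0, ..., g (D - 1).
uni : (ℕ → ℤ) → ℕ → ℤ → ℤ
uni g zero x = 0ℤ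
uni g (suc D) x = g 0 ℤ.+ x ℤ.* uni (g ∘ suc) D x

uni-cong : ∀ D {g h : ℕ → ℤ} x → (∀ d → g d ≡ h d) → uni g D x ≡ uni h D x
uni-cong zero x p = refl
uni-cong (suc D) x p = cong₂ (λ u v → u ℤ.+ x ℤ.* v) (p 0) (uni-cong D x (λ d → p (suc d)))

uni-+ : ∀ D g h x → uni (λ d → g d ℤ.+ h d) D x ≡ uni g D x ℤ.+ uni h D x
uni-+ zero g h x = refl
uni-+ (suc D) g h x rewrite uni-+ D (g ∘ suc) (h ∘ suc) x = lem (g 0) (h 0) x (uni (g ∘ suc) D x) (uni (h ∘ suc) D x)
  where
  lem : ∀ a b x u v → (a ℤ.+ b) ℤ.+ x ℤ.* (u ℤ.+ v) ≡ (a ℤ.+ x ℤ.* u) ℤ.+ (b ℤ.+ x ℤ.* v)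
  lem = solve-∀

uni-0 : ∀ D x → uni (λ _ → 0ℤ) D x ≡ 0ℤ
uni-0 zero x = refl
uni-0 (suc D) x rewrite uni-0 D x = trans (ℤP.+-identityˡ _) (ℤP.*-zeroʳ x)

uni-δ : ∀ D k v x → k < D → uni (λ d → if d ≡ᵇ k then v else 0ℤ) D x ≡ x ℤ.^ k ℤ.* v
uni-δ (suc D) zero v x p rewrite uni-0 D x | ℤP.*-zeroʳ x = trans (ℤP.+-identityʳ v) (sym (ℤP.*-identityˡ v))
uni-δ (suc D) (suc k) v x (s<s p) rewrite uni-δ D k v x p =
  trans (ℤP.+-identityˡ _) (sym (ℤP.*-assoc x (x ℤ.^ k) v))

-- The constant term is divisible by every large x, hence zero.
uni-zero : ∀ D g M → (∀ n → M ≤ n → uni g D (ℤ.+ n) ≡ 0ℤ) → ∀ d → d < D → g d ≡ 0ℤ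
uni-zero (suc D) g M h = λ { zero _ → g0 ; (suc d) (s<s p) → uni-zero D (g ∘ suc) (suc M) h' d p }
  where
  -- One argument beyond both M and |g 0| suffices: a multiple of n₀ of absolute value below n₀ is
  -- zero.
  n₀ = M + suc ℤ.∣ g 0 ∣
  q = uni (g ∘ suc) D (ℤ.+ n₀)
  eq : g 0 ≡ ℤ.- (ℤ.+ n₀ ℤ.* q)
  eq = trans (lem (g 0) (ℤ.+ n₀ ℤ.* q)) (trans (cong (ℤ._- (ℤ.+ n₀ ℤ.* q)) (h n₀ (m≤m+n M _))) (ℤP.+-identityˡ _))
    where
    lem : ∀ a b → a ≡ (a ℤ.+ b) ℤ.- b
    lem = solve-∀
  absEq : ℤ.∣ g 0 ∣ ≡ n₀ * ℤ.∣ q ∣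
  absEq = trans (cong ℤ.∣_∣ eq) (trans (ℤP.∣-i∣≡∣i∣ (ℤ.+ n₀ ℤ.* q)) (ℤP.abs-* (ℤ.+ n₀) q))
  small : ∀ c k → c ≡ (M + suc c) * k → c ≡ 0
  small c zero e = trans e (*-zeroʳ (M + suc c))
  small c (suc k) e = ⊥-elim (<-irrefl e (≤-trans (m≤n+m (suc c) M) (m≤m*n (M + suc c) (suc k))))
  g0 : g 0 ≡ 0ℤ
  g0 = ℤP.∣i∣≡0⇒i≡0 (small _ _ absEq)
  -- The bound rises to `suc M` to keep the cancelled argument n away from zero.
  h' : ∀ n → suc M ≤ n → uni (g ∘ suc) D (ℤ.+ n) ≡ 0ℤ
  h' (suc n) p = ℤP.*-cancelˡ-≡ (ℤ.+ suc n) (uni (g ∘ suc) D (ℤ.+ suc n)) 0ℤ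
    (trans (sym (ℤP.+-identityˡ _))
    (trans (cong (ℤ._+ (ℤ.+ suc n ℤ.* uni (g ∘ suc) D (ℤ.+ suc n))) (sym g0))
    (trans (h (suc n) (≤-trans (n≤1+n M) p)) (sym (ℤP.*-zeroʳ (ℤ.+ suc n))))))

-- slice d p is the coefficient of x₁^d in p, with the remaining variables renumbered.
slice : ℕ → Poly → Poly
slice d [] = []
slice zero ((c , []) ∷ p) = (c , []) ∷ slice zero p
slice (suc d) ((c , []) ∷ p) = slice (suc d) p
slice d ((c , x ∷ e) ∷ p) = if d ≡ᵇ x then (c , e) ∷ slice d p else slice d p

coeff-slice : ∀ p d e → coeff p (d ∷ e) ≡ coeff (slice d p) e
coeff-slice [] d e = refl
coeff-slice ((c , []) ∷ p) zero e rewrite coeff-slice p zero e = refl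
coeff-slice ((c , []) ∷ p) (suc d) e = trans (ℤP.+-identityˡ _) (coeff-slice p (suc d) e)
coeff-slice ((c , x ∷ f) ∷ p) zero e with 0 ≡ᵇ x
... | true = cong (λ z → (if monoEq e f then c else 0ℤ) ℤ.+ z) (coeff-slice p zero e)
... | false = trans (ℤP.+-identityˡ _) (coeff-slice p zero e)
coeff-slice ((c , x ∷ f) ∷ p) (suc d) e with suc d ≡ᵇ x
... | true = cong (λ z → (if monoEq e f then c else 0ℤ) ℤ.+ z) (coeff-slice p (suc d) e)
... | false = trans (ℤP.+-identityˡ _) (coeff-slice p (suc d) e)

coeff-[] : ∀ p → coeff p [] ≡ coeff p (0 ∷ [])
coeff-[] [] = refl
coeff-[] ((c , []) ∷ p) = cong (λ z → c ℤ.+ z) (coeff-[] p)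
coeff-[] ((c , zero ∷ f) ∷ p) = cong (λ z → (if monoEq [] f then c else 0ℤ) ℤ.+ z) (coeff-[] p)
coeff-[] ((c , suc x ∷ f) ∷ p) = cong (λ z → 0ℤ ℤ.+ z) (coeff-[] p)

-- Exceeds every exponent of x₁, and is at least 1 so that the Horner sum always contains the
-- constant coefficient, where empty monomials land.
degBound : Poly → ℕ
degBound [] = 1
degBound ((c , []) ∷ p) = degBound p
degBound ((c , x ∷ e) ∷ p) = suc x ⊔ degBound p

degBound-pos : ∀ p → 1 ≤ degBound p
degBound-pos [] = ≤-refl
degBound-pos ((c , []) ∷ p) = degBound-pos p
degBound-pos ((c , x ∷ e) ∷ p) = ≤-trans (degBound-pos p) (m≤n⊔m (suc x) _)

ev-slice : ∀ p D r → degBound p ≤ D → ev p r ≡ uni (λ d → ev (slice d p) (r ∘ suc)) D (r 1)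
ev-slice [] D r h = sym (uni-0 D (r 1))
ev-slice ((c , []) ∷ p) D r h =
  trans (cong₂ ℤ._+_ (sym (trans (uni-δ D 0 (c ℤ.* 1ℤ) (r 1) (≤-trans (degBound-pos p) h)) (ℤP.*-identityˡ _))) (ev-slice p D r h))
  (trans (sym (uni-+ D _ _ (r 1))) (uni-cong D (r 1) λ { zero → refl ; (suc d) → ℤP.+-identityˡ _ }))
ev-slice ((c , x ∷ e) ∷ p) D r h =
  trans (cong₂ ℤ._+_ headT (ev-slice p D r (≤-trans (m≤n⊔m (suc x) _) h)))
  (trans (sym (uni-+ D _ _ (r 1))) (uni-cong D (r 1) pointwise))
  where
  headT : c ℤ.* (r 1 ℤ.^ x ℤ.* evM e (r ∘ suc)) ≡ uni (λ d → if d ≡ᵇ x then c ℤ.* evM e (r ∘ suc) else 0ℤ) D (r 1)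
  headT = trans (*-exchange c (r 1 ℤ.^ x) (evM e (r ∘ suc))) (sym (uni-δ D x _ (r 1) (≤-trans (m≤m⊔n (suc x) (degBound p)) h)))
  pointwise : ∀ d → (if d ≡ᵇ x then c ℤ.* evM e (r ∘ suc) else 0ℤ) ℤ.+ ev (slice d p) (r ∘ suc) ≡ ev (slice d ((c , x ∷ e) ∷ p)) (r ∘ suc)
  pointwise zero with 0 ≡ᵇ x
  ... | true = refl
  ... | false = ℤP.+-identityˡ _
  pointwise (suc d) with suc d ≡ᵇ x
  ... | true = refl
  ... | false = ℤP.+-identityˡ _

Short : ℕ → Poly → Set
Short L = All (λ t → length (proj₂ t) ≤ L)

slice-short : ∀ {L} d p → Short (suc L) p → Short L (slice d p)
slice-short d [] [] = []
slice-short zero ((c , []) ∷ p) (_ ∷ h) = z≤n ∷ slice-short zero p h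
slice-short (suc d) ((c , []) ∷ p) (_ ∷ h) = slice-short (suc d) p h
slice-short zero ((c , x ∷ e) ∷ p) (s≤s q ∷ h) with 0 ≡ᵇ x
... | true = q ∷ slice-short zero p h
... | false = slice-short zero p h
slice-short (suc d) ((c , x ∷ e) ∷ p) (s≤s q ∷ h) with suc d ≡ᵇ x
... | true = q ∷ slice-short (suc d) p h
... | false = slice-short (suc d) p h

absSum : ℕ → Point → ℕ
absSum zero r = 0
absSum (suc K) r = ℤ.∣ r (suc K) ∣ + absSum K r

absSum-≥ : ∀ K r j → j < K → ℤ.∣ r (suc j) ∣ ≤ absSum K r
absSum-≥ (suc K) r j p with m≤n⇒m<n∨m≡n p
... | inj₁ (s<s q) = ≤-trans (absSum-≥ K r j q) (m≤n+m _ _)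
... | inj₂ refl = m≤m+n _ _

consP : ℤ → Point → Point
consP x r zero = x
consP x r (suc zero) = x
consP x r (2+ j) = r (suc j)

-- `absSum` bounds the absolute value of each old coordinate, so any n beyond it is new.
consP-distinct : ∀ K r n → Distinct (pred K) r → absSum K r < n → Distinct K (consP (ℤ.+ n) r)
consP-distinct K r n d b (suc zero) (2+ j) _ _ q e =
  <⇒≱ b (subst (_≤ absSum K r) (cong ℤ.∣_∣ (sym e)) (absSum-≥ K r j (≤-trans (n≤1+n _) q)))
consP-distinct (suc K) r n d b (2+ i) (2+ j) _ p (s≤s q) e = d (suc i) (suc j) z<s (s<s⁻¹ p) q e
consP-distinct K r n d b (suc i) (suc zero) _ (s<s ()) q e

-- Induction on the number L of variables. For fixed remaining coordinates, p is a polynomial in x₁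
-- alone that vanishes at all large integers; hence its coefficients, the values of the slices,
-- vanish. K is independent of L and loses the coordinate that is split off.
coeff-zero : ∀ L K p → Short L p → (∀ r → Distinct K r → ev p r ≡ 0ℤ) → ∀ e → coeff p e ≡ 0ℤ
coeff-zero zero K p sh h e = trans (constant p sh) (lem (h (λ j → ℤ.+ j) (λ i j _ q _ w → <-irrefl (ℤP.+-injective w) q)))
  where
  constant : ∀ p → Short 0 p → coeff p e ≡ (if monoEq e [] then ev p (λ j → ℤ.+ j) else 0ℤ)
  constant [] [] with monoEq e []
  ... | true = refl
  ... | false = refl
  constant ((c , []) ∷ p) (_ ∷ s) rewrite constant p s with monoEq e []
  ... | true = cong (ℤ._+ ev p (λ j → ℤ.+ j)) (sym (ℤP.*-identityʳ c))
  ... | false = refl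
  lem : ev p (λ j → ℤ.+ j) ≡ 0ℤ → (if monoEq e [] then ev p (λ j → ℤ.+ j) else 0ℤ) ≡ 0ℤ
  lem q with monoEq e []
  ... | true = q
  ... | false = refl
coeff-zero (suc L) K p sh h = λ { [] → trans (coeff-[] p) (cons 0 []) ; (d ∷ e) → cons d e }
  where
  cons : ∀ d e → coeff p (d ∷ e) ≡ 0ℤ
  cons d e = trans (coeff-slice p d e) (coeff-zero L (pred K) (slice d p) (slice-short d p sh) h' e)
    where
    h' : ∀ r → Distinct (pred K) r → ev (slice d p) r ≡ 0ℤ
    h' r dr = uni-zero D (λ d → ev (slice d p) r) (suc (absSum K r)) vanish d (m≤m⊔n (suc d) (degBound p))
      where
      D = suc d ⊔ degBound p
      vanish : ∀ n → suc (absSum K r) ≤ n → uni (λ d → ev (slice d p) r) D (ℤ.+ n) ≡ 0ℤ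
      vanish n b = trans (uni-cong D (ℤ.+ n) (λ d → ev-cong (slice d p) {r} {consP (ℤ.+ n) r ∘ suc} (λ j → refl)))
        (trans (sym (ev-slice p D (consP (ℤ.+ n) r) (m≤n⊔m (suc d) (degBound p)))) (h _ (consP-distinct K r n dr b)))

short-exists : ∀ p → ∃[ L ] Short L p
short-exists [] = 0 , []
short-exists ((c , e) ∷ p) with short-exists p
... | L , s = length e ⊔ L , m≤m⊔n _ _ ∷ All.map (λ q → ≤-trans q (m≤n⊔m _ _)) s

ev⇒≈P : ∀ K p q → (∀ r → Distinct K r → ev p r ≡ ev q r) → p ≈P q
ev⇒≈P K p q h e = ℤP.i-j≡0⇒i≡j (coeff p e) (coeff q e)
  (trans (cong (λ z → coeff p e ℤ.+ z) (sym (coeff-negP q e)))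
  (trans (sym (coeff-++ p (negP q) e))
  (coeff-zero (proj₁ (short-exists (p ++ negP q))) K (p ++ negP q) (proj₂ (short-exists (p ++ negP q)))
    (λ r d → trans (ev-++ p (negP q) r) (trans (cong (λ z → ev p r ℤ.+ z) (ev-negP q r))
      (trans (cong (ℤ._- ev q r) (h r d)) (ℤP.+-inverseʳ (ev q r))))) e)))

-- One-line notation

get : List ℕ → ℕ → ℕ
get = lookupD 0

lookupD-in : ∀ w {i} d → i < length w → lookupD d w i ≡ get w i
lookupD-in (x ∷ w) {zero} d p = refl
lookupD-in (x ∷ w) {suc i} d (s<s p) = lookupD-in w d p

lookupD-out : ∀ w {i} d → length w ≤ i → lookupD d w i ≡ d
lookupD-out [] d p = refl
lookupD-out (x ∷ w) {suc i} d (s≤s p) = lookupD-out w d p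

app-in : ∀ w {i} → i < length w → app w (suc i) ≡ get w i
app-in w p = lookupD-in w _ p

app-out : ∀ w {j} → length w < j → app w j ≡ j
app-out w {suc i} (s≤s p) = lookupD-out w (suc i) p

get-ext : ∀ v w → length v ≡ length w → (∀ i → i < length v → get v i ≡ get w i) → v ≡ w
get-ext [] [] p h = refl
get-ext (x ∷ v) (y ∷ w) p h = cong₂ _∷_ (h 0 z<s) (get-ext v w (suc-injective p) (λ i q → h (suc i) (s<s q)))

app-ext : ∀ v w → length v ≡ length w → (∀ j → app v j ≡ app w j) → v ≡ w
app-ext v w p h = get-ext v w p (λ i q → trans (sym (app-in v q)) (trans (h (suc i)) (app-in w (subst (i <_) p q))))

get-applyUpTo : ∀ f L {i} → i < L → get (applyUpTo f L) i ≡ f i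
get-applyUpTo f (suc L) {zero} p = refl
get-applyUpTo f (suc L) {suc i} (s<s p) = get-applyUpTo (f ∘ suc) L p

map-range : ∀ (f : ℕ → ℕ) n L → map f (range n L) ≡ applyUpTo (λ i → f (n + i)) L
map-range f n L = trans (cong (map f) (LP.map-upTo (n +_) L)) (LP.map-applyUpTo (n +_) f L)

range-≡ : ∀ n L → range n L ≡ applyUpTo (n +_) L
range-≡ n L = LP.map-upTo (n +_) L

length-map-range : ∀ (f : ℕ → ℕ) n L → length (map f (range n L)) ≡ L
length-map-range f n L = trans (cong length (map-range f n L)) (LP.length-applyUpTo (λ i → f (n + i)) L)

app-map-range : ∀ f L {j} → 1 ≤ j → j ≤ L → app (map f (range 1 L)) j ≡ f j
app-map-range f L {suc i} _ p =
  trans (app-in (map f (range 1 L)) (subst (i <_) (sym (length-map-range f 1 L)) p))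
  (trans (cong (λ l → get l i) (map-range f 1 L)) (get-applyUpTo (f ∘ suc) L p))

length-range : ∀ n L → length (range n L) ≡ L
length-range n L = trans (cong length (range-≡ n L)) (LP.length-applyUpTo (n +_) L)

lookupD-++ˡ : ∀ d v w {i} → i < length v → lookupD d (v ++ w) i ≡ lookupD d v i
lookupD-++ˡ d (x ∷ v) w {zero} p = refl
lookupD-++ˡ d (x ∷ v) w {suc i} (s<s p) = lookupD-++ˡ d v w p

lookupD-++ʳ : ∀ d v w i → lookupD d (v ++ w) (length v + i) ≡ lookupD d w i
lookupD-++ʳ d [] w i = refl
lookupD-++ʳ d (x ∷ v) w i = lookupD-++ʳ d v w i

app-++-range : ∀ w c j → app (w ++ range (suc (length w)) c) j ≡ app w j
app-++-range w c zero = refl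
app-++-range w c (suc i) with i <? length w
... | yes p = lookupD-++ˡ (suc i) w _ p
... | no ¬p with length w | ≮⇒≥ ¬p | lookupD-out w {i} (suc i) (≮⇒≥ ¬p) | lookupD-++ʳ (suc i) w (range (suc (length w)) c) (i ∸ length w)
... | n | q | e | e' rewrite m+[n∸m]≡n q = trans e' (trans tail (sym e))
  where
  k = i ∸ n
  tail : lookupD (suc i) (range (suc n) c) k ≡ suc i
  tail with k <? c
  ... | yes r = trans (lookupD-in (range (suc n) c) (suc i) (subst (k <_) (sym (length-range (suc n) c)) r))
                (trans (cong (λ l → get l k) (range-≡ (suc n) c)) (trans (get-applyUpTo (suc n +_) c r) (cong suc (m+[n∸m]≡n q))))
  ... | no r = lookupD-out (range (suc n) c) (suc i) (subst (_≤ k) (sym (length-range (suc n) c)) (≮⇒≥ r))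

app-pad : ∀ w M j → app (pad w M) j ≡ app w j
app-pad w M j = app-++-range w (M ∸ length w) j

length-pad : ∀ w M → length (pad w M) ≡ length w ⊔ M
length-pad w M rewrite LP.length-++ w {range (suc (length w)) (M ∸ length w)} | length-range (suc (length w)) (M ∸ length w)
  with ≤-total (length w) M
... | inj₁ p = trans (m+[n∸m]≡n p) (sym (m≤n⇒m⊔n≡n p))
... | inj₂ p rewrite m≤n⇒m∸n≡0 p = trans (+-identityʳ _) (sym (m≥n⇒m⊔n≡m p))

length-mulT : ∀ w a b → length (mulT w a b) ≡ length w ⊔ (a ⊔ b)
length-mulT w a b = trans (length-map-range (λ j → app (pad w (a ⊔ b)) (transp a b j)) 1 (length (pad w (a ⊔ b)))) (length-pad w (a ⊔ b))

app-mulT : ∀ w a b → 1 ≤ a → 1 ≤ b → ∀ j → app (mulT w a b) j ≡ app w (transp a b j)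
app-mulT w (suc a) (suc b) _ _ zero = refl
app-mulT w a b 1≤a 1≤b (suc i) with suc i ≤? length (pad w (a ⊔ b))
... | yes p = trans (app-map-range (λ j → app (pad w (a ⊔ b)) (transp a b j)) _ z<s p) (app-pad w (a ⊔ b) (transp a b (suc i)))
... | no ¬p = trans (app-out (mulT w a b) (subst (_< suc i) (sym (length-map-range (λ j → app (pad w (a ⊔ b)) (transp a b j)) 1 (length (pad w (a ⊔ b))))) (≰⇒> ¬p)))
    (sym (trans (cong (app w) (transp-o {a} {b} {suc i} (λ { refl → <-irrefl refl (≤-<-trans (≤-trans (m≤m⊔n a b) (m≤n⊔m (length w) (a ⊔ b))) out) })
                                        (λ { refl → <-irrefl refl (≤-<-trans (≤-trans (m≤n⊔m a b) (m≤n⊔m (length w) (a ⊔ b))) out) })))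
         (app-out w (≤-<-trans (m≤m⊔n (length w) (a ⊔ b)) out))))
  where
  out : length w ⊔ (a ⊔ b) < suc i
  out = subst (_< suc i) (length-pad w (a ⊔ b)) (≰⇒> ¬p)

-- Bijectivity is recorded as an inverse of `app w` on all of ℕ. This does not mention the length of
-- the list, so it is inherited by products with transpositions and by padded notations.
record Valid (w : Perm) : Set where
  field
    inv : ℕ → ℕ
    app-inv : ∀ y → app w (inv y) ≡ y
    inv-app : ∀ x → inv (app w x) ≡ x

  app-inj : ∀ {i j} → app w i ≡ app w j → i ≡ j
  app-inj {i} {j} p = trans (sym (inv-app i)) (trans (cong inv p) (inv-app j))

open Valid public

valid-mulT : ∀ {w a b} → 1 ≤ a → 1 ≤ b → Valid w → Valid (mulT w a b)
valid-mulT {w} {a} {b} p q v .inv y = transp a b (inv v y)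
valid-mulT {w} {a} {b} p q v .app-inv y =
  trans (app-mulT w a b p q (transp a b (inv v y))) (trans (cong (app w) (transp-invol a b (inv v y))) (app-inv v y))
valid-mulT {w} {a} {b} p q v .inv-app x =
  trans (cong (λ z → transp a b (inv v z)) (app-mulT w a b p q x))
  (trans (cong (transp a b) (inv-app v (transp a b x))) (transp-invol a b x))

record InS (N : ℕ) (w : Perm) : Set where
  constructor inS
  field
    len-eq : length w ≡ N
    valid : Valid w

open InS public

length-mulT-in : ∀ {w N a b} → length w ≡ N → a ≤ N → b ≤ N → length (mulT w a b) ≡ N
length-mulT-in {w} {N} {a} {b} refl p q = trans (length-mulT w a b) (m≥n⇒m⊔n≡m (⊔-lub p q))

inS-mulT : ∀ {N w a b} → 1 ≤ a → a < b → b ≤ N → InS N w → InS N (mulT w a b)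
inS-mulT {w = w} p q r (inS l v) = inS (length-mulT-in {w} l (≤-trans (<⇒≤ q) r) r) (valid-mulT p (≤-trans p (<⇒≤ q)) v)

mulT-ext : ∀ {N w a b} {v} → InS N w → 1 ≤ a → a < b → b ≤ N → length v ≡ N → (∀ j → app v j ≡ app w (transp a b j)) → mulT w a b ≡ v
mulT-ext {w = w} {a} {b} {v} s p q r lv h =
  app-ext (mulT w a b) v (trans (len-eq (inS-mulT p q r s)) (sym lv)) (λ j → trans (app-mulT w a b p (≤-trans p (<⇒≤ q)) j) (sym (h j)))

mulT-invol : ∀ {N w a b} → InS N w → 1 ≤ a → a < b → b ≤ N → mulT (mulT w a b) a b ≡ w
mulT-invol {w = w} {a} {b} s p q r = mulT-ext (inS-mulT p q r s) p q r (len-eq s)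
  (λ j → sym (trans (app-mulT w a b p (≤-trans p (<⇒≤ q)) (transp a b j)) (cong (app w) (transp-invol a b j))))

-- Inversions

-- The list form of right multiplication by an adjacent transposition. It recurses along the list as
-- `len` and `codes` do, which `mulT` does not.
swapAt : ℕ → List ℕ → List ℕ
swapAt zero (x ∷ y ∷ w) = y ∷ x ∷ w
swapAt (suc i) (x ∷ w) = x ∷ swapAt i w
swapAt _ w = w

length-swapAt : ∀ i w → length (swapAt i w) ≡ length w
length-swapAt zero [] = refl
length-swapAt zero (x ∷ []) = refl
length-swapAt zero (x ∷ y ∷ w) = refl
length-swapAt (suc i) [] = refl
length-swapAt (suc i) (x ∷ w) = cong suc (length-swapAt i w)

get-swapAt : ∀ i w → suc i < length w → ∀ j → get (swapAt i w) j ≡ get w (transp i (suc i) j)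
get-swapAt zero (x ∷ y ∷ w) p zero = refl
get-swapAt zero (x ∷ y ∷ w) p (suc zero) = refl
get-swapAt zero (x ∷ y ∷ w) p (2+ j) = refl
get-swapAt zero (x ∷ []) (s<s ()) j
get-swapAt (suc i) (x ∷ w) (s<s p) zero = refl
get-swapAt (suc i) (x ∷ w) (s<s p) (suc j) =
  trans (get-swapAt i w p j) (cong (get (x ∷ w)) (transp-suc i (suc i) j))

mulT-swapAt : ∀ i w → suc i < length w → mulT w (suc i) (2+ i) ≡ swapAt i w
mulT-swapAt i w p = get-ext (mulT w (suc i) (2+ i)) (swapAt i w) (trans lm (sym (length-swapAt i w))) λ j q →
  trans (sym (app-in (mulT w (suc i) (2+ i)) q)) (trans (app-mulT w (suc i) (2+ i) z<s z<s (suc j))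
  (trans (cong (app w) (sym (transp-suc i (suc i) j)))
  (trans (app-in w (inside j (subst (j <_) lm q))) (sym (get-swapAt i w p j)))))
  where
  lm : length (mulT w (suc i) (2+ i)) ≡ length w
  lm = length-mulT-in {w} {length w} {suc i} {2+ i} refl (<⇒≤ p) p
  inside : ∀ j → j < length w → transp i (suc i) j < length w
  inside j q with transp i (suc i) j | transp-view i (suc i) j
  ... | _ | at-a refl = p
  ... | _ | at-b refl = <-trans (n<1+n i) p
  ... | _ | off _ _ = q

data AscAt : ℕ → List ℕ → Set where
  here  : ∀ {x y w} → x < y → AscAt 0 (x ∷ y ∷ w)
  there : ∀ {i x w} → AscAt i w → AscAt (suc i) (x ∷ w)

ascAt : ∀ i w → suc i < length w → get w i < get w (suc i) → AscAt i w
ascAt zero (x ∷ []) (s<s ()) q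
ascAt zero (x ∷ y ∷ w) p q = here q
ascAt (suc i) (x ∷ w) (s<s p) q = there (ascAt i w p q)

ascAt-< : ∀ {i w} → AscAt i w → suc i < length w
ascAt-< (here _) = s<s z<s
ascAt-< (there a) = s<s (ascAt-< a)

ascAt-get : ∀ {i w} → AscAt i w → get w i < get w (suc i)
ascAt-get (here p) = p
ascAt-get (there a) = ascAt-get a

countBelow-swapAt : ∀ x i w → countBelow x (swapAt i w) ≡ countBelow x w
countBelow-swapAt x zero [] = refl
countBelow-swapAt x zero (_ ∷ []) = refl
countBelow-swapAt x zero (y ∷ z ∷ w) = +-exchange (if z <ᵇ x then 1 else 0) (if y <ᵇ x then 1 else 0) (countBelow x w)
countBelow-swapAt x (suc i) [] = refl
countBelow-swapAt x (suc i) (y ∷ w) = cong ((if y <ᵇ x then 1 else 0) +_) (countBelow-swapAt x i w)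

len-swapAt : ∀ {i w} → AscAt i w → len (swapAt i w) ≡ suc (len w)
len-swapAt {w = x ∷ y ∷ w} (here p) rewrite <ᵇ-yes p | <ᵇ-no (<⇒≤ p) =
  cong suc (+-exchange (countBelow y w) (countBelow x w) (len w))
len-swapAt {suc i} {x ∷ w} (there a) rewrite countBelow-swapAt x i w | len-swapAt a = +-suc _ _

app-asc : ∀ w i → suc i < length w → app w (suc i) < app w (2+ i) → AscAt i w
app-asc w i p q = ascAt i w p (subst₂ _<_ (app-in w (<-trans (n<1+n i) p)) (app-in w p) q)

asc-app : ∀ w i → AscAt i w → app w (suc i) < app w (2+ i)
asc-app w i a = subst₂ _<_ (sym (app-in w (<-trans (n<1+n i) (ascAt-< a)))) (sym (app-in w (ascAt-< a))) (ascAt-get a)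

app-mulT-a : ∀ w a b → 1 ≤ a → 1 ≤ b → app (mulT w a b) a ≡ app w b
app-mulT-a w a b p q = trans (app-mulT w a b p q a) (cong (app w) (transp-a a b))

app-mulT-b : ∀ w a b → 1 ≤ a → 1 ≤ b → app (mulT w a b) b ≡ app w a
app-mulT-b w a b p q = trans (app-mulT w a b p q b) (cong (app w) (transp-b a b))

app-mulT-o : ∀ w a b {j} → 1 ≤ a → 1 ≤ b → j ≢ a → j ≢ b → app (mulT w a b) j ≡ app w j
app-mulT-o w a b {j} p q n m = trans (app-mulT w a b p q j) (cong (app w) (transp-o n m))

module _ {N : ℕ} where
  len-adj-asc : ∀ {w i} → InS N w → 1 ≤ i → i < N → app w i < app w (suc i) → len (mulT w i (suc i)) ≡ suc (len w)
  len-adj-asc {w} {suc i} (inS refl v) _ q h =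
    trans (cong len (mulT-swapAt i w q)) (len-swapAt (app-asc w i q h))

  len-adj-desc : ∀ {w i} → InS N w → 1 ≤ i → i < N → app w (suc i) < app w i → len w ≡ suc (len (mulT w i (suc i)))
  len-adj-desc {w} {i} s p q h =
    trans (cong len (sym (mulT-invol s p (n<1+n i) q)))
      (len-adj-asc (inS-mulT p (n<1+n i) q s) p q
        (subst₂ _<_ (sym (app-mulT-a w i (suc i) p (m≤n⇒m≤1+n p))) (sym (app-mulT-b w i (suc i) p (m≤n⇒m≤1+n p))) h))

  -- Conjugating by the adjacent transposition (b-1, b) shortens (a, b).
  private
    asc : ∀ d {w a} → InS N w → 1 ≤ a → suc (d + a) ≤ N → app w a < app w (suc (d + a)) → len w < len (mulT w a (suc (d + a)))
    asc zero s p q h = ≤-reflexive (sym (len-adj-asc s p q h))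
    asc (suc d) {w} {a} s p q h = subst (λ v → len w < len v) (sym w₃≡) main
      where
      c = suc (d + a)
      b = suc c
      a<c : a < c
      a<c = s≤s (m≤n+m a d)
      1≤c : 1 ≤ c
      1≤c = s≤s z≤n
      1≤b : 1 ≤ b
      1≤b = s≤s z≤n
      c<N = q
      w₁ = mulT w c b
      w₂ = mulT w₁ a c
      w₃ = mulT w₂ c b
      s₁ = inS-mulT 1≤c (n<1+n c) c<N s
      s₂ = inS-mulT p a<c (<⇒≤ c<N) s₁
      s₃ = inS-mulT 1≤c (n<1+n c) c<N s₂
      a≢c = <⇒≢ a<c
      a≢b = <⇒≢ (m<n⇒m<1+n a<c)
      w₃≡ : mulT w a b ≡ w₃
      w₃≡ = mulT-ext s p (m<n⇒m<1+n a<c) q (len-eq s₃) λ j →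
        trans (app-mulT w₂ c b 1≤c 1≤b j) (trans (app-mulT w₁ a c p 1≤c (transp c b j)) (trans (app-mulT w c b 1≤c 1≤b (transp a c (transp c b j)))
        (cong (app w) (trans (transp-conj c b a c (transp c b j))
          (trans (cong₂ (λ x y → transp x y (transp c b (transp c b j))) (transp-o a≢c a≢b) (transp-a c b))
            (cong (transp a b) (transp-invol c b j)))))))
      P = app w a
      Q = app w c
      R = app w b
      w₁a : app w₁ a ≡ P
      w₁a = app-mulT-o w c b 1≤c 1≤b a≢c a≢b
      w₁c : app w₁ c ≡ R
      w₁c = app-mulT-a w c b 1≤c 1≤b
      w₁b : app w₁ b ≡ Q
      w₁b = app-mulT-b w c b 1≤c 1≤b
      w₂c : app w₂ c ≡ P
      w₂c = trans (app-mulT-b w₁ a c p 1≤c) w₁a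
      w₂b : app w₂ b ≡ Q
      w₂b = trans (app-mulT-o w₁ a c p 1≤c (a≢b ∘ sym) 1+n≢n) w₁b
      step : len w₁ < len w₂
      step = asc d s₁ p (<⇒≤ c<N) (subst₂ _<_ (sym w₁a) (sym w₁c) h)
      up₁ : Q < R → len w₁ ≡ suc (len w)
      up₁ = len-adj-asc s 1≤c c<N
      dn₁ : R < Q → len w ≡ suc (len w₁)
      dn₁ = len-adj-desc s 1≤c c<N
      up₃ : P < Q → len w₃ ≡ suc (len w₂)
      up₃ z = len-adj-asc s₂ 1≤c c<N (subst₂ _<_ (sym w₂c) (sym w₂b) z)
      dn₃ : Q < P → len w₂ ≡ suc (len w₃)
      dn₃ z = len-adj-desc s₂ 1≤c c<N (subst₂ _<_ (sym w₂b) (sym w₂c) z)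
      -- The two outer factors cannot both descend, as this would mean R < Q < P against P < R. If
      -- one of them descends, the other ascends, and the gain of the middle factor remains.
      main : len w < len w₃
      main with <-cmp Q R
      ... | tri≈ _ e _ = ⊥-elim (<⇒≢ (n<1+n c) (app-inj (valid s) e))
      ... | tri> _ _ R<Q = subst₂ _<_ (sym (dn₁ R<Q)) (sym (up₃ (<-trans h R<Q))) (s<s step)
      ... | tri< Q<R _ _ with <-cmp P Q
      ...   | tri≈ _ e _ = ⊥-elim (a≢c (app-inj (valid s) e))
      ...   | tri< P<Q _ _ = subst (len w <_) (sym (up₃ P<Q)) (m<n⇒m<1+n (<-trans (≤-reflexive (sym (up₁ Q<R))) step))
      ...   | tri> _ _ Q<P = s<s⁻¹ (subst₂ _<_ (up₁ Q<R) (dn₃ Q<P) step)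

  len-asc : ∀ {w a b} → InS N w → 1 ≤ a → a < b → b ≤ N → app w a < app w b → len w < len (mulT w a b)
  len-asc {w} {a} {suc b} s p (s≤s q) r h =
    subst (λ z → len w < len (mulT w a (suc z))) (m∸n+n≡m q)
      (asc (b ∸ a) s p (subst (λ z → suc z ≤ N) (sym (m∸n+n≡m q)) r)
           (subst (λ z → app w a < app w (suc z)) (sym (m∸n+n≡m q)) h))

  len-desc : ∀ {w a b} → InS N w → 1 ≤ a → a < b → b ≤ N → app w b < app w a → len (mulT w a b) < len w
  len-desc {w} {a} {b} s p q r h = subst (λ v → len (mulT w a b) < len v) (mulT-invol s p q r)
    (len-asc (inS-mulT p q r s) p q r
      (subst₂ _<_ (sym (app-mulT-a w a b p (≤-trans p (<⇒≤ q)))) (sym (app-mulT-b w a b p (≤-trans p (<⇒≤ q)))) h))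

  cover-asc : ∀ {w a b} → InS N w → 1 ≤ a → a < b → b ≤ N → len (mulT w a b) ≡ suc (len w) → app w a < app w b
  cover-asc {w} {a} {b} s p q r e with <-cmp (app w a) (app w b)
  ... | tri< h _ _ = h
  ... | tri≈ _ h _ = ⊥-elim (<⇒≢ q (app-inj (valid s) h))
  ... | tri> _ _ h = ⊥-elim (<⇒≱ (len-desc s p q r h) (≤-trans (n≤1+n _) (≤-reflexive (sym e))))

-- Finite sums over lists

ΣL : List ℕ → (ℕ → ℤ) → ℤ
ΣL A f = sumℤ (map f A)

Σ-cong : ∀ A {f g : ℕ → ℤ} → (∀ x → x ∈ A → f x ≡ g x) → ΣL A f ≡ ΣL A g
Σ-cong [] h = refl
Σ-cong (x ∷ A) h = cong₂ ℤ._+_ (h x (here refl)) (Σ-cong A (λ y p → h y (there p)))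

Σ-0 : ∀ A → ΣL A (λ _ → 0ℤ) ≡ 0ℤ
Σ-0 [] = refl
Σ-0 (x ∷ A) = trans (ℤP.+-identityˡ _) (Σ-0 A)

Σ-+ : ∀ A f g → ΣL A (λ x → f x ℤ.+ g x) ≡ ΣL A f ℤ.+ ΣL A g
Σ-+ [] f g = refl
Σ-+ (x ∷ A) f g rewrite Σ-+ A f g = +ℤ-interchange (f x) (g x) (ΣL A f) (ΣL A g)

Σ-* : ∀ A k f → ΣL A (λ x → k ℤ.* f x) ≡ k ℤ.* ΣL A f
Σ-* [] k f = sym (ℤP.*-zeroʳ k)
Σ-* (x ∷ A) k f rewrite Σ-* A k f = sym (ℤP.*-distribˡ-+ k (f x) (ΣL A f))

Σ-minus : ∀ A f g → ΣL A (λ x → f x ℤ.- g x) ≡ ΣL A f ℤ.- ΣL A g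
Σ-minus [] f g = refl
Σ-minus (x ∷ A) f g rewrite Σ-minus A f g = lem (f x) (g x) (ΣL A f) (ΣL A g)
  where
  lem : ∀ a b c d → (a ℤ.- b) ℤ.+ (c ℤ.- d) ≡ (a ℤ.+ c) ℤ.- (b ℤ.+ d)
  lem = solve-∀

Σ-swap : ∀ A B (f : ℕ → ℕ → ℤ) → ΣL A (λ x → ΣL B (f x)) ≡ ΣL B (λ y → ΣL A (λ x → f x y))
Σ-swap [] B f = sym (Σ-0 B)
Σ-swap (x ∷ A) B f = trans (cong (λ z → ΣL B (f x) ℤ.+ z) (Σ-swap A B f)) (sym (Σ-+ B (f x) (λ y → ΣL A (λ x → f x y))))

infixl 5 _∖_
_∖_ : List ℕ → ℕ → List ℕ
[] ∖ y = []
(x ∷ A) ∖ y = if x ≡ᵇ y then A ∖ y else x ∷ (A ∖ y)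

∖-same : ∀ A x → (x ∷ A) ∖ x ≡ A ∖ x
∖-same A x rewrite ≡ᵇ-yes {x} {x} refl = refl

∖-other : ∀ A {x y} → x ≢ y → (x ∷ A) ∖ y ≡ x ∷ (A ∖ y)
∖-other A n rewrite ≡ᵇ-no n = refl

∖-∉ : ∀ A x → x ∉ A → A ∖ x ≡ A
∖-∉ [] x n = refl
∖-∉ (y ∷ A) x n rewrite ≡ᵇ-no {y} {x} (λ e → n (here (sym e))) = cong (y ∷_) (∖-∉ A x (n ∘ there))

∖-∈ : ∀ A {x y} → y ∈ A ∖ x → y ∈ A × y ≢ x
∖-∈ (z ∷ A) {x} p with z ≟ x
... | yes refl with ∖-∈ A (subst (_ ∈_) (∖-same A z) p)
...   | q , n = there q , n
∖-∈ (z ∷ A) {x} p | no n with subst (_ ∈_) (∖-other A n) p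
...   | here refl = here refl , n
...   | there r with ∖-∈ A r
...     | q , m = there q , m

∈-∖ : ∀ A {x y} → y ∈ A → y ≢ x → y ∈ A ∖ x
∈-∖ (z ∷ A) {x} (here refl) n = subst (z ∈_) (sym (∖-other A n)) (here refl)
∈-∖ (z ∷ A) {x} {y} (there p) n with z ≟ x
... | yes refl = subst (y ∈_) (sym (∖-same A z)) (∈-∖ A p n)
... | no m = subst (y ∈_) (sym (∖-other A m)) (there (∈-∖ A p n))

∖-comm : ∀ A x y → A ∖ x ∖ y ≡ A ∖ y ∖ x
∖-comm [] x y = refl
∖-comm (z ∷ A) x y with z ≡ᵇ x in e | z ≡ᵇ y in e'
... | true | true = ∖-comm A x y
... | true | false rewrite e = ∖-comm A x y
... | false | true rewrite e' = ∖-comm A x y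
... | false | false rewrite e | e' = cong (z ∷_) (∖-comm A x y)

∖-unique : ∀ {A} x → Unique A → Unique (A ∖ x)
∖-unique x [] = []
∖-unique {z ∷ A} x (n ∷ u) with z ≡ᵇ x
... | true = ∖-unique x u
... | false = All.tabulate (λ p → All.lookup n (proj₁ (∖-∈ A p))) ∷ ∖-unique x u

Σ-∖ : ∀ A x f → ΣL (A ∖ x) f ≡ ΣL A (λ y → if y ≡ᵇ x then 0ℤ else f y)
Σ-∖ [] x f = refl
Σ-∖ (y ∷ A) x f with y ≡ᵇ x
... | true = trans (Σ-∖ A x f) (sym (ℤP.+-identityˡ _))
... | false = cong (λ z → f y ℤ.+ z) (Σ-∖ A x f)

Σ-remove : ∀ {A x} f → Unique A → x ∈ A → ΣL A f ≡ f x ℤ.+ ΣL (A ∖ x) f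
Σ-remove {x ∷ A} f (n ∷ u) (here refl) = cong (λ B → f x ℤ.+ ΣL B f)
  (sym (trans (∖-same A x) (∖-∉ A x (λ p → All.lookup n p refl))))
Σ-remove {y ∷ A} {x} f (n ∷ u) (there p) =
  trans (cong (λ z → f y ℤ.+ z) (Σ-remove f u p))
  (trans (+ℤ-exchange (f y) (f x) (ΣL (A ∖ x) f)) (cong (λ B → f x ℤ.+ ΣL B f) (sym (∖-other A (All.lookup n p)))))

Σ-off-diagonal : ∀ A (f : ℕ → ℕ → ℤ) → ΣL A (λ x → ΣL (A ∖ x) (f x)) ≡ ΣL A (λ y → ΣL (A ∖ y) (λ x → f x y))
Σ-off-diagonal A f =
  trans (Σ-cong A (λ x _ → Σ-∖ A x (f x)))
  (trans (Σ-swap A A _)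
  (Σ-cong A (λ y _ → trans (Σ-cong A (λ x _ → flip x y)) (sym (Σ-∖ A y (λ x → f x y))))))
  where
  flip : ∀ x y → (if y ≡ᵇ x then 0ℤ else f x y) ≡ (if x ≡ᵇ y then 0ℤ else f x y)
  flip x y with x ≟ y
  ... | yes refl = refl
  ... | no n rewrite ≡ᵇ-no n | ≡ᵇ-no (n ∘ sym) = refl

-- Bruhat operators and the Fomin–Kirillov relations

opaque
  -- The operator [a b] acts here on functions of permutations, so composites read from left to
  -- right: `op a b (op c d F) w` steps along (a, b) first and then along (c, d).
  op : ℕ → ℕ → (Perm → ℤ) → Perm → ℤ
  op a b F w = if len (mulT w a b) ≡ᵇ suc (len w) then F (mulT w a b) else 0ℤ

  op-yes : ∀ a b F w → len (mulT w a b) ≡ suc (len w) → op a b F w ≡ F (mulT w a b)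
  op-yes a b F w e rewrite ≡ᵇ-yes e = refl

  op-no : ∀ a b F w → len (mulT w a b) ≢ suc (len w) → op a b F w ≡ 0ℤ
  op-no a b F w e rewrite ≡ᵇ-no e = refl

  op-cong : ∀ a b F G w → (len (mulT w a b) ≡ suc (len w) → F (mulT w a b) ≡ G (mulT w a b)) → op a b F w ≡ op a b G w
  op-cong a b F G w h with len (mulT w a b) ≟ suc (len w)
  ... | yes e = trans (op-yes a b F w e) (trans (h e) (sym (op-yes a b G w e)))
  ... | no n = trans (op-no a b F w n) (sym (op-no a b G w n))

  op-0 : ∀ a b w → op a b (λ _ → 0ℤ) w ≡ 0ℤ
  op-0 a b w with len (mulT w a b) ≡ᵇ suc (len w)
  ... | true = refl
  ... | false = refl

  op-+ : ∀ a b F G w → op a b (λ v → F v ℤ.+ G v) w ≡ op a b F w ℤ.+ op a b G w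
  op-+ a b F G w with len (mulT w a b) ≡ᵇ suc (len w)
  ... | true = refl
  ... | false = refl

  op-minus : ∀ a b F G w → op a b (λ v → F v ℤ.- G v) w ≡ op a b F w ℤ.- op a b G w
  op-minus a b F G w with len (mulT w a b) ≡ᵇ suc (len w)
  ... | true = refl
  ... | false = refl

  op-* : ∀ a b k F w → op a b (λ v → k ℤ.* F v) w ≡ k ℤ.* op a b F w
  op-* a b k F w with len (mulT w a b) ≡ᵇ suc (len w)
  ... | true = refl
  ... | false = sym (ℤP.*-zeroʳ k)

  op-Σ : ∀ a b A (F : ℕ → Perm → ℤ) w → op a b (λ v → ΣL A (λ x → F x v)) w ≡ ΣL A (λ x → op a b (F x) w)
  op-Σ a b [] F w = op-0 a b w
  op-Σ a b (x ∷ A) F w = trans (op-+ a b (F x) (λ v → ΣL A (λ x → F x v)) w) (cong (λ z → op a b (F x) w ℤ.+ z) (op-Σ a b A F w))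

module FK {N : ℕ} where

  op-desc : ∀ {a b w} F → InS N w → 1 ≤ a → a < b → b ≤ N → app w b < app w a → op a b F w ≡ 0ℤ
  op-desc {a} {b} {w} F s p q r h = op-no a b F w (λ e → <-asym h (cover-asc s p q r e))

  -- Two successive covers, expressed by two ascents and the total length. The total depends only on
  -- the final permutation, so it carries over to another factorisation of the same product.
  Two : (a b c d : ℕ) → Perm → Set
  Two a b c d w = app w a < app w b × app (mulT w a b) c < app (mulT w a b) d
    × len (mulT (mulT w a b) c d) ≡ suc (suc (len w))

  two? : ∀ a b c d w → Dec (Two a b c d w)
  two? a b c d w with app w a <? app w b | app (mulT w a b) c <? app (mulT w a b) d | len (mulT (mulT w a b) c d) ≟ suc (suc (len w))
  ... | yes p | yes q | yes r = yes (p , q , r)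
  ... | no n | _ | _ = no (n ∘ proj₁)
  ... | yes _ | no n | _ = no (n ∘ proj₁ ∘ proj₂)
  ... | yes _ | yes _ | no n = no (n ∘ proj₂ ∘ proj₂)

  -- Each ascending step adds at least one to the length, so the total decides whether both are covers.
  op²-yes : ∀ {a b c d w} F → InS N w → 1 ≤ a → a < b → b ≤ N → 1 ≤ c → c < d → d ≤ N → Two a b c d w
    → op a b (op c d F) w ≡ F (mulT (mulT w a b) c d)
  op²-yes {a} {b} {c} {d} {w} F s p q r p' q' r' (u , v , e) =
    trans (op-yes a b (op c d F) w e₁) (op-yes c d F (mulT w a b) (trans e (cong suc (sym e₁))))
    where
    l₁ = len-asc s p q r u
    l₂ = len-asc (inS-mulT p q r s) p' q' r' v
    e₁ : len (mulT w a b) ≡ suc (len w)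
    e₁ = ≤-antisym (s≤s⁻¹ (subst (len (mulT w a b) <_) e l₂)) l₁

  op²-no : ∀ {a b c d w} F → InS N w → 1 ≤ a → a < b → b ≤ N → 1 ≤ c → c < d → d ≤ N → ¬ Two a b c d w
    → op a b (op c d F) w ≡ 0ℤ
  op²-no {a} {b} {c} {d} {w} F s p q r p' q' r' n with len (mulT w a b) ≟ suc (len w) | len (mulT (mulT w a b) c d) ≟ suc (len (mulT w a b))
  ... | no m | _ = op-no a b (op c d F) w m
  ... | yes e | no m = trans (op-yes a b (op c d F) w e) (op-no c d F (mulT w a b) m)
  ... | yes e | yes e' = ⊥-elim (n (cover-asc s p q r e , cover-asc (inS-mulT p q r s) p' q' r' e' , trans e' (cong suc e)))

  op²-≡ : ∀ {a b c d a' b' c' d' w} F → InS N w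
    → 1 ≤ a → a < b → b ≤ N → 1 ≤ c → c < d → d ≤ N
    → 1 ≤ a' → a' < b' → b' ≤ N → 1 ≤ c' → c' < d' → d' ≤ N
    → mulT (mulT w a b) c d ≡ mulT (mulT w a' b') c' d'
    → (Two a b c d w → Two a' b' c' d' w) → (Two a' b' c' d' w → Two a b c d w)
    → op a b (op c d F) w ≡ op a' b' (op c' d' F) w
  op²-≡ {a} {b} {c} {d} {w = w} F s h₁ h₂ h₃ h₄ h₅ h₆ k₁ k₂ k₃ k₄ k₅ k₆ e to from with two? a b c d w
  ... | yes t = trans (op²-yes F s h₁ h₂ h₃ h₄ h₅ h₆ t) (trans (cong F e) (sym (op²-yes F s k₁ k₂ k₃ k₄ k₅ k₆ (to t))))
  ... | no n = trans (op²-no F s h₁ h₂ h₃ h₄ h₅ h₆ n) (sym (op²-no F s k₁ k₂ k₃ k₄ k₅ k₆ (n ∘ from)))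

  mulT²-≡ : ∀ {w a b c d a' b' c' d'} → InS N w
    → 1 ≤ a → a < b → b ≤ N → 1 ≤ c → c < d → d ≤ N
    → 1 ≤ a' → a' < b' → b' ≤ N → 1 ≤ c' → c' < d' → d' ≤ N
    → (∀ j → transp a b (transp c d j) ≡ transp a' b' (transp c' d' j))
    → mulT (mulT w a b) c d ≡ mulT (mulT w a' b') c' d'
  mulT²-≡ {w} {a} {b} {c} {d} {a'} {b'} {c'} {d'} s h₁ h₂ h₃ h₄ h₅ h₆ k₁ k₂ k₃ k₄ k₅ k₆ e =
    mulT-ext (inS-mulT h₁ h₂ h₃ s) h₄ h₅ h₆ (len-eq (inS-mulT k₄ k₅ k₆ (inS-mulT k₁ k₂ k₃ s))) λ j →
    trans (app-mulT (mulT w a' b') c' d' k₄ (≤-trans k₄ (<⇒≤ k₅)) j)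
    (trans (app-mulT w a' b' k₁ (≤-trans k₁ (<⇒≤ k₂)) (transp c' d' j))
    (trans (cong (app w) (sym (e j))) (sym (app-mulT w a b h₁ (≤-trans h₁ (<⇒≤ h₂)) (transp c d j)))))

  op-comm : ∀ {a b c d w} F → InS N w → 1 ≤ a → a < b → b ≤ N → 1 ≤ c → c < d → d ≤ N
    → a ≢ c → a ≢ d → b ≢ c → b ≢ d → op a b (op c d F) w ≡ op c d (op a b F) w
  op-comm {a} {b} {c} {d} {w} F s h₁ h₂ h₃ h₄ h₅ h₆ ac ad bc bd =
    op²-≡ F s h₁ h₂ h₃ h₄ h₅ h₆ h₄ h₅ h₆ h₁ h₂ h₃ e
      (λ { (u , v , l) → subst₂ _<_ w₁c w₁d v , subst₂ _<_ (sym w₂a) (sym w₂b) u , trans (cong len (sym e)) l })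
      (λ { (u , v , l) → subst₂ _<_ w₂a w₂b v , subst₂ _<_ (sym w₁c) (sym w₁d) u , trans (cong len e) l })
    where
    1≤b = ≤-trans h₁ (<⇒≤ h₂)
    1≤d = ≤-trans h₄ (<⇒≤ h₅)
    e = mulT²-≡ s h₁ h₂ h₃ h₄ h₅ h₆ h₄ h₅ h₆ h₁ h₂ h₃ (transp-comm ac ad bc bd)
    w₁c = app-mulT-o w a b h₁ 1≤b (ac ∘ sym) (bc ∘ sym)
    w₁d = app-mulT-o w a b h₁ 1≤b (ad ∘ sym) (bd ∘ sym)
    w₂a = app-mulT-o w c d h₄ 1≤d ac ad
    w₂b = app-mulT-o w c d h₄ 1≤d bc bd

  -- At most one term on the right is nonzero. The first needs w(c) < w(x) for its step [c x]; in
  -- the second, [i c] comes after [i x] and compares w(x) at i with w(c) at c, so it needs w(x) <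
  -- w(c). In either case the remaining term is another factorisation of the product on the left.
  op-triangle : ∀ {i c x w} F → InS N w → 1 ≤ i → i < c → c < x → x ≤ N
    → op i c (op c x F) w ≡ op c x (op i x F) w ℤ.+ op i x (op i c F) w
  op-triangle {i} {c} {x} {w} F s p q r t with <-cmp (app w c) (app w x)
  ... | tri≈ _ e _ = ⊥-elim (<⇒≢ r (app-inj (valid s) e))
  ... | tri< Q<R _ _ = trans
      (op²-≡ F s p q c≤N 1≤c r t 1≤c r t p i<x t e₂
        (λ { (u , v , l) → Q<R , subst₂ _<_ (sym w₂i) (sym w₂x) u , trans (cong len (sym e₂)) l })
        (λ { (u , v , l) → let P<Q = subst₂ _<_ w₂i w₂x v in
             P<Q , subst₂ _<_ (sym w₁c) (sym w₁x) (<-trans P<Q Q<R) , trans (cong len e₂) l }))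
      (trans (sym (ℤP.+-identityʳ _)) (cong (λ z → op c x (op i x F) w ℤ.+ z) (sym
        (op²-no F s p i<x t p q c≤N (λ { (u , v , l) → <-asym Q<R (subst₂ _<_ w₃i w₃c v) })))))
    where
    1≤c = ≤-trans p (<⇒≤ q)
    1≤x = ≤-trans 1≤c (<⇒≤ r)
    c≤N = ≤-trans (<⇒≤ r) t
    i<x = <-trans q r
    i≢c = <⇒≢ q
    i≢x = <⇒≢ i<x
    c≢x = <⇒≢ r
    w₁c = app-mulT-b w i c p 1≤c
    w₁x = app-mulT-o w i c p 1≤c (i≢x ∘ sym) (c≢x ∘ sym)
    w₂i = app-mulT-o w c x 1≤c 1≤x i≢c i≢x
    w₂x = app-mulT-b w c x 1≤c 1≤x
    w₃i = app-mulT-a w i x p 1≤x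
    w₃c = app-mulT-o w i x p 1≤x (i≢c ∘ sym) c≢x
    e₂ : mulT (mulT w i c) c x ≡ mulT (mulT w c x) i x
    e₂ = mulT²-≡ s p q c≤N 1≤c r t 1≤c r t p i<x t λ j →
      sym (trans (transp-conj c x i x j) (cong₂ (λ a b → transp a b (transp c x j)) (transp-o i≢c i≢x) (transp-b c x)))
  ... | tri> _ _ R<Q = trans
      (op²-≡ F s p q c≤N 1≤c r t p i<x t p q c≤N e₃
        (λ { (u , v , l) → subst₂ _<_ w₁c w₁x v , subst₂ _<_ (sym w₃i) (sym w₃c) R<Q , trans (cong len (sym e₃)) l })
        (λ { (u , v , l) → <-trans u R<Q , subst₂ _<_ (sym w₁c) (sym w₁x) u , trans (cong len e₃) l }))
      (trans (sym (ℤP.+-identityˡ _)) (cong (λ z → z ℤ.+ op i x (op i c F) w) (sym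
        (op²-no F s 1≤c r t p i<x t (λ { (u , v , l) → <-asym R<Q u })))))
    where
    1≤c = ≤-trans p (<⇒≤ q)
    1≤x = ≤-trans 1≤c (<⇒≤ r)
    c≤N = ≤-trans (<⇒≤ r) t
    i<x = <-trans q r
    i≢c = <⇒≢ q
    i≢x = <⇒≢ i<x
    c≢x = <⇒≢ r
    w₁c = app-mulT-b w i c p 1≤c
    w₁x = app-mulT-o w i c p 1≤c (i≢x ∘ sym) (c≢x ∘ sym)
    w₃i = app-mulT-a w i x p 1≤x
    w₃c = app-mulT-o w i x p 1≤x (i≢c ∘ sym) c≢x
    e₃ : mulT (mulT w i c) c x ≡ mulT (mulT w i x) i c
    e₃ = mulT²-≡ s p q c≤N 1≤c r t p i<x t p q c≤N λ j →
      trans (transp-conj i c c x j) (cong₂ (λ a b → transp a b (transp i c j)) (transp-b i c) (transp-o (i≢x ∘ sym) (c≢x ∘ sym)))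

-- Sums over chains

-- H m I A F w sums F over the ends of the saturated chains of length m from w whose
-- first positions run weakly along I and whose second positions are distinct members of A.
H : ℕ → List ℕ → List ℕ → (Perm → ℤ) → Perm → ℤ
H zero I A F w = F w
H (suc m) [] A F w = 0ℤ
H (suc m) (c ∷ I) A F w = H (suc m) I A F w ℤ.+ ΣL A (λ j → op c j (H m (c ∷ I) (A ∖ j) F) w)

-- The Dunkl element of position c. When A and I consist of all positions above and below c, Monk's
-- rule says that it multiplies Schubert polynomials by x_c.
θ : ℕ → List ℕ → List ℕ → (Perm → ℤ) → Perm → ℤ
θ c A I G w = ΣL A (λ j → op c j G w) ℤ.- ΣL I (λ i → op i c G w)

Above : ℕ → ℕ → List ℕ → Set
Above N c A = ∀ x → x ∈ A → c < x × x ≤ N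

Below : ℕ → List ℕ → Set
Below c I = ∀ i → i ∈ I → 1 ≤ i × i < c

above-∖ : ∀ {N c A} x → Above N c A → Above N c (A ∖ x)
above-∖ {A = A} x u y p = u y (proj₁ (∖-∈ A p))

module Words {N : ℕ} (F : Perm → ℤ) where
  open FK {N}

  op-congS : ∀ {a b w} G G' → InS N w → 1 ≤ a → a < b → b ≤ N → (∀ v → InS N v → G v ≡ G' v) → op a b G w ≡ op a b G' w
  op-congS {a} {b} {w} G G' s p q r h = op-cong a b G G' w (λ _ → h (mulT w a b) (inS-mulT p q r s))

  Swap : ℕ → Set
  Swap m = ∀ c i I A {w} → InS N w → 1 ≤ c → 1 ≤ i → c ≢ i → Above N c A → Above N i A
    → H m (c ∷ i ∷ I) A F w ≡ H m (i ∷ c ∷ I) A F w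

  -- After expanding both sides by c and by i, only the chains that use both positions remain to be
  -- compared. There `op c x` and `op i y` commute, because x and y are different and lie above both
  -- c and i. `IH₁` brings the other position to the front after one step, `IH₀` restores a common
  -- order after two.
  H-swap-step : ∀ m → Swap m → Swap (suc m) → Swap (2+ m)
  H-swap-step m IH₀ IH₁ c i I A {w} s p q n u v =
    trans (cong (λ z → (h₀ ℤ.+ Si) ℤ.+ z) left)
    (trans (+ℤ-interchange h₀ Si Sc D)
    (cong (λ z → (h₀ ℤ.+ Sc) ℤ.+ z) (sym right)))
    where
    M = suc m
    h₀ = H (suc M) I A F w
    Si = ΣL A (λ y → op i y (H M (i ∷ I) (A ∖ y) F) w)
    Sc = ΣL A (λ x → op c x (H M (c ∷ I) (A ∖ x) F) w)
    D = ΣL A (λ x → ΣL (A ∖ x) (λ y → op c x (op i y (H m (c ∷ i ∷ I) (A ∖ x ∖ y) F)) w))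
    left : ΣL A (λ x → op c x (H M (c ∷ i ∷ I) (A ∖ x) F) w) ≡ Sc ℤ.+ D
    left = trans (Σ-cong A term) (Σ-+ A (λ x → op c x (H M (c ∷ I) (A ∖ x) F) w) (λ x → ΣL (A ∖ x) (λ y → op c x (op i y (H m (c ∷ i ∷ I) (A ∖ x ∖ y) F)) w)))
      where
      term : ∀ x → x ∈ A → op c x (H M (c ∷ i ∷ I) (A ∖ x) F) w
        ≡ op c x (H M (c ∷ I) (A ∖ x) F) w ℤ.+ ΣL (A ∖ x) (λ y → op c x (op i y (H m (c ∷ i ∷ I) (A ∖ x ∖ y) F)) w)
      term x x∈ = trans
        (op-congS _ (λ v → H M (c ∷ I) (A ∖ x) F v ℤ.+ ΣL (A ∖ x) (λ y → op i y (H m (c ∷ i ∷ I) (A ∖ x ∖ y) F) v)) s p (proj₁ (u x x∈)) (proj₂ (u x x∈))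
          (λ w' s' → trans (IH₁ c i I (A ∖ x) s' p q n (above-∖ x u) (above-∖ x v))
            (cong (λ z → H M (c ∷ I) (A ∖ x) F w' ℤ.+ z) (Σ-cong (A ∖ x) (λ y y∈ →
              let vy = v y (proj₁ (∖-∈ A y∈)) in
              op-congS _ _ s' q (proj₁ vy) (proj₂ vy)
                (λ w″ s″ → sym (IH₀ c i I (A ∖ x ∖ y) s″ p q n (above-∖ y (above-∖ x u)) (above-∖ y (above-∖ x v)))))))))
        (trans (op-+ c x (H M (c ∷ I) (A ∖ x) F) (λ v → ΣL (A ∖ x) (λ y → op i y (H m (c ∷ i ∷ I) (A ∖ x ∖ y) F) v)) w)
          (cong (λ z → op c x (H M (c ∷ I) (A ∖ x) F) w ℤ.+ z) (op-Σ c x (A ∖ x) (λ y → op i y (H m (c ∷ i ∷ I) (A ∖ x ∖ y) F)) w)))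
    right : ΣL A (λ y → op i y (H M (i ∷ c ∷ I) (A ∖ y) F) w) ≡ Si ℤ.+ D
    right = trans (Σ-cong A term) (trans (Σ-+ A (λ y → op i y (H M (i ∷ I) (A ∖ y) F) w) (λ y → ΣL (A ∖ y) (λ x → op i y (op c x (H m (c ∷ i ∷ I) (A ∖ y ∖ x) F)) w))) (cong (λ z → Si ℤ.+ z)
      (trans (Σ-off-diagonal A (λ y x → op i y (op c x (H m (c ∷ i ∷ I) (A ∖ y ∖ x) F)) w)) (Σ-cong A (λ x x∈ → Σ-cong (A ∖ x) (λ y y∈ → comm x x∈ y y∈))))))
      where
      term : ∀ y → y ∈ A → op i y (H M (i ∷ c ∷ I) (A ∖ y) F) w
        ≡ op i y (H M (i ∷ I) (A ∖ y) F) w ℤ.+ ΣL (A ∖ y) (λ x → op i y (op c x (H m (c ∷ i ∷ I) (A ∖ y ∖ x) F)) w)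
      term y y∈ = trans
        (op-congS _ (λ w' → H M (i ∷ I) (A ∖ y) F w' ℤ.+ ΣL (A ∖ y) (λ x → op c x (H m (c ∷ i ∷ I) (A ∖ y ∖ x) F) w')) s q (proj₁ (v y y∈)) (proj₂ (v y y∈))
          (λ w' s' → sym (IH₁ c i I (A ∖ y) s' p q n (above-∖ y u) (above-∖ y v))))
        (trans (op-+ i y (H M (i ∷ I) (A ∖ y) F) (λ v → ΣL (A ∖ y) (λ x → op c x (H m (c ∷ i ∷ I) (A ∖ y ∖ x) F) v)) w)
          (cong (λ z → op i y (H M (i ∷ I) (A ∖ y) F) w ℤ.+ z) (op-Σ i y (A ∖ y) (λ x → op c x (H m (c ∷ i ∷ I) (A ∖ y ∖ x) F)) w)))
      comm : ∀ x → x ∈ A → ∀ y → y ∈ A ∖ x → op i y (op c x (H m (c ∷ i ∷ I) (A ∖ y ∖ x) F)) w ≡ op c x (op i y (H m (c ∷ i ∷ I) (A ∖ x ∖ y) F)) w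
      comm x x∈ y y∈ with ∖-∈ A y∈
      ... | y∈A , y≢x = trans
        (cong (λ B → op i y (op c x (H m (c ∷ i ∷ I) B F)) w) (∖-comm A y x))
        (op-comm _ s q (proj₁ vy) (proj₂ vy) p (proj₁ ux) (proj₂ ux) (n ∘ sym)
           (<⇒≢ (proj₁ (v x x∈))) (<⇒≢ (proj₁ (u y y∈A)) ∘ sym) y≢x)
        where
        vy = v y y∈A
        ux = u x x∈

  H-swap : ∀ m → Swap m
  H-swap zero c i I A s p q n u v = refl
  H-swap (suc zero) c i I A {w} s p q n u v =
    lem (H 1 I A F w) (ΣL A (λ y → op i y F w)) (ΣL A (λ x → op c x F w))
    where
    lem : ∀ a b c → (a ℤ.+ b) ℤ.+ c ≡ (a ℤ.+ c) ℤ.+ b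
    lem = solve-∀
  H-swap (2+ m) = H-swap-step m (H-swap m) (H-swap (suc m))

  -- Along a chain with constant first position c the value there increases,
  -- so a second position carrying a smaller value is never used.
  H-unused : ∀ m c j A {w} → InS N w → 1 ≤ c → Above N c A → app w j < app w c
    → H m (c ∷ []) (A ∖ j) F w ≡ H m (c ∷ []) A F w
  H-unused zero c j A s p u h = refl
  H-unused (suc m) c j A {w} s p u h = cong (λ z → 0ℤ ℤ.+ z)
    (trans (Σ-∖ A j (λ l → op c l (H m (c ∷ []) (A ∖ j ∖ l) F) w)) (Σ-cong A term))
    where
    term : ∀ l → l ∈ A → (if l ≡ᵇ j then 0ℤ else op c l (H m (c ∷ []) (A ∖ j ∖ l) F) w) ≡ op c l (H m (c ∷ []) (A ∖ l) F) w
    term l l∈ with l ≟ j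
    ... | yes refl rewrite ≡ᵇ-yes {l} {l} refl = sym (op-desc _ s p (proj₁ (u l l∈)) (proj₂ (u l l∈)) h)
    ... | no n rewrite ≡ᵇ-no n = trans (cong (λ B → op c l (H m (c ∷ []) B F) w) (∖-comm A j l))
        (op-cong c l _ _ w (λ e → H-unused m c j (A ∖ l) (inS-mulT p c<l l≤N s) p (above-∖ l u)
          (subst₂ _<_ (sym (app-mulT-o w c l p 1≤l j≢c (n ∘ sym))) (sym (app-mulT-a w c l p 1≤l))
             (<-trans h (cover-asc s p c<l l≤N e)))))
      where
      c<l = proj₁ (u l l∈)
      l≤N = proj₂ (u l l∈)
      1≤l = ≤-trans p (<⇒≤ c<l)
      j≢c : j ≢ c
      j≢c e = <-irrefl (cong (app w) e) h

  -- This is h_{m+1}(k) = h_{m+1}(k-1) + x_k h_m(k) with the Dunkl element in place of x_k: c leaves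
  -- the first positions and joins the second ones, and inside θ no member of A is excluded. The
  -- induction on I moves i to the front by `H-swap` and commutes the steps of i with θ; the only
  -- obstruction comes from steps at i, c and a common x, and is settled by `op-triangle`.
  H-rec : ∀ I m c A {w} → InS N w → 1 ≤ c → c ≤ N → Above N c A → Unique A → Below c I → Unique I
    → H (suc m) (c ∷ I) A F w ≡ H (suc m) I (c ∷ A) F w ℤ.+ θ c A I (H m (c ∷ I) A F) w
  H-rec [] m c A {w} s p c≤N u ua b ui =
    -- After the step (c, j) position j carries the smaller of the two values, so readmitting j
    -- creates no new chain.
    trans (cong (λ z → 0ℤ ℤ.+ z) (Σ-cong A (λ j j∈ →
      let c<j = proj₁ (u j j∈) ; j≤N = proj₂ (u j j∈) ; 1≤j = ≤-trans p (<⇒≤ c<j) in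
      op-cong c j (H m (c ∷ []) (A ∖ j) F) (H m (c ∷ []) A F) w (λ e → H-unused m c j A (inS-mulT p c<j j≤N s) p u
        (subst₂ _<_ (sym (app-mulT-b w c j p 1≤j)) (sym (app-mulT-a w c j p 1≤j)) (cover-asc s p c<j j≤N e))))))
    (cong (λ z → 0ℤ ℤ.+ z) (sym (ℤP.+-identityʳ (ΣL A (λ j → op c j (H m (c ∷ []) A F) w)))))
  H-rec (i ∷ I) zero c A {w} s p c≤N u ua b (ni ∷ ui) =
    trans (H-swap 1 c i I A s p q (<⇒≢ i<c ∘ sym) u v)
    (trans (cong (λ z → z ℤ.+ Six) (H-rec I zero c A s p c≤N u ua (λ l m → b l (there m)) ui))
    (lem (H 1 I (c ∷ A) F w) Scj Slc Six Sic))
    where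
    q = proj₁ (b i (here refl))
    i<c = proj₂ (b i (here refl))
    v : Above N i A
    v x x∈ = <-trans i<c (proj₁ (u x x∈)) , proj₂ (u x x∈)
    Six = ΣL A (λ x → op i x F w)
    Scj = ΣL A (λ j → op c j F w)
    Slc = ΣL I (λ l → op l c F w)
    Sic = op i c F w
    lem : ∀ X cj lc ix ic → (X ℤ.+ (cj ℤ.- lc)) ℤ.+ ix ≡ (X ℤ.+ (ic ℤ.+ ix)) ℤ.+ (cj ℤ.- (ic ℤ.+ lc))
    lem = solve-∀
  H-rec (i ∷ I) (suc m) c A {w} s p c≤N u ua b (ni ∷ ui) =
    trans (H-swap (suc M) c i I A s p q c≢i u v)
    (trans (cong₂ ℤ._+_ (H-rec I (suc m) c A s p c≤N u ua (λ l l∈ → b l (there l∈)) ui) left)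
    (trans (cong (λ z → (X ℤ.+ (Scj ℤ.- Slc)) ℤ.+ (SH ℤ.+ z)) P≡)
    (trans (regroup X Scj Slc SH ICH Q₁ Q₂ Q₃)
    (sym (cong₂ ℤ._+_ (cong (λ z → X ℤ.+ z) right₁) (cong₂ ℤ._-_ right₂ (cong₂ ℤ._+_ right₃ right₄)))))))
    where
    M = suc m
    q = proj₁ (b i (here refl))
    i<c = proj₂ (b i (here refl))
    c≢i = <⇒≢ i<c ∘ sym
    c∉A : c ∉ A
    c∉A c∈ = <-irrefl refl (proj₁ (u c c∈))
    v : Above N i A
    v x x∈ = <-trans i<c (proj₁ (u x x∈)) , proj₂ (u x x∈)
    K : ℕ → Perm → ℤ
    K x = H m (c ∷ i ∷ I) (A ∖ x) F
    HI = H M (c ∷ I) A F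
    X = H (suc M) I (c ∷ A) F w
    Scj = ΣL A (λ j → op c j HI w)
    Slc = ΣL I (λ l → op l c HI w)
    SH = ΣL A (λ x → op i x (H M (i ∷ I) (c ∷ (A ∖ x)) F) w)
    ICH = op i c (H M (i ∷ I) A F) w
    Q₁ = ΣL A (λ j → ΣL A (λ x → op c j (op i x (K x)) w))
    Q₂ = ΣL A (λ x → op i c (op c x (K x)) w)
    Q₃ = ΣL I (λ l → ΣL A (λ x → op l c (op i x (K x)) w))
    Pt : ℕ → ℤ
    Pt x = ΣL (A ∖ x) (λ j → op i x (op c j (K x)) w) ℤ.- (op i x (op i c (K x)) w ℤ.+ ΣL I (λ l → op i x (op l c (K x)) w))
    regroup : ∀ X Scj Slc SH ICH Q₁ Q₂ Q₃ → (X ℤ.+ (Scj ℤ.- Slc)) ℤ.+ (SH ℤ.+ (Q₁ ℤ.- (Q₂ ℤ.+ Q₃)))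
      ≡ (X ℤ.+ (ICH ℤ.+ SH)) ℤ.+ ((Scj ℤ.+ Q₁) ℤ.- ((ICH ℤ.+ Q₂) ℤ.+ (Slc ℤ.+ Q₃)))
    regroup = solve-∀
    left : ΣL A (λ x → op i x (H M (i ∷ c ∷ I) (A ∖ x) F) w) ≡ SH ℤ.+ ΣL A Pt
    left = trans (Σ-cong A term) (Σ-+ A _ Pt)
      where
      term : ∀ x → x ∈ A → op i x (H M (i ∷ c ∷ I) (A ∖ x) F) w ≡ op i x (H M (i ∷ I) (c ∷ (A ∖ x)) F) w ℤ.+ Pt x
      term x x∈ = trans
        (op-congS _ (λ w' → H M (i ∷ I) (c ∷ (A ∖ x)) F w' ℤ.+ θ c (A ∖ x) (i ∷ I) (K x) w') s q (proj₁ (v x x∈)) (proj₂ (v x x∈))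
          (λ w' s' → trans (sym (H-swap M c i I (A ∖ x) s' p q c≢i (above-∖ x u) (above-∖ x v)))
            (H-rec (i ∷ I) m c (A ∖ x) s' p c≤N (above-∖ x u) (∖-unique x ua) b (ni ∷ ui))))
        (trans (op-+ i x (H M (i ∷ I) (c ∷ (A ∖ x)) F) (θ c (A ∖ x) (i ∷ I) (K x)) w)
        (cong (λ z → op i x (H M (i ∷ I) (c ∷ (A ∖ x)) F) w ℤ.+ z)
          (trans (op-minus i x (λ w' → ΣL (A ∖ x) (λ j → op c j (K x) w')) (λ w' → op i c (K x) w' ℤ.+ ΣL I (λ l → op l c (K x) w')) w)
          (cong₂ ℤ._-_ (op-Σ i x (A ∖ x) (λ j → op c j (K x)) w)
            (trans (op-+ i x (op i c (K x)) (λ w' → ΣL I (λ l → op l c (K x) w')) w)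
              (cong (λ z → op i x (op i c (K x)) w ℤ.+ z) (op-Σ i x I (λ l → op l c (K x)) w)))))))
    by-i : ∀ w' → InS N w' → H M (c ∷ i ∷ I) A F w' ≡ HI w' ℤ.+ ΣL A (λ x → op i x (K x) w')
    by-i w' s' = trans (H-swap M c i I A s' p q c≢i u v)
      (cong (λ z → HI w' ℤ.+ z) (Σ-cong A (λ x x∈ → op-congS _ (K x) s' q (proj₁ (v x x∈)) (proj₂ (v x x∈))
        (λ w″ s″ → sym (H-swap m c i I (A ∖ x) s″ p q c≢i (above-∖ x u) (above-∖ x v))))))
    expand : ∀ a b → 1 ≤ a → a < b → b ≤ N
      → op a b (H M (c ∷ i ∷ I) A F) w ≡ op a b HI w ℤ.+ ΣL A (λ x → op a b (op i x (K x)) w)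
    expand a b h₁ h₂ h₃ = trans (op-congS _ (λ w' → HI w' ℤ.+ ΣL A (λ x → op i x (K x) w')) s h₁ h₂ h₃ by-i)
      (trans (op-+ a b HI (λ w' → ΣL A (λ x → op i x (K x) w')) w)
        (cong (λ z → op a b HI w ℤ.+ z) (op-Σ a b A (λ x → op i x (K x)) w)))
    right₁ : ΣL (c ∷ A) (λ j → op i j (H M (i ∷ I) ((c ∷ A) ∖ j) F) w) ≡ ICH ℤ.+ SH
    right₁ = cong₂ ℤ._+_
      (cong (λ B → op i c (H M (i ∷ I) B F) w) (trans (∖-same A c) (∖-∉ A c c∉A)))
      (Σ-cong A (λ x x∈ → cong (λ B → op i x (H M (i ∷ I) B F) w) (∖-other A (<⇒≢ (proj₁ (u x x∈))))))
    right₂ : ΣL A (λ j → op c j (H M (c ∷ i ∷ I) A F) w) ≡ Scj ℤ.+ Q₁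
    right₂ = trans (Σ-cong A (λ j j∈ → expand c j p (proj₁ (u j j∈)) (proj₂ (u j j∈)))) (Σ-+ A (λ j → op c j HI w) (λ j → ΣL A (λ x → op c j (op i x (K x)) w)))
    right₃ : op i c (H M (c ∷ i ∷ I) A F) w ≡ ICH ℤ.+ Q₂
    right₃ = trans (op-+ i c (H M (i ∷ I) A F) (λ w' → ΣL A (λ x → op c x (K x) w')) w)
      (cong (λ z → ICH ℤ.+ z) (op-Σ i c A (λ x → op c x (K x)) w))
    right₄ : ΣL I (λ l → op l c (H M (c ∷ i ∷ I) A F) w) ≡ Slc ℤ.+ Q₃
    right₄ = trans (Σ-cong I (λ l l∈ → expand l c (proj₁ (b l (there l∈))) (proj₂ (b l (there l∈))) c≤N)) (Σ-+ I (λ l → op l c HI w) (λ l → ΣL A (λ x → op l c (op i x (K x)) w)))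
    P≡ : ΣL A Pt ≡ Q₁ ℤ.- (Q₂ ℤ.+ Q₃)
    P≡ = trans (Σ-cong A term)
      (trans (Σ-minus A (λ x → ΣL A (λ j → op c j (op i x (K x)) w)) (λ x → op i c (op c x (K x)) w ℤ.+ ΣL I (λ l → op l c (op i x (K x)) w)))
      (cong₂ ℤ._-_ (Σ-swap A A (λ x j → op c j (op i x (K x)) w)) (trans (Σ-+ A (λ x → op i c (op c x (K x)) w) (λ x → ΣL I (λ l → op l c (op i x (K x)) w))) (cong (λ z → Q₂ ℤ.+ z) (Σ-swap A I (λ x l → op l c (op i x (K x)) w))))))
      where
      -- U is the diagonal term j = x missing from the sum over A without x. Added to both parts of
      -- the difference, it completes that sum, and U + T becomes the right side of the triangle
      -- relation.
      ring : ∀ U S T R → S ℤ.- (T ℤ.+ R) ≡ (U ℤ.+ S) ℤ.- ((U ℤ.+ T) ℤ.+ R)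
      ring = solve-∀
      term : ∀ x → x ∈ A → Pt x ≡ ΣL A (λ j → op c j (op i x (K x)) w) ℤ.- (op i c (op c x (K x)) w ℤ.+ ΣL I (λ l → op l c (op i x (K x)) w))
      term x x∈ = trans
        (cong₂ (λ y z → y ℤ.- (op i x (op i c (K x)) w ℤ.+ z)) (Σ-cong (A ∖ x) commA) (Σ-cong I commI))
        (trans (ring (op c x (op i x (K x)) w) (ΣL (A ∖ x) (λ j → op c j (op i x (K x)) w)) (op i x (op i c (K x)) w) (ΣL I (λ l → op l c (op i x (K x)) w)))
        (sym (cong₂ (λ y z → y ℤ.- (z ℤ.+ ΣL I (λ l → op l c (op i x (K x)) w)))
          (Σ-remove (λ j → op c j (op i x (K x)) w) ua x∈)
          (op-triangle (K x) s q i<c c<x x≤N))))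
        where
        c<x = proj₁ (u x x∈)
        x≤N = proj₂ (u x x∈)
        i<x = proj₁ (v x x∈)
        commA : ∀ j → j ∈ A ∖ x → op i x (op c j (K x)) w ≡ op c j (op i x (K x)) w
        commA j j∈ with ∖-∈ A j∈
        ... | j∈A , j≢x = op-comm (K x) s q i<x x≤N p (proj₁ (u j j∈A)) (proj₂ (u j j∈A))
          (c≢i ∘ sym) (<⇒≢ (proj₁ (v j j∈A))) (<⇒≢ c<x ∘ sym) (j≢x ∘ sym)
        commI : ∀ l → l ∈ I → op i x (op l c (K x)) w ≡ op l c (op i x (K x)) w
        commI l l∈ = op-comm (K x) s q i<x x≤N (proj₁ (b l (there l∈))) (proj₂ (b l (there l∈))) c≤N
          (All.lookup ni l∈) (c≢i ∘ sym) (<⇒≢ (<-trans (proj₂ (b l (there l∈))) c<x) ∘ sym) (<⇒≢ c<x ∘ sym)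

-- Schubert polynomials as functions of points

S : Perm → Point → ℤ
S w r = ev (schub w) r

data FirstAsc : ℕ → List ℕ → Set where
  here  : ∀ {x y w} → x < y → FirstAsc 0 (x ∷ y ∷ w)
  there : ∀ {i x y w} → y ≤ x → FirstAsc i (y ∷ w) → FirstAsc (suc i) (x ∷ y ∷ w)

FirstAsc⇒AscAt : ∀ {i w} → FirstAsc i w → AscAt i w
FirstAsc⇒AscAt (here p) = here p
FirstAsc⇒AscAt (there _ a) = there (FirstAsc⇒AscAt a)

firstAscent-FA : ∀ {i w} n → FirstAsc i w → firstAscentFrom n w ≡ just (n + i)
firstAscent-FA n (here p) rewrite <ᵇ-yes p = cong just (sym (+-identityʳ n))
firstAscent-FA n (there {i} q a) rewrite <ᵇ-no q = trans (firstAscent-FA (suc n) a) (cong just (sym (+-suc n i)))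

data Ascents (w : List ℕ) : Set where
  none  : Linked _≥_ w → (∀ n → firstAscentFrom n w ≡ nothing) → Ascents w
  first : ∀ i → FirstAsc i w → Ascents w

ascents : ∀ w → Ascents w
ascents [] = none [] (λ n → refl)
ascents (x ∷ []) = none [-] (λ n → refl)
ascents (x ∷ y ∷ w) with x <? y | ascents (y ∷ w)
... | yes p | _ = first 0 (here p)
... | no ¬p | first i a = first (suc i) (there (≮⇒≥ ¬p) a)
... | no ¬p | none l e = none (≮⇒≥ ¬p ∷ l)
  (λ n → trans (cong (λ b → if b then just n else firstAscentFrom (suc n) (y ∷ w)) (<ᵇ-no (≮⇒≥ ¬p))) (e (suc n)))

asc-after-first : ∀ {i j w} → FirstAsc i w → AscAt j w → i ≤ j
asc-after-first (here p) a = z≤n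
asc-after-first (there q a) (here p) = ⊥-elim (<⇒≱ p q)
asc-after-first (there q a) (there b) = s≤s (asc-after-first a b)

linked-no-asc : ∀ {j w} → Linked _≥_ w → AscAt j w → ⊥
linked-no-asc (q ∷ l) (here p) = <⇒≱ p q
linked-no-asc (q ∷ l) (there a) = linked-no-asc l a
linked-no-asc [-] (there ())

countBelow-≤ : ∀ x w → countBelow x w ≤ length w
countBelow-≤ x [] = z≤n
countBelow-≤ x (y ∷ w) with y <ᵇ x
... | true = s≤s (countBelow-≤ x w)
... | false = m≤n⇒m≤1+n (countBelow-≤ x w)

len-≤ : ∀ w → len w ≤ length w * length w
len-≤ [] = z≤n
len-≤ (x ∷ w) = +-mono-≤ (m≤n⇒m≤1+n (countBelow-≤ x w)) (≤-trans (len-≤ w) (*-monoʳ-≤ (length w) (n≤1+n (length w))))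

-- A swap at an ascent costs one unit of fuel and raises `len` by one, so the condition persists;
-- fuel zero is excluded because `len` is at most the square of the length. It also serves as the
-- measure for inductions towards longer permutations.
Enough : ℕ → Perm → Set
Enough f w = length w * length w < f + len w

enough-swap : ∀ {f i w} → AscAt i w → Enough (suc f) w → Enough f (swapAt i w)
enough-swap {f} {i} {w} a e rewrite length-swapAt i w | len-swapAt a | +-suc f (len w) = e

schubF-step : ∀ {f i w} → FirstAsc i w → schubF (suc f) w ≡ ∂ (suc i) (schubF f (swapAt i w))
schubF-step {f} {i} {w} a rewrite firstAscent-FA 1 a | mulT-swapAt i w (ascAt-< (FirstAsc⇒AscAt a)) = refl

schubF-fuel : ∀ f f' w → Enough f w → Enough f' w → schubF f w ≡ schubF f' w
schubF-fuel zero f' w e e' = ⊥-elim (<⇒≱ e (len-≤ w))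
schubF-fuel (suc f) zero w e e' = ⊥-elim (<⇒≱ e' (len-≤ w))
schubF-fuel (suc f) (suc f') w e e' with ascents w
... | none l h rewrite h 1 = refl
... | first i a rewrite firstAscent-FA 1 a | mulT-swapAt i w (ascAt-< (FirstAsc⇒AscAt a)) =
  cong (∂ (suc i)) (schubF-fuel f f' (swapAt i w) (enough-swap {f} (FirstAsc⇒AscAt a) e) (enough-swap {f'} (FirstAsc⇒AscAt a) e'))

enough-start : ∀ w → Enough (suc (length w * length w)) w
enough-start w = m≤m+n (suc (length w * length w)) (len w)

schub-step : ∀ {i w} → FirstAsc i w → schub w ≡ ∂ (suc i) (schub (swapAt i w))
schub-step {i} {w} a = trans (schubF-step a)
  (cong (∂ (suc i)) (schubF-fuel (length w * length w) _ (swapAt i w)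
    (enough-swap {length w * length w} (FirstAsc⇒AscAt a) (enough-start w)) (enough-start (swapAt i w))))

-- Divided differences of functions, with their commutation and braid relations

X : ℕ → Point → ℤ
X i r = r (suc i) ℤ.- r (2+ i)

-- States that g is ∂_{i+1} f with the denominator cleared; at points with distinct coordinates this
-- determines g.
DD : ℕ → ℕ → (Point → ℤ) → (Point → ℤ) → Set
DD N i f g = ∀ r → Distinct N r → X i r ℤ.* g r ≡ f r ℤ.- f (swapP (suc i) r)

distinct-≢ : ∀ {N r i j} → Distinct N r → 1 ≤ i → i ≤ N → 1 ≤ j → j ≤ N → i ≢ j → r i ≢ r j
distinct-≢ {i = i} {j} d p q p' q' n e with <-cmp i j
... | tri< h _ _ = d i j p h q' e
... | tri≈ _ h _ = n h
... | tri> _ _ h = d j i p' h q (sym e)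

transp-range : ∀ {N a b j} → 1 ≤ a → a ≤ N → 1 ≤ b → b ≤ N → 1 ≤ j → j ≤ N → 1 ≤ transp a b j × transp a b j ≤ N
transp-range {a = a} {b} {j} p q p' q' s t with transp a b j | transp-view a b j
... | _ | at-a _ = p' , q'
... | _ | at-b _ = p , q
... | _ | off _ _ = s , t

distinct-swap : ∀ {N r i} → 2+ i ≤ N → Distinct N r → Distinct N (swapP (suc i) r)
distinct-swap {N} {r} {i} h d j k p q t =
  distinct-≢ d (proj₁ tj) (proj₂ tj) (proj₁ tk) (proj₂ tk) (λ e → <⇒≢ q (transp-inj (suc i) (2+ i) e))
  where
  tj = transp-range z<s (<⇒≤ h) z<s h p (≤-trans (<⇒≤ q) t)
  tk = transp-range z<s (<⇒≤ h) z<s h (≤-trans p (<⇒≤ q)) t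

X≢0 : ∀ {N r i} → 2+ i ≤ N → Distinct N r → X i r ≢ 0ℤ
X≢0 {r = r} {i} h d e = d (suc i) (2+ i) z<s ≤-refl h (ℤP.i-j≡0⇒i≡j (r (suc i)) (r (2+ i)) e)

cancelˡ : ∀ {k} a b → k ≢ 0ℤ → k ℤ.* a ≡ k ℤ.* b → a ≡ b
cancelˡ {k} a b n e = ℤP.*-cancelˡ-≡ k a b {{ℤ.≢-nonZero n}} e

X-swap : ∀ i r → X i (swapP (suc i) r) ≡ ℤ.- X i r
X-swap i r rewrite transp-a (suc i) (2+ i) | transp-b (suc i) (2+ i) = lem (r (suc i)) (r (2+ i))
  where
  lem : ∀ a b → b ℤ.- a ≡ ℤ.- (a ℤ.- b)
  lem = solve-∀

X-swap-next : ∀ i r → X (suc i) (swapP (suc i) r) ≡ X i r ℤ.+ X (suc i) r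
X-swap-next i r rewrite transp-b (suc i) (2+ i) | transp-o {suc i} {2+ i} {suc (2+ i)} (m+1+n≢m (suc i) {1} ∘ trans (+-comm (suc i) 2)) 1+n≢n =
  lem (r (suc i)) (r (2+ i)) (r (suc (2+ i)))
  where
  lem : ∀ a b c → a ℤ.- c ≡ (a ℤ.- b) ℤ.+ (b ℤ.- c)
  lem = solve-∀

X-swap-prev : ∀ i r → X i (swapP (2+ i) r) ≡ X i r ℤ.+ X (suc i) r
X-swap-prev i r rewrite transp-a (2+ i) (suc (2+ i)) | transp-o {2+ i} {suc (2+ i)} {suc i} (1+n≢n ∘ sym) (m+1+n≢m (suc i) {1} ∘ trans (+-comm (suc i) 2) ∘ sym) =
  lem (r (suc i)) (r (2+ i)) (r (suc (2+ i)))
  where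
  lem : ∀ a b c → a ℤ.- c ≡ (a ℤ.- b) ℤ.+ (b ℤ.- c)
  lem = solve-∀

-- Commutation of distant divided differences: X (Y w) and X (v - vt) both equal the alternating sum
-- of f over the four rearrangements of the point. The letters s and t mark values at swapped
-- points.
far-ℤ : ∀ X Y w u us v vt f ft fs fst fts → X ≢ 0ℤ
  → X ℤ.* w ≡ u ℤ.- us → Y ℤ.* u ≡ f ℤ.- ft → Y ℤ.* us ≡ fs ℤ.- fst
  → X ℤ.* v ≡ f ℤ.- fs → X ℤ.* vt ≡ ft ℤ.- fts → fst ≡ fts
  → Y ℤ.* w ≡ v ℤ.- vt
far-ℤ X Y w u us v vt f ft fs fst fts n e₁ e₂ e₃ e₄ e₅ refl = cancelˡ _ _ n
  (trans (*-exchange X Y w) (trans (cong (Y ℤ.*_) e₁) (trans (l₂ Y u us) (trans (cong₂ ℤ._-_ e₂ e₃)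
  (trans (l₃ f ft fs fst) (trans (cong₂ ℤ._-_ (sym e₄) (sym e₅)) (sym (l₂ X v vt))))))))
  where
  l₂ : ∀ Y u v → Y ℤ.* (u ℤ.- v) ≡ Y ℤ.* u ℤ.- Y ℤ.* v
  l₂ = solve-∀
  l₃ : ∀ a b c d → (a ℤ.- b) ℤ.- (c ℤ.- d) ≡ (a ℤ.- c) ℤ.- (b ℤ.- d)
  l₃ = solve-∀

-- A divided difference is symmetric in its two variables, since exchanging them changes the sign of
-- numerator and denominator alike.
anti-≡ : ∀ X g gs a b → X ≢ 0ℤ → X ℤ.* g ≡ a ℤ.- b → (ℤ.- X) ℤ.* gs ≡ b ℤ.- a → gs ≡ g
anti-≡ X g gs a b n e e' = cancelˡ _ _ n
  (trans (l₁ X gs) (trans (cong ℤ.-_ e') (trans (l₂ a b) (sym e))))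
  where
  l₁ : ∀ X g → X ℤ.* g ≡ ℤ.- ((ℤ.- X) ℤ.* g)
  l₁ = solve-∀
  l₂ : ∀ a b → ℤ.- (b ℤ.- a) ≡ a ℤ.- b
  l₂ = solve-∀

-- X Z (Y w) and X Z (k - kt) both equal the alternating sum of f over the six rearrangements.
braid-ℤ : ∀ X Y Z w g' g's g gs gt gts f fs ft fts fst fsts k kt h hs ht hst
  → Z ≡ X ℤ.+ Y → X ≢ 0ℤ → Y ≢ 0ℤ → Z ≢ 0ℤ
  → X ℤ.* w ≡ g' ℤ.- g's → Y ℤ.* g' ≡ g ℤ.- gt → Z ℤ.* g's ≡ gs ℤ.- gts
  → X ℤ.* g ≡ f ℤ.- fs → (ℤ.- X) ℤ.* gs ≡ fs ℤ.- f → Z ℤ.* gt ≡ ft ℤ.- fst → Y ℤ.* gts ≡ fts ℤ.- fsts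
  → X ℤ.* k ≡ h ℤ.- hs → Z ℤ.* kt ≡ ht ℤ.- hst
  → Y ℤ.* h ≡ f ℤ.- ft → Z ℤ.* hs ≡ fs ℤ.- fts → (ℤ.- Y) ℤ.* ht ≡ ft ℤ.- f → X ℤ.* hst ≡ fst ℤ.- fsts
  → Y ℤ.* w ≡ k ℤ.- kt
braid-ℤ X Y Z w g' g's g gs gt gts f fs ft fts fst fsts k kt h hs ht hst refl nX nY nZ
  e₁ e₂ e₃ e₄ e₅ e₆ e₇ k₁ k₂ k₃ k₄ k₅ k₆
  with anti-≡ X g gs f fs nX e₄ e₅ | anti-≡ Y h ht f ft nY k₃ k₅
... | refl | refl = cancelˡ _ _ nX (cancelˡ _ _ nZ (trans side₁ (sym side₂)))
  where
  Σ₆ = ((f ℤ.- fs) ℤ.- (ft ℤ.- fst)) ℤ.+ (fts ℤ.- fsts)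
  a₁ : ∀ X Y w → (X ℤ.+ Y) ℤ.* (X ℤ.* (Y ℤ.* w)) ≡ ((X ℤ.+ Y) ℤ.* Y) ℤ.* (X ℤ.* w)
  a₁ = solve-∀
  a₂ : ∀ X Y a b → ((X ℤ.+ Y) ℤ.* Y) ℤ.* (a ℤ.- b) ≡ (X ℤ.+ Y) ℤ.* (Y ℤ.* a) ℤ.- Y ℤ.* ((X ℤ.+ Y) ℤ.* b)
  a₂ = solve-∀
  a₃ : ∀ X Y g gt gts → (X ℤ.+ Y) ℤ.* (g ℤ.- gt) ℤ.- Y ℤ.* (g ℤ.- gts) ≡ (X ℤ.* g ℤ.- (X ℤ.+ Y) ℤ.* gt) ℤ.+ Y ℤ.* gts
  a₃ = solve-∀
  side₁ : (X ℤ.+ Y) ℤ.* (X ℤ.* (Y ℤ.* w)) ≡ Σ₆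
  side₁ = trans (a₁ X Y w) (trans (cong (((X ℤ.+ Y) ℤ.* Y) ℤ.*_) e₁) (trans (a₂ X Y g' g's)
    (trans (cong₂ (λ p q → (X ℤ.+ Y) ℤ.* p ℤ.- Y ℤ.* q) e₂ e₃) (trans (a₃ X Y g gt gts)
    (cong₂ ℤ._+_ (cong₂ ℤ._-_ e₄ e₆) e₇)))))
  b₁ : ∀ X Y k kt → (X ℤ.+ Y) ℤ.* (X ℤ.* (k ℤ.- kt)) ≡ (X ℤ.+ Y) ℤ.* (X ℤ.* k) ℤ.- X ℤ.* ((X ℤ.+ Y) ℤ.* kt)
  b₁ = solve-∀
  b₂ : ∀ X Y h hs hst → (X ℤ.+ Y) ℤ.* (h ℤ.- hs) ℤ.- X ℤ.* (h ℤ.- hst) ≡ (Y ℤ.* h ℤ.- (X ℤ.+ Y) ℤ.* hs) ℤ.+ X ℤ.* hst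
  b₂ = solve-∀
  b₃ : ∀ f fs ft fts fst fsts → ((f ℤ.- ft) ℤ.- (fs ℤ.- fts)) ℤ.+ (fst ℤ.- fsts) ≡ ((f ℤ.- fs) ℤ.- (ft ℤ.- fst)) ℤ.+ (fts ℤ.- fsts)
  b₃ = solve-∀
  side₂ : (X ℤ.+ Y) ℤ.* (X ℤ.* (k ℤ.- kt)) ≡ Σ₆
  side₂ = trans (b₁ X Y k kt) (trans (cong₂ (λ p q → (X ℤ.+ Y) ℤ.* p ℤ.- X ℤ.* q) k₁ k₂)
    (trans (b₂ X Y h hs hst) (trans (cong₂ ℤ._+_ (cong₂ ℤ._-_ k₃ k₄) k₆) (b₃ f fs ft fts fst fsts))))

-- With zero-based indices, w arises from f by ∂_i, ∂_{i+1}, ∂_i in turn and k by ∂_{i+1}, ∂_i; then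
-- w is ∂_{i+1} k. Extensionality of f is assumed because a point swapped twice agrees with the
-- original only pointwise.
braid-DD : ∀ {N i} (f g g' w h k : Point → ℤ) → suc (2+ i) ≤ N
  → (∀ r r' → (∀ j → r j ≡ r' j) → f r ≡ f r')
  → DD N i f g → DD N (suc i) g g' → DD N i g' w → DD N (suc i) f h → DD N i h k → DD N (suc i) k w
braid-DD {N} {i} f g g' w h k q ext F G G' F' H' r d =
  braid-ℤ (X i r) (X (suc i) r) (X i r ℤ.+ X (suc i) r)
    (w r) (g' r) (g' (s r)) (g r) (g (s r)) (g (t r)) (g (t (s r)))
    (f r) (f (s r)) (f (t r)) (f (t (s r))) (f (s (t r))) (f (s (t (s r))))
    (k r) (k (t r)) (h r) (h (s r)) (h (t r)) (h (s (t r)))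
    refl (X≢0 (<⇒≤ q) d) (X≢0 q d) (λ e → X≢0 q ds (trans (X-swap-next i r) e))
    (G' r d) (G r d) (subst (λ z → z ℤ.* g' (s r) ≡ g (s r) ℤ.- g (t (s r))) (X-swap-next i r) (G (s r) ds))
    (F r d)
    (subst₂ (λ z y → z ℤ.* g (s r) ≡ f (s r) ℤ.- y) (X-swap i r) (ext _ _ (λ j → cong r (transp-invol (suc i) (2+ i) j))) (F (s r) ds))
    (subst (λ z → z ℤ.* g (t r) ≡ f (t r) ℤ.- f (s (t r))) (X-swap-prev i r) (F (t r) dt))
    (subst (λ z → z ℤ.* g (t (s r)) ≡ f (t (s r)) ℤ.- f (s (t (s r)))) Xts (F (t (s r)) (distinct-swap q ds)))
    (H' r d) (subst (λ z → z ℤ.* k (t r) ≡ h (t r) ℤ.- h (s (t r))) (X-swap-prev i r) (H' (t r) dt))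
    (F' r d) (subst (λ z → z ℤ.* h (s r) ≡ f (s r) ℤ.- f (t (s r))) (X-swap-next i r) (F' (s r) ds))
    (subst₂ (λ z y → z ℤ.* h (t r) ≡ f (t r) ℤ.- y) (X-swap (suc i) r) (ext _ _ (λ j → cong r (transp-invol (2+ i) (suc (2+ i)) j))) (F' (t r) dt))
    (subst₂ (λ z y → z ℤ.* h (s (t r)) ≡ f (s (t r)) ℤ.- y) Xst (ext _ _ (λ j → cong r (braid j))) (F' (s (t r)) (distinct-swap (<⇒≤ q) dt)))
  where
  s t : Point → Point
  s = swapP (suc i)
  t = swapP (2+ i)
  ds = distinct-swap (<⇒≤ q) d
  dt = distinct-swap q d
  a = suc i
  b = 2+ i
  c = suc (2+ i)
  l₁ : ∀ x y → (ℤ.- x) ℤ.+ (x ℤ.+ y) ≡ y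
  l₁ = solve-∀
  l₂ : ∀ x y → (x ℤ.+ y) ℤ.+ (ℤ.- y) ≡ x
  l₂ = solve-∀
  Xts : X i (t (s r)) ≡ X (suc i) r
  Xts = trans (X-swap-prev i (s r)) (trans (cong₂ ℤ._+_ (X-swap i r) (X-swap-next i r)) (l₁ (X i r) (X (suc i) r)))
  Xst : X (suc i) (s (t r)) ≡ X i r
  Xst = trans (X-swap-next i (t r)) (trans (cong₂ ℤ._+_ (X-swap-prev i r) (X-swap (suc i) r)) (l₂ (X i r) (X (suc i) r)))
  a≢c : a ≢ c
  a≢c = <⇒≢ (s≤s (n≤1+n (suc i)))
  braid : ∀ j → transp b c (transp a b (transp b c j)) ≡ transp a b (transp b c (transp a b j))
  braid j = trans (transp-conj b c a b (transp b c j))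
    (trans (cong₂ (λ x y → transp x y (transp b c (transp b c j))) (transp-o (1+n≢n ∘ sym) a≢c) (transp-a b c))
    (trans (cong (transp a c) (trans (transp-invol b c j) (sym (transp-invol a b j))))
    (sym (trans (transp-conj a b b c (transp a b j))
      (cong₂ (λ x y → transp x y (transp a b (transp a b j))) (transp-b a b) (transp-o (a≢c ∘ sym) 1+n≢n))))))

asc-far : ∀ {i j w} → suc i < j → AscAt i w → AscAt j w
  → AscAt j (swapAt i w) × AscAt i (swapAt j w) × swapAt i (swapAt j w) ≡ swapAt j (swapAt i w)
asc-far h (here p) (there (here q)) = ⊥-elim (<-irrefl refl h)
asc-far h (here p) (there (there b)) = there (there b) , here p , refl
asc-far (s<s h) (there a) (there b) with asc-far h a b
... | p , q , e = there p , there q , cong (_ ∷_) e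

-- Three increasing neighbours can be reversed along either side of the braid relation, and each of
-- the three swaps is then made at an ascent.
asc-near : ∀ {i w} → AscAt i w → AscAt (suc i) w
  → AscAt (suc i) (swapAt i w) × AscAt i (swapAt (suc i) (swapAt i w))
  × AscAt i (swapAt (suc i) w) × AscAt (suc i) (swapAt i (swapAt (suc i) w))
  × swapAt (suc i) (swapAt i (swapAt (suc i) w)) ≡ swapAt i (swapAt (suc i) (swapAt i w))
asc-near (here p) (there (here q)) = there (here (<-trans p q)) , here q , here (<-trans p q) , there (here p) , refl
asc-near (there a) (there b) with asc-near a b
... | p , q , r , s , e = there p , there q , there r , there s , cong (_ ∷_) e

S-cong : ∀ w r r' → (∀ j → r j ≡ r' j) → S w r ≡ S w r'
S-cong w r r' h = ev-cong (schub w) {r} {r'} (λ j → h (suc j))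

S-first : ∀ {i w} N → FirstAsc i w → DD N i (S (swapAt i w)) (S w)
S-first {i} {w} N a r d = trans (cong (λ p → X i r ℤ.* ev p r) (schub-step a)) (∂-spec i (schub (swapAt i w)) r)

X-off : ∀ {a b} i r → suc i ≢ a → suc i ≢ b → 2+ i ≢ a → 2+ i ≢ b → X i (r ∘ transp a b) ≡ X i r
X-off i r p q p' q' = cong₂ (λ x y → r x ℤ.- r y) (transp-o p q) (transp-o p' q')

far-DD : ∀ {N i j} (f g h w : Point → ℤ) → suc i < j → 2+ j ≤ N
  → (∀ r r' → (∀ k → r k ≡ r' k) → f r ≡ f r')
  → DD N j f g → DD N i g w → DD N i f h → DD N j h w
far-DD {N} {i} {j} f g h w far q ext G W H' r d =
  far-ℤ (X i r) (X j r) (w r) (g r) (g (s r)) (h r) (h (t r)) (f r) (f (t r)) (f (s r)) (f (t (s r))) (f (s (t r)))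
    (X≢0 i≤ d) (W r d) (G r d)
    (subst (λ x → x ℤ.* g (s r) ≡ f (s r) ℤ.- f (t (s r))) (X-off j r (n₁ ∘ sym) (n₂ ∘ sym) (n₃ ∘ sym) (n₄ ∘ sym)) (G (s r) (distinct-swap i≤ d)))
    (H' r d)
    (subst (λ x → x ℤ.* h (t r) ≡ f (t r) ℤ.- f (s (t r))) (X-off i r n₁ n₃ n₂ n₄) (H' (t r) (distinct-swap q d)))
    (ext _ _ (λ k → cong r (transp-comm n₁ n₃ n₂ n₄ k)))
  where
  s t : Point → Point
  s = swapP (suc i)
  t = swapP (suc j)
  i≤ = ≤-trans (s≤s (<⇒≤ far)) (<⇒≤ q)
  n₁ : suc i ≢ suc j
  n₁ = <⇒≢ (s≤s (<⇒≤ far))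
  n₂ : 2+ i ≢ suc j
  n₂ = <⇒≢ (s≤s far)
  n₃ : suc i ≢ 2+ j
  n₃ = <⇒≢ (s≤s (m≤n⇒m≤1+n (<⇒≤ far)))
  n₄ : 2+ i ≢ 2+ j
  n₄ = <⇒≢ (s≤s (m≤n⇒m≤1+n far))

len-<-swapAt : ∀ {i w} → AscAt i w → len w < len (swapAt i w)
len-<-swapAt a = ≤-reflexive (sym (len-swapAt a))

-- The recursion along first ascents is compatible with every ascent, because divided
-- differences satisfy the commutation and braid relations.
S-asc : ∀ f {N w} → length w ≡ N → Enough f w → ∀ {i} → AscAt i w → DD N i (S (swapAt i w)) (S w)
S-asc zero {N} {w} lw e a = ⊥-elim (<⇒≱ e (len-≤ w))
S-asc (suc f) {N} {w} lw e {i} a = go (ascents w)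
  where
  IH : ∀ {w'} → len w < len w' → length w' ≡ length w → ∀ {j} → AscAt j w' → DD N j (S (swapAt j w')) (S w')
  IH {w'} l l' = S-asc f {N} {w'} (trans l' lw)
    (subst (λ n → n * n < f + len w') (sym l') (<-≤-trans e (≤-trans (≤-reflexive (sym (+-suc f (len w)))) (+-monoʳ-≤ f l))))
  go : Ascents w → DD N i (S (swapAt i w)) (S w)
  go (none l _) = ⊥-elim (linked-no-asc l a)
  go (first k b) with <-cmp k i
  ... | tri≈ _ refl _ = S-first N b
  ... | tri> _ _ h = ⊥-elim (<⇒≱ h (asc-after-first b a))
  ... | tri< h _ _ with m≤n⇒m<n∨m≡n h
  ...   | inj₁ far with asc-far far (FirstAsc⇒AscAt b) a
  ...     | p , q , z = far-DD (S (swapAt i u)) (S u) (S v) (S w) far (subst (2+ i ≤_) lw (ascAt-< a)) (S-cong (swapAt i u))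
            (IH (len-<-swapAt (FirstAsc⇒AscAt b)) (length-swapAt k w) p)
            (S-first N b)
            (subst (λ y → DD N k (S y) (S v)) z (IH (len-<-swapAt a) (length-swapAt i w) q))
    where
    u = swapAt k w
    v = swapAt i w
  go (first k b) | tri< h _ _ | inj₂ refl with asc-near (FirstAsc⇒AscAt b) a
  ... | p , q , p' , q' , z = braid-DD (S (swapAt k u₂)) (S u₂) (S u) (S w) (S v₂) (S v)
            (subst (suc (2+ k) ≤_) lw (ascAt-< a)) (S-cong (swapAt k u₂))
            (IH (<-trans lu (len-<-swapAt p)) (trans (length-swapAt (suc k) u) (length-swapAt k w)) q)
            (IH lu (length-swapAt k w) p)
            (S-first N b)
            (subst (λ y → DD N (suc k) (S y) (S v₂)) z (IH (<-trans lv (len-<-swapAt p')) (trans (length-swapAt k v) (length-swapAt (suc k) w)) q'))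
            (IH lv (length-swapAt (suc k) w) p')
    where
    u = swapAt k w
    u₂ = swapAt (suc k) u
    v = swapAt (suc k) w
    v₂ = swapAt k v
    lu = len-<-swapAt (FirstAsc⇒AscAt b)
    lv = len-<-swapAt a

S-rule : ∀ {N w} i → InS N w → 2+ i ≤ N → app w (suc i) < app w (2+ i)
  → DD N i (S (mulT w (suc i) (2+ i))) (S w)
S-rule {N} {w} i s q h = subst (λ v → DD N i (S v) (S w)) (sym (mulT-swapAt i w q'))
  (S-asc _ (len-eq s) (enough-start w) (app-asc w i q' h))
  where
  q' = subst (2+ i ≤_) (sym (len-eq s)) q

-- At an ascent `S w` is itself a divided difference in these two variables.
S-symmetric : ∀ {N w} i → InS N w → 2+ i ≤ N → app w (suc i) < app w (2+ i)
  → ∀ r → Distinct N r → S w (swapP (suc i) r) ≡ S w r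
S-symmetric {N} {w} i s q h r d = anti-≡ (X i r) (S w r) (S w (swapP (suc i) r)) (S v r) (S v (swapP (suc i) r)) (X≢0 q d)
  (S-rule i s q h r d)
  (subst₂ (λ z y → z ℤ.* S w (swapP (suc i) r) ≡ S v (swapP (suc i) r) ℤ.- y) (X-swap i r)
    (S-cong v _ _ (λ j → cong r (transp-invol (suc i) (2+ i) j)))
    (S-rule i s q h (swapP (suc i) r) (distinct-swap q d)))
  where
  v = mulT w (suc i) (2+ i)

-- Dominant permutations

-- The Lehmer code. Dominant permutations are those whose code decreases weakly, and their Schubert
-- polynomial is the monomial with the code as exponents.
codes : List ℕ → List ℕ
codes [] = []
codes (x ∷ w) = countBelow x w ∷ codes w

countBelow-mono : ∀ {x y} → x ≤ y → ∀ v → countBelow x v ≤ countBelow y v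
countBelow-mono p [] = z≤n
countBelow-mono {x} p (z ∷ v) with z <? x
... | yes q rewrite <ᵇ-yes q | <ᵇ-yes (<-≤-trans q p) = s≤s (countBelow-mono p v)
... | no q rewrite <ᵇ-no (≮⇒≥ q) = ≤-trans (countBelow-mono p v) (m≤n+m _ _)

countBelow-skip : ∀ {x y} w → x ≤ y → countBelow x (y ∷ w) ≡ countBelow x w
countBelow-skip w p rewrite <ᵇ-no p = refl

countBelow-take : ∀ {x y} w → y < x → countBelow x (y ∷ w) ≡ suc (countBelow x w)
countBelow-take w p rewrite <ᵇ-yes p = refl

-- At the first ascent of a dominant permutation the code is constant,
-- and swapping there raises the first of the two entries by one.
codes-equal : ∀ {x y w} → x < y → Linked _≥_ (codes (x ∷ y ∷ w)) → countBelow x w ≡ countBelow y w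
codes-equal {x} {y} {w} p (q ∷ _) = ≤-antisym (countBelow-mono (<⇒≤ p) w) (subst (countBelow y w ≤_) (countBelow-skip w (<⇒≤ p)) q)

codes-raise : ∀ {i w} → FirstAsc i w → Linked _≥_ (codes w) → ∀ r → evM (codes (swapAt i w)) r ≡ r (suc i) ℤ.* evM (codes w) r
codes-raise {w = x ∷ y ∷ w} (here p) l r = here-case (codes-equal {x} {y} {w} p l)
  where
  here-case : countBelow x w ≡ countBelow y w → evM (codes (y ∷ x ∷ w)) r ≡ r 1 ℤ.* evM (codes (x ∷ y ∷ w)) r
  here-case e rewrite countBelow-take w p | countBelow-skip w (<⇒≤ p) | e =
    ℤP.*-assoc (r 1) (r 1 ℤ.^ countBelow y w) (r 2 ℤ.^ countBelow y w ℤ.* evM (codes w) (r ∘ suc ∘ suc))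
codes-raise {suc i} {x ∷ y ∷ w} (there q a) l r
  rewrite countBelow-swapAt x i (y ∷ w) | codes-raise a (Linked.tail l) (r ∘ suc) =
  *-exchange (r 1 ℤ.^ countBelow x (y ∷ w)) (r (2+ i)) (evM (codes (y ∷ w)) (r ∘ suc))

codes-constant : ∀ {i w} → FirstAsc i w → Linked _≥_ (codes w) → get (codes w) i ≡ get (codes w) (suc i)
codes-constant {w = x ∷ y ∷ w} (here p) l = trans (countBelow-skip w (<⇒≤ p)) (codes-equal {x} {y} {w} p l)
codes-constant (there q a) (_ ∷ l) = codes-constant a l

-- Only one code entry grows, so the order could fail only against the entry before it. If y < z is
-- the first ascent and x stands before y, then x > y, and counting y gives x the room for the
-- increase.
codes-dominant : ∀ {i w} → Unique w → FirstAsc i w → Linked _≥_ (codes w) → Linked _≥_ (codes (swapAt i w))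
codes-dominant {w = x ∷ y ∷ w} u (here p) l@(_ ∷ l') =
  subst₂ (λ a b → Linked _≥_ (a ∷ b ∷ codes w)) (sym (countBelow-take w p)) (sym (codes-equal {x} {y} {w} p l)) (n≤1+n _ ∷ l')
codes-dominant {w = x ∷ y ∷ z ∷ w} ((y≢x ∷ _) ∷ u) (there q (here p)) (d ∷ l) = head≥ ∷ codes-dominant u (here p) l
  where
  y<x = ≤∧≢⇒< q (y≢x ∘ sym)
  head≥ : countBelow z (y ∷ w) ≤ countBelow x (z ∷ y ∷ w)
  head≥ = subst₂ _≤_ (sym (trans (countBelow-take w p) (cong suc (sym (codes-equal {y} {z} {w} p l))))) (sym (trans (countBelow-swapAt x 0 (y ∷ z ∷ w)) (countBelow-take (z ∷ w) y<x)))
    (s≤s (≤-trans (countBelow-mono (<⇒≤ y<x) w) (m≤n+m _ _)))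
codes-dominant {2+ i} {x ∷ y ∷ z ∷ w} (_ ∷ u) (there q (there q' a)) (d ∷ l) =
  subst₂ _≤_ (sym (countBelow-swapAt y i (z ∷ w))) (sym (countBelow-swapAt x (suc i) (y ∷ z ∷ w))) d ∷ codes-dominant u (there q' a) l

all-swapAt : ∀ {P : ℕ → Set} i w → All P w → All P (swapAt i w)
all-swapAt zero [] a = a
all-swapAt zero (x ∷ []) a = a
all-swapAt zero (x ∷ y ∷ w) (p ∷ q ∷ a) = q ∷ p ∷ a
all-swapAt (suc i) [] a = a
all-swapAt (suc i) (x ∷ w) (p ∷ a) = p ∷ all-swapAt i w a

unique-swapAt : ∀ i w → Unique w → Unique (swapAt i w)
unique-swapAt zero [] u = u
unique-swapAt zero (x ∷ []) u = u
unique-swapAt zero (x ∷ y ∷ w) ((p ∷ a) ∷ b ∷ u) = ((p ∘ sym) ∷ b) ∷ a ∷ u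
unique-swapAt (suc i) [] u = u
unique-swapAt (suc i) (x ∷ w) (a ∷ u) = all-swapAt i w a ∷ unique-swapAt i w u

descending : ∀ {w} → Unique w → Linked _≥_ w → AllPairs _>_ w
descending u l = AllPairs.zipWith (λ { (n , q) → ≤∧≢⇒< q (n ∘ sym) }) (u , Linked⇒AllPairs (λ p q → ≤-trans q p) l)

countBelow-all : ∀ {x w} → All (x >_) w → countBelow x w ≡ length w
countBelow-all [] = refl
countBelow-all (p ∷ a) rewrite <ᵇ-yes p = cong suc (countBelow-all a)

codes-descending : ∀ {w} → AllPairs _>_ w → codes w ≡ applyUpTo (λ j → length w ∸ suc j) (length w)
codes-descending [] = refl
codes-descending (a ∷ d) = cong₂ _∷_ (countBelow-all a) (codes-descending d)

codes-descending-linked : ∀ {w} → AllPairs _>_ w → Linked _≥_ (codes w)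
codes-descending-linked [] = []
codes-descending-linked ([] ∷ []) = [-]
codes-descending-linked {x ∷ y ∷ w} ((p ∷ a) ∷ d) = ≤-trans (countBelow-mono (<⇒≤ p) w) (m≤n+m _ _) ∷ codes-descending-linked d

S-none : ∀ {w} → firstAscentFrom 1 w ≡ nothing → schub w ≡ staircase (length w)
S-none e rewrite e = refl

evM-symmetric : ∀ i e r → get e i ≡ get e (suc i) → evM e (swapP (suc i) r) ≡ evM e r
evM-symmetric i e r q = trans (evM-split i e (swapP (suc i) r)) (trans
  (cong₂ (λ x y → x ℤ.* y) (cong (ℤ._^ get e i) (cong r (transp-a (suc i) (2+ i))))
     (cong₂ (λ x y → x ℤ.^ get e (suc i) ℤ.* y) (cong r (transp-b (suc i) (2+ i))) (restM-cong i e (λ j n m → cong r (transp-o n m)))))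
  (trans (rearrange q) (sym (evM-split i e r))))
  where
  rearrange : get e i ≡ get e (suc i) →
    r (2+ i) ℤ.^ get e i ℤ.* (r (suc i) ℤ.^ get e (suc i) ℤ.* restM i e r) ≡ r (suc i) ℤ.^ get e i ℤ.* (r (2+ i) ℤ.^ get e (suc i) ℤ.* restM i e r)
  rearrange q rewrite q = *-exchange (r (2+ i) ℤ.^ get e (suc i)) (r (suc i) ℤ.^ get e (suc i)) (restM i e r)

-- At the first ascent the code has two equal entries, so its monomial is symmetric in the two
-- variables, and the swapped permutation has this monomial times x_{i+1}. The divided difference of
-- that product is the monomial again. Without ascents the code is the staircase.
S-dominant : ∀ f {N w} → length w ≡ N → Enough f w → Unique w → Linked _≥_ (codes w) → ∀ r → Distinct N r → S w r ≡ evM (codes w) r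
S-dominant zero {w = w} lw e u l r d = ⊥-elim (<⇒≱ e (len-≤ w))
S-dominant (suc f) {N} {w} lw e u l r d with ascents w
... | none m h = trans (cong (λ p → ev p r) (S-none {w} (h 1)))
    (trans (ℤP.+-identityʳ _) (trans (ℤP.*-identityˡ _)
    (cong (λ c → evM c r) (trans (LP.map-upTo (λ j → length w ∸ suc j) (length w)) (sym (codes-descending (descending u m)))))))
... | first i a = cancelˡ _ _ (X≢0 i≤ d)
    (trans (S-first N a r d) (trans (cong₂ ℤ._-_ (IH r d) (IH (swapP (suc i) r) (distinct-swap i≤ d)))
    (trans (cong₂ ℤ._-_ (codes-raise a l r)
       (trans (codes-raise a l (swapP (suc i) r)) (cong₂ ℤ._*_ (cong r (transp-a (suc i) (2+ i))) (evM-symmetric i (codes w) r (codes-constant a l)))))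
    (lem (r (suc i)) (r (2+ i)) (evM (codes w) r)))))
  where
  i≤ = subst (2+ i ≤_) lw (ascAt-< (FirstAsc⇒AscAt a))
  IH = S-dominant f {N} {swapAt i w} (trans (length-swapAt i w) lw) (enough-swap {f} (FirstAsc⇒AscAt a) e) (unique-swapAt i w u) (codes-dominant u a l)
  lem : ∀ a b c → a ℤ.* c ℤ.- b ℤ.* c ≡ (a ℤ.- b) ℤ.* c
  lem = solve-∀

∈-get : ∀ {y w} → y ∈ w → ∃[ k ] (k < length w × get w k ≡ y)
∈-get (here refl) = 0 , z<s , refl
∈-get (there p) with ∈-get p
... | k , q , e = suc k , s<s q , e

valid-unique : ∀ w → (∀ i j → i < length w → j < length w → get w i ≡ get w j → i ≡ j) → Unique w
valid-unique [] h = []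
valid-unique (x ∷ w) h = All.tabulate (λ p → let k , q , e = ∈-get p in λ x≡ → 0≢1+n (h 0 (suc k) z<s (s<s q) (trans x≡ (sym e))))
  ∷ valid-unique w (λ i j p q e → suc-injective (h (suc i) (suc j) (s<s p) (s<s q) e))

inS-unique : ∀ {N w} → InS N w → Unique w
inS-unique {w = w} s = valid-unique w (λ i j p q e → suc-injective (app-inj (valid s) (trans (app-in w p) (trans e (sym (app-in w q))))))

-- Stability under adding a fixed point

codes-snoc : ∀ w z → All (_≤ z) w → codes (w ++ z ∷ []) ≡ codes w ++ 0 ∷ []
codes-snoc [] z [] = refl
codes-snoc (x ∷ w) z (p ∷ a) = cong₂ _∷_ (cb w) (codes-snoc w z a)
  where
  cb : ∀ w → countBelow x (w ++ z ∷ []) ≡ countBelow x w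
  cb [] = countBelow-skip [] p
  cb (y ∷ w) = cong ((if y <ᵇ x then 1 else 0) +_) (cb w)

evM-snoc-0 : ∀ e r → evM (e ++ 0 ∷ []) r ≡ evM e r
evM-snoc-0 [] r = refl
evM-snoc-0 (x ∷ e) r = cong (r 1 ℤ.^ x ℤ.*_) (evM-snoc-0 e (r ∘ suc))

linked-snoc-0 : ∀ {l} → Linked _≥_ l → Linked _≥_ (l ++ 0 ∷ [])
linked-snoc-0 [] = [-]
linked-snoc-0 [-] = z≤n ∷ [-]
linked-snoc-0 (p ∷ l) = p ∷ linked-snoc-0 l

FirstAsc-++ : ∀ {i w} v → FirstAsc i w → FirstAsc i (w ++ v)
FirstAsc-++ v (here p) = here p
FirstAsc-++ v (there q a) = there q (FirstAsc-++ v a)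

swapAt-++ : ∀ {i w} v → FirstAsc i w → swapAt i (w ++ v) ≡ swapAt i w ++ v
swapAt-++ v (here p) = refl
swapAt-++ v (there q a) = cong (_ ∷_) (swapAt-++ v a)

unique-snoc : ∀ {w z} → Unique w → All (_< z) w → Unique (w ++ z ∷ [])
unique-snoc [] [] = [] ∷ []
unique-snoc {x ∷ w} {z} (n ∷ u) (p ∷ a) = all-snoc n (<⇒≢ p) ∷ unique-snoc u a
  where
  all-snoc : ∀ {w} → All (x ≢_) w → x ≢ z → All (x ≢_) (w ++ z ∷ [])
  all-snoc [] q = q ∷ []
  all-snoc (n ∷ a) q = n ∷ all-snoc a q

distinct-≤ : ∀ {N K r} → N ≤ K → Distinct K r → Distinct N r
distinct-≤ p d i j a b c = d i j a b (≤-trans c p)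

-- Both sides follow the same first ascents until w is descending. With z appended the list still
-- ascends at its end, so it is not the longest element of its group; but it is dominant, with the
-- staircase followed by 0 as its code.
S-snoc : ∀ f {N w z} → length w ≡ N → Enough f w → Unique w → All (_< z) w → ∀ r → Distinct (suc N) r → S (w ++ z ∷ []) r ≡ S w r
S-snoc zero {w = w} lw e u b r d = ⊥-elim (<⇒≱ e (len-≤ w))
S-snoc (suc f) {N} {w} {z} lw e u b r d with ascents w
... | none m h =
  let l = codes-descending-linked (descending u m)
      c≡ = codes-snoc w z (All.map <⇒≤ b)
      lw' = trans (LP.length-++ w) (trans (+-comm (length w) 1) (cong suc lw)) in
  trans (S-dominant _ lw' (enough-start (w ++ z ∷ [])) (unique-snoc u b) (subst (Linked _≥_) (sym c≡) (linked-snoc-0 l)) r d)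
  (trans (cong (λ c → evM c r) c≡) (trans (evM-snoc-0 (codes w) r)
  (sym (S-dominant _ lw (enough-start w) u l r (distinct-≤ (n≤1+n N) d)))))
... | first i a = cancelˡ _ _ (X≢0 i≤ d)
    (trans (S-first (suc N) (FirstAsc-++ (z ∷ []) a) r d)
    (trans (cong₂ ℤ._-_ (trans (cong (λ v → S v r) (swapAt-++ (z ∷ []) a)) (IH r d))
                        (trans (cong (λ v → S v (swapP (suc i) r)) (swapAt-++ (z ∷ []) a)) (IH (swapP (suc i) r) (distinct-swap i≤ d))))
    (sym (S-first N a r (distinct-≤ (n≤1+n N) d)))))
  where
  i≤ = m≤n⇒m≤1+n (subst (2+ i ≤_) lw (ascAt-< (FirstAsc⇒AscAt a)))
  IH = S-snoc f {N} {swapAt i w} {z} (trans (length-swapAt i w) lw) (enough-swap {f} (FirstAsc⇒AscAt a) e) (unique-swapAt i w u) (all-swapAt i w b)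

-- Monk's rule

FixesAbove : ℕ → Perm → Set
FixesAbove P w = ∀ j → P < j → app w j ≡ j

fixes-≤ : ∀ {P w j} → Valid w → FixesAbove P w → j ≤ P → app w j ≤ P
fixes-≤ {P} {w} {j} v f p with app w j ≤? P
... | yes q = q
... | no n = ⊥-elim (n (subst (_≤ P) (sym (app-inj v (f (app w j) (≰⇒> n)))) p))

fixes-mulT : ∀ {P w a b} → 1 ≤ a → a < b → b ≤ P → FixesAbove P w → FixesAbove P (mulT w a b)
fixes-mulT {P} {w} {a} {b} p q r f j h = trans
  (app-mulT-o w a b {j} p (≤-trans p (<⇒≤ q)) (λ { refl → <⇒≱ h (≤-trans (<⇒≤ q) r) }) (λ { refl → <⇒≱ h r })) (f j h)

-- The signed contribution of the transposition (k j) to Monk's rule. A single family over all j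
-- allows the sum to be reindexed by an adjacent transposition.
sop : ℕ → ℕ → (Perm → ℤ) → Perm → ℤ
sop k j F w = if k <ᵇ j then op k j F w else (if j <ᵇ k then ℤ.- op j k F w else 0ℤ)

sop-< : ∀ {k j} F w → k < j → sop k j F w ≡ op k j F w
sop-< F w p rewrite <ᵇ-yes p = refl

sop-> : ∀ {k j} F w → j < k → sop k j F w ≡ ℤ.- op j k F w
sop-> F w p rewrite <ᵇ-no (<⇒≤ p) | <ᵇ-yes p = refl

sop-≡ : ∀ k F w → sop k k F w ≡ 0ℤ
sop-≡ k F w rewrite <ᵇ-no (≤-refl {k}) = refl

unique-range : ∀ n L → Unique (range n L)
unique-range n L = Unique.map⁺ (+-cancelˡ-≡ n _ _) (Unique.upTo⁺ L)

∈-range : ∀ {n L j} → n ≤ j → j < n + L → j ∈ range n L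
∈-range {n} {L} {j} p q = subst (_∈ range n L) (m+[n∸m]≡n p)
  (∈-map⁺ (n +_) (∈-upTo⁺ (+-cancelˡ-< n _ _ (subst (_< n + L) (sym (m+[n∸m]≡n p)) q))))

range-∈ : ∀ {n L j} → j ∈ range n L → n ≤ j × j < n + L
range-∈ {n} {L} {j} p with ∈-map⁻ (n +_) p
... | k , q , refl = m≤m+n n k , +-monoʳ-< n (∈-upTo⁻ q)

Σ-transp : ∀ {A a b} f → Unique A → a ∈ A → b ∈ A → a ≢ b → ΣL A f ≡ ΣL A (f ∘ transp a b)
Σ-transp {A} {a} {b} f u a∈ b∈ n =
  trans (split f) (trans (+ℤ-exchange (f a) (f b) (ΣL (A ∖ a ∖ b) f))
  (trans (cong₂ (λ x y → x ℤ.+ (y ℤ.+ ΣL (A ∖ a ∖ b) f)) (cong f (sym (transp-a a b))) (cong f (sym (transp-b a b))))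
  (trans (cong (λ z → f (transp a b a) ℤ.+ (f (transp a b b) ℤ.+ z)) (Σ-cong (A ∖ a ∖ b) rest))
  (sym (split (f ∘ transp a b))))))
  where
  split : ∀ g → ΣL A g ≡ g a ℤ.+ (g b ℤ.+ ΣL (A ∖ a ∖ b) g)
  split g = trans (Σ-remove g u a∈) (cong (λ z → g a ℤ.+ z) (Σ-remove g (∖-unique a u) (∈-∖ A b∈ (n ∘ sym))))
  rest : ∀ x → x ∈ A ∖ a ∖ b → f x ≡ f (transp a b x)
  rest x p with ∖-∈ (A ∖ a) p
  ... | q , x≢b = cong f (sym (transp-o (proj₂ (∖-∈ A q)) x≢b))

Σ-δ : ∀ {A k} v → Unique A → k ∈ A → ΣL A (λ j → if j ≡ᵇ k then v else 0ℤ) ≡ v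
Σ-δ {A} {k} v u p = trans (Σ-remove (λ j → if j ≡ᵇ k then v else 0ℤ) u p)
  (trans (cong₂ ℤ._+_ at (trans (Σ-cong (A ∖ k) off') (Σ-0 (A ∖ k)))) (ℤP.+-identityʳ v))
  where
  at : (if k ≡ᵇ k then v else 0ℤ) ≡ v
  at rewrite ≡ᵇ-yes {k} {k} refl = refl
  off' : ∀ x → x ∈ A ∖ k → (if x ≡ᵇ k then v else 0ℤ) ≡ 0ℤ
  off' x q rewrite ≡ᵇ-no (proj₂ (∖-∈ A q)) = refl

transp-mono : ∀ a {k j} → k < j → ¬ (k ≡ a × j ≡ suc a) → transp a (suc a) k < transp a (suc a) j
transp-mono a {k} {j} p n with transp a (suc a) k | transp-view a (suc a) k | transp a (suc a) j | transp-view a (suc a) j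
... | _ | at-a refl | _ | at-a refl = ⊥-elim (<-irrefl refl p)
... | _ | at-a refl | _ | at-b refl = ⊥-elim (n (refl , refl))
... | _ | at-a refl | _ | off _ m = ≤∧≢⇒< p (m ∘ sym)
... | _ | at-b refl | _ | at-a refl = ⊥-elim (<-asym p (n<1+n a))
... | _ | at-b refl | _ | at-b refl = ⊥-elim (<-irrefl refl p)
... | _ | at-b refl | _ | off _ _ = <-trans (n<1+n a) p
... | _ | off _ _ | _ | at-a refl = m<n⇒m<1+n p
... | _ | off m _ | _ | at-b refl = ≤∧≢⇒< (s≤s⁻¹ p) m
... | _ | off _ _ | _ | off _ _ = p

-- Applying a divided difference to Monk's rule for v = w s gives Monk's rule for w:
-- ∂ maps the term of a transposition t ≠ s at v to the term of s t s at w.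
module MonkStep {N : ℕ} (w : Perm) (i : ℕ) (s : InS N w) (q : 2+ i ≤ N)
  (h : app w (suc i) < app w (2+ i)) (r : Point) (d : Distinct N r) where

  a = suc i
  b = 2+ i
  σ = transp a b
  v = mulT w a b
  r' = swapP a r
  d' = distinct-swap {i = i} q d
  sv : InS N v
  sv = inS-mulT z<s (n<1+n a) q s
  Sr : Point → Perm → ℤ
  Sr ρ u = S u ρ
  lenv : len v ≡ suc (len w)
  lenv = len-adj-asc s z<s q h

  σ-range : ∀ {j} → 1 ≤ j → j ≤ N → 1 ≤ σ j × σ j ≤ N
  σ-range = transp-range {N} {a} {b} z<s (<⇒≤ q) z<s q

  -- Let u = v t_kj and let u' be its conjugate counterpart at w, so that u = u' s. If u' covers w,
  -- then u' ascends at s, u covers v, and `S u'` is the divided difference of `S u`. Otherwise u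
  -- does not cover v, or u ascends at s; in the latter case `S u` is symmetric and the difference
  -- vanishes.
  op-∂ : ∀ {k j} → 1 ≤ k → k < j → j ≤ N → ¬ (k ≡ a × j ≡ b)
    → X i r ℤ.* op (σ k) (σ j) (Sr r) w ≡ op k j (Sr r) v ℤ.- op k j (Sr r') v
  op-∂ {k} {j} 1≤k k<j j≤N n = go (len u' ≟ suc (len w))
    where
    1≤j = ≤-trans 1≤k (<⇒≤ k<j)
    1≤σk = proj₁ (σ-range 1≤k (≤-trans (<⇒≤ k<j) j≤N))
    σj≤N = proj₂ (σ-range 1≤j j≤N)
    σk<σj = transp-mono a k<j n
    u = mulT v k j
    su = inS-mulT 1≤k k<j j≤N sv
    u' = mulT w (σ k) (σ j)
    su' = inS-mulT 1≤σk σk<σj σj≤N s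
    u≡ : u ≡ mulT u' a b
    u≡ = mulT-ext sv 1≤k k<j j≤N (len-eq (inS-mulT z<s (n<1+n a) q su')) (λ x →
      trans (app-mulT u' a b z<s z<s x)
      (trans (app-mulT w (σ k) (σ j) 1≤σk (≤-trans 1≤σk (<⇒≤ σk<σj)) (σ x))
      (trans (cong (app w) (sym (transp-conj a b k j x))) (sym (app-mulT w a b z<s z<s (transp k j x))))))
    u'≡ : mulT u a b ≡ u'
    u'≡ = trans (cong (λ y → mulT y a b) u≡) (mulT-invol su' z<s (n<1+n a) q)
    go : Dec (len u' ≡ suc (len w)) → X i r ℤ.* op (σ k) (σ j) (Sr r) w ≡ op k j (Sr r) v ℤ.- op k j (Sr r') v
    go (yes e) = trans (cong (X i r ℤ.*_) (op-yes (σ k) (σ j) (Sr r) w e))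
      (trans (subst (λ y → DD N i (S y) (S u')) (sym u≡) (S-rule i su' q asc-u') r d)
      (sym (cong₂ ℤ._-_ (op-yes k j (Sr r) v lenu) (op-yes k j (Sr r') v lenu))))
      where
      v<u : len v < len u
      v<u = len-asc sv 1≤k k<j j≤N (subst₂ _<_ (sym (app-mulT w a b z<s z<s k)) (sym (app-mulT w a b z<s z<s j))
        (cover-asc s 1≤σk σk<σj σj≤N e))
      asc-u' : app u' a < app u' b
      asc-u' with <-cmp (app u' a) (app u' b)
      ... | tri< z _ _ = z
      ... | tri≈ _ z _ = ⊥-elim (1+n≢n (sym (app-inj (valid su') z)))
      ... | tri> _ _ z = ⊥-elim (<-asym v<u (subst₂ _<_ (sym (cong len u≡)) (trans e (sym lenv)) (≤-reflexive (sym (len-adj-desc su' z<s q z)))))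
      lenu : len u ≡ suc (len v)
      lenu = trans (cong len u≡) (trans (len-adj-asc su' z<s q asc-u') (cong suc (trans e (sym lenv))))
    go (no ne) = trans (cong (X i r ℤ.*_) (op-no (σ k) (σ j) (Sr r) w ne)) (trans (ℤP.*-zeroʳ (X i r)) (sym zero-rhs))
      where
      zero-rhs : op k j (Sr r) v ℤ.- op k j (Sr r') v ≡ 0ℤ
      zero-rhs with len u ≟ suc (len v)
      ... | no m = cong₂ ℤ._-_ (op-no k j (Sr r) v m) (op-no k j (Sr r') v m)
      ... | yes e with <-cmp (app u a) (app u b)
      ...   | tri≈ _ z _ = ⊥-elim (1+n≢n (sym (app-inj (valid su) z)))
      ...   | tri< z _ _ = trans (cong₂ ℤ._-_ (op-yes k j (Sr r) v e) (trans (op-yes k j (Sr r') v e) (S-symmetric i su q z r d))) (ℤP.+-inverseʳ (S u r))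
      ...   | tri> _ _ z = ⊥-elim (ne (trans (cong len (sym u'≡)) (trans (suc-injective (trans (sym (len-adj-desc su z<s q z)) e)) lenv)))

  op-v : ∀ ρ → op a b (Sr ρ) v ≡ 0ℤ
  op-v ρ = op-desc (Sr ρ) sv z<s (n<1+n a) q
    (subst₂ _<_ (sym (app-mulT-b w a b z<s z<s)) (sym (app-mulT-a w a b z<s z<s)) h)
    where open FK {N}

  -- For j = k in {a, b} the transposition is s itself and leads from w to v. Its contribution is
  -- exactly the correction (r k - r (σ k)) `S v r` by which multiplication by a variable fails to
  -- commute with ∂.
  term : ∀ k j → 1 ≤ k → k ≤ N → 1 ≤ j → j ≤ N
    → X i r ℤ.* sop k (σ j) (Sr r) w ≡ (sop (σ k) j (Sr r) v ℤ.- sop (σ k) j (Sr r') v) ℤ.+ (if j ≡ᵇ k then (r k ℤ.- r (σ k)) ℤ.* S v r else 0ℤ)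
  term k j 1≤k k≤N 1≤j j≤N with j ≟ k
  ... | yes refl rewrite ≡ᵇ-yes {j} {j} refl = diagonal (σ j) (transp-view a b j)
    where
    times-neg : ∀ x y → x ℤ.* (ℤ.- y) ≡ (0ℤ ℤ.- 0ℤ) ℤ.+ (ℤ.- x) ℤ.* y
    times-neg = solve-∀
    anti : ∀ x y → y ℤ.- x ≡ ℤ.- (x ℤ.- y)
    anti = solve-∀
    diagonal : ∀ k' → TranspView a b j k' → X i r ℤ.* sop j k' (Sr r) w ≡ (sop k' j (Sr r) v ℤ.- sop k' j (Sr r') v) ℤ.+ (r j ℤ.- r k') ℤ.* S v r
    diagonal _ (at-a refl) = trans (cong (X i r ℤ.*_) (trans (sop-< (Sr r) w (n<1+n a)) (op-yes a b (Sr r) w lenv)))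
      (trans (sym (ℤP.+-identityˡ _)) (sym (cong₂ (λ x y → (x ℤ.- y) ℤ.+ X i r ℤ.* S v r)
        (trans (sop-> (Sr r) v (n<1+n a)) (cong ℤ.-_ (op-v r))) (trans (sop-> (Sr r') v (n<1+n a)) (cong ℤ.-_ (op-v r'))))))
    diagonal _ (at-b refl) = trans (cong (X i r ℤ.*_) (trans (sop-> (Sr r) w (n<1+n a)) (cong ℤ.-_ (op-yes a b (Sr r) w lenv))))
      (trans (times-neg (X i r) (S v r)) (sym (trans (cong₂ (λ x y → (x ℤ.- y) ℤ.+ (r b ℤ.- r a) ℤ.* S v r)
        (trans (sop-< (Sr r) v (n<1+n a)) (op-v r)) (trans (sop-< (Sr r') v (n<1+n a)) (op-v r')))
        (cong (λ z → (0ℤ ℤ.- 0ℤ) ℤ.+ z ℤ.* S v r) (anti (r a) (r b))))))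
    diagonal _ (off _ _) = trans (cong (X i r ℤ.*_) (sop-≡ j (Sr r) w)) (trans (ℤP.*-zeroʳ (X i r))
      (sym (trans (cong₂ (λ x y → (x ℤ.- y) ℤ.+ (r j ℤ.- r j) ℤ.* S v r) (sop-≡ j (Sr r) v) (sop-≡ j (Sr r') v)) (lem (r j) (S v r)))))
      where
      lem : ∀ x y → (0ℤ ℤ.- 0ℤ) ℤ.+ (x ℤ.- x) ℤ.* y ≡ 0ℤ
      lem = solve-∀
  ... | no j≢k rewrite ≡ᵇ-no j≢k = trans main (sym (ℤP.+-identityʳ _))
    where
    σσk = transp-invol a b k
    1≤σk = proj₁ (σ-range 1≤k k≤N)
    σk≤N = proj₂ (σ-range 1≤k k≤N)
    bad₁ : ¬ (σ k ≡ a × j ≡ b)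
    bad₁ (e , e') = j≢k (trans e' (trans (sym (transp-a a b)) (trans (cong σ (sym e)) σσk)))
    bad₂ : ¬ (j ≡ a × σ k ≡ b)
    bad₂ (e' , e) = j≢k (trans e' (trans (sym (transp-b a b)) (trans (cong σ (sym e)) σσk)))
    neg : ∀ y z → (ℤ.- y) ℤ.- (ℤ.- z) ≡ ℤ.- (y ℤ.- z)
    neg = solve-∀
    times-neg′ : ∀ x y → x ℤ.* (ℤ.- y) ≡ ℤ.- (x ℤ.* y)
    times-neg′ = solve-∀
    main : X i r ℤ.* sop k (σ j) (Sr r) w ≡ sop (σ k) j (Sr r) v ℤ.- sop (σ k) j (Sr r') v
    main with <-cmp (σ k) j
    ... | tri< z _ _ = trans (cong (X i r ℤ.*_) (trans (sop-< (Sr r) w (subst (_< σ j) σσk (transp-mono a z bad₁))) (cong (λ y → op y (σ j) (Sr r) w) (sym σσk))))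
        (trans (op-∂ 1≤σk z j≤N bad₁) (sym (cong₂ ℤ._-_ (sop-< (Sr r) v z) (sop-< (Sr r') v z))))
    ... | tri≈ _ refl _ = trans (cong (X i r ℤ.*_) (trans (cong (λ y → sop k y (Sr r) w) σσk) (sop-≡ k (Sr r) w)))
        (trans (ℤP.*-zeroʳ (X i r)) (sym (cong₂ ℤ._-_ (sop-≡ (σ k) (Sr r) v) (sop-≡ (σ k) (Sr r') v))))
    ... | tri> _ _ z = trans (cong (X i r ℤ.*_) (trans (sop-> (Sr r) w (subst (σ j <_) σσk (transp-mono a z bad₂))) (cong (λ y → ℤ.- op (σ j) y (Sr r) w) (sym σσk))))
        (trans (times-neg′ (X i r) (op (σ j) (σ (σ k)) (Sr r) w)) (trans (cong ℤ.-_ (op-∂ 1≤j z σk≤N bad₂))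
        (sym (trans (cong₂ ℤ._-_ (sop-> (Sr r) v z) (sop-> (Sr r') v z)) (neg (op j (σ k) (Sr r) v) (op j (σ k) (Sr r') v))))))

  monk-down : (∀ k ρ → 1 ≤ k → k ≤ N → suc k ≤ N → Distinct N ρ → ρ k ℤ.* S v ρ ≡ ΣL (range 1 N) (λ j → sop k j (Sr ρ) v))
    → ∀ k → 1 ≤ k → suc k ≤ N → suc (σ k) ≤ N → r k ℤ.* S w r ≡ ΣL (range 1 N) (λ j → sop k j (Sr r) w)
  monk-down IH k 1≤k k<N σk<N = cancelˡ _ _ (X≢0 q d)
    (trans (*-exchange (X i r) (r k) (S w r)) (trans (cong (r k ℤ.*_) (S-rule i s q h r d))
    (trans (l₂ (r k) (r (σ k)) (S v r) (S v r'))
    (trans (cong₂ (λ x y → (x ℤ.- y) ℤ.+ (r k ℤ.- r (σ k)) ℤ.* S v r) (IH (σ k) r 1≤σk σk≤N σk<N d)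
       (trans (cong (λ z → r z ℤ.* S v r') (sym (transp-invol a b k))) (IH (σ k) r' 1≤σk σk≤N σk<N d')))
    (sym (trans (cong (X i r ℤ.*_) (Σ-transp (λ j → sop k j (Sr r) w) uR a∈ b∈ (1+n≢n ∘ sym)))
      (trans (sym (Σ-* R (X i r) (λ j → sop k (σ j) (Sr r) w)))
      (trans (Σ-cong R (λ j j∈ → term k j 1≤k k≤N (proj₁ (range-∈ {1} j∈)) (s≤s⁻¹ (proj₂ (range-∈ {1} j∈)))))
      (trans (Σ-+ R (λ j → sop (σ k) j (Sr r) v ℤ.- sop (σ k) j (Sr r') v) (λ j → if j ≡ᵇ k then (r k ℤ.- r (σ k)) ℤ.* S v r else 0ℤ))
        (cong₂ ℤ._+_ (Σ-minus R (λ j → sop (σ k) j (Sr r) v) (λ j → sop (σ k) j (Sr r') v)) (Σ-δ ((r k ℤ.- r (σ k)) ℤ.* S v r) uR (∈-range 1≤k (s≤s k≤N)))))))))))))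
    where
    R = range 1 N
    uR = unique-range 1 N
    k≤N = <⇒≤ k<N
    a∈ : a ∈ R
    a∈ = ∈-range {1} z<s (s≤s (<⇒≤ q))
    b∈ : b ∈ R
    b∈ = ∈-range {1} z<s (s≤s q)
    1≤σk = proj₁ (σ-range 1≤k k≤N)
    σk≤N = <⇒≤ σk<N
    l₂ : ∀ x y u u' → x ℤ.* (u ℤ.- u') ≡ (y ℤ.* u ℤ.- x ℤ.* u') ℤ.+ (x ℤ.- y) ℤ.* u
    l₂ = solve-∀

-- For k below the length of ds, the list `ds ++ z ∷ []` with entry k and the last entry exchanged.
rot : ℕ → List ℕ → ℕ → List ℕ
rot zero (x ∷ ds) z = z ∷ ds ++ x ∷ []
rot (suc k) (x ∷ ds) z = x ∷ rot k ds z
rot k [] z = z ∷ []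

length-snoc : ∀ (ds : List ℕ) z → length (ds ++ z ∷ []) ≡ suc (length ds)
length-snoc ds z = trans (LP.length-++ ds) (+-comm (length ds) 1)

length-rot : ∀ k ds z → k < length ds → length (rot k ds z) ≡ suc (length ds)
length-rot zero (x ∷ ds) z p = cong suc (length-snoc ds x)
length-rot (suc k) (x ∷ ds) z (s<s p) = cong suc (length-rot k ds z p)

get-snoc-last : ∀ ds z → get (ds ++ z ∷ []) (length ds) ≡ z
get-snoc-last [] z = refl
get-snoc-last (x ∷ ds) z = get-snoc-last ds z

get-snoc : ∀ ds z j → j ≢ length ds → get (ds ++ z ∷ []) j ≡ get ds j
get-snoc [] z zero n = ⊥-elim (n refl)
get-snoc [] z (suc j) n = refl
get-snoc (x ∷ ds) z zero n = refl
get-snoc (x ∷ ds) z (suc j) n = get-snoc ds z j (n ∘ cong suc)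

get-rot : ∀ k ds z j → k < length ds → get (rot k ds z) j ≡ get (ds ++ z ∷ []) (transp k (length ds) j)
get-rot zero (x ∷ ds) z zero p = sym (get-snoc-last ds z)
get-rot zero (x ∷ ds) z (suc j) p with j ≟ length ds
... | yes refl rewrite ≡ᵇ-yes {length ds} {length ds} refl = get-snoc-last ds x
... | no n rewrite ≡ᵇ-no n = trans (get-snoc ds x j n) (sym (get-snoc ds z j n))
get-rot (suc k) (x ∷ ds) z zero p = refl
get-rot (suc k) (x ∷ ds) z (suc j) (s<s p) = trans (get-rot k ds z j p) (cong (get (x ∷ ds ++ z ∷ [])) (transp-suc k (length ds) j))

mulT-rot : ∀ k ds z → k < length ds → mulT (ds ++ z ∷ []) (suc k) (suc (length ds)) ≡ rot k ds z
mulT-rot k ds z p = get-ext (mulT w (suc k) (suc n)) (rot k ds z) (trans lm (sym (length-rot k ds z p))) λ j q →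
  trans (sym (app-in (mulT w (suc k) (suc n)) q)) (trans (app-mulT w (suc k) (suc n) z<s z<s (suc j))
  (trans (cong (app w) (sym (transp-suc k n j)))
  (trans (app-in w (inside j (subst (j <_) lm q))) (sym (get-rot k ds z j p)))))
  where
  w = ds ++ z ∷ []
  n = length ds
  lm : length (mulT w (suc k) (suc n)) ≡ suc n
  lm = length-mulT-in {w} {suc n} {suc k} {suc n} (length-snoc ds z) (<⇒≤ (s≤s p)) ≤-refl
  inside : ∀ j → j < suc n → transp k n j < length w
  inside j q with transp k n j | transp-view k n j
  ... | _ | at-a refl = subst (n <_) (sym (length-snoc ds z)) (n<1+n n)
  ... | _ | at-b refl = subst (k <_) (sym (length-snoc ds z)) (m<n⇒m<1+n p)
  ... | _ | off _ _ = subst (j <_) (sym (length-snoc ds z)) q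

countBelow-snoc : ∀ x w y → countBelow x (w ++ y ∷ []) ≡ (if y <ᵇ x then 1 else 0) + countBelow x w
countBelow-snoc x [] y = refl
countBelow-snoc x (v ∷ w) y rewrite countBelow-snoc x w y = +-exchange (if v <ᵇ x then 1 else 0) (if y <ᵇ x then 1 else 0) (countBelow x w)

countBelow-rot : ∀ x k ds z → k < length ds → countBelow x (rot k ds z) ≡ countBelow x (ds ++ z ∷ [])
countBelow-rot x zero (y ∷ ds) z p rewrite countBelow-snoc x ds y | countBelow-snoc x ds z = +-exchange (if z <ᵇ x then 1 else 0) (if y <ᵇ x then 1 else 0) (countBelow x ds)
countBelow-rot x (suc k) (y ∷ ds) z (s<s p) = cong ((if y <ᵇ x then 1 else 0) +_) (countBelow-rot x k ds z p)

linked-raise : ∀ {x l} → Linked _≥_ (x ∷ l) → Linked _≥_ (suc x ∷ l)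
linked-raise [-] = [-]
linked-raise (p ∷ l) = m≤n⇒m≤1+n p ∷ l

linked-codes-cons : ∀ {x w} → length w ≤ suc x → Linked _≥_ (codes w) → Linked _≥_ (x ∷ codes w)
linked-codes-cons {w = []} _ l = [-]
linked-codes-cons {x} {y ∷ w} (s≤s p) l = ≤-trans (countBelow-≤ y w) p ∷ l

all-snoc : ∀ {P : ℕ → Set} {w x} → All P w → P x → All P (w ++ x ∷ [])
all-snoc [] q = q ∷ []
all-snoc (n ∷ a) q = n ∷ all-snoc a q

countBelow-top : ∀ {x z ds} → x < z → All (x >_) ds → countBelow x (ds ++ z ∷ []) ≡ length ds
countBelow-top {x} {z} {ds} p a = trans (countBelow-snoc x ds z) (trans (cong (λ b → (if b then 1 else 0) + countBelow x ds) (<ᵇ-no (<⇒≤ p))) (countBelow-all a))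

codes-top : ∀ {z ds} → AllPairs _>_ ds → All (_< z) ds → Linked _≥_ (codes (ds ++ z ∷ []))
codes-top {z} {ds} d b = subst (Linked _≥_) (sym (codes-snoc ds z (All.map <⇒≤ b))) (linked-snoc-0 (codes-descending-linked d))

-- In position k, z exceeds everything that ds has behind k and also the displaced entry, so the
-- code rises by one there. It changes nowhere else, because the displaced entry is larger than all
-- entries of ds behind it.
codes-rot : ∀ k ds z → k < length ds → AllPairs _>_ ds → All (_< z) ds
  → (∀ r → evM (codes (rot k ds z)) r ≡ r (suc k) ℤ.* evM (codes (ds ++ z ∷ [])) r)
  × Linked _≥_ (codes (rot k ds z)) × len (rot k ds z) ≡ suc (len (ds ++ z ∷ []))
codes-rot zero (x ∷ ds) z p (a ∷ d) (q ∷ b) =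
  (λ r → subst₂ (λ u v → evM (u ∷ codes (ds ++ x ∷ [])) r ≡ r 1 ℤ.* evM (v ∷ codes (ds ++ z ∷ [])) r) (sym top) (sym (countBelow-top q a))
     (trans (cong (λ c → evM (suc (length ds) ∷ c) r) same) (ℤP.*-assoc (r 1) _ _)))
  , subst₂ (λ u v → Linked _≥_ (u ∷ v)) (sym top) (sym same)
      (linked-raise (linked-codes-cons (≤-reflexive (length-snoc ds z)) (codes-top d b)))
  , trans (cong₂ _+_ top lens) (cong (λ u → suc (u + len (ds ++ z ∷ []))) (sym (countBelow-top q a)))
  where
  top : countBelow z (ds ++ x ∷ []) ≡ suc (length ds)
  top = trans (countBelow-all (all-snoc b q)) (length-snoc ds x)
  same : codes (ds ++ x ∷ []) ≡ codes (ds ++ z ∷ [])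
  same = trans (codes-snoc ds x (All.map <⇒≤ a)) (sym (codes-snoc ds z (All.map <⇒≤ b)))
  len-sum : ∀ w → len w ≡ foldr _+_ 0 (codes w)
  len-sum [] = refl
  len-sum (y ∷ w) = cong (countBelow y w +_) (len-sum w)
  lens : len (ds ++ x ∷ []) ≡ len (ds ++ z ∷ [])
  lens = trans (len-sum (ds ++ x ∷ [])) (trans (cong (foldr _+_ 0) same) (sym (len-sum (ds ++ z ∷ []))))
codes-rot (suc k) (x ∷ ds) z (s<s p) (a ∷ d) (q ∷ b) with codes-rot k ds z p d b
... | e , l , n =
  (λ r → trans (cong₂ (λ u v → r 1 ℤ.^ u ℤ.* v) (countBelow-rot x k ds z p) (e (r ∘ suc))) (*-exchange (r 1 ℤ.^ countBelow x (ds ++ z ∷ [])) (r (2+ k)) (evM (codes (ds ++ z ∷ [])) (r ∘ suc))))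
  , subst (λ u → Linked _≥_ (u ∷ codes (rot k ds z))) (sym (trans (countBelow-rot x k ds z p) (countBelow-top q a)))
      (linked-codes-cons (≤-reflexive (length-rot k ds z p)) l)
  , trans (cong₂ _+_ (countBelow-rot x k ds z p) n) (+-suc _ _)

descending-get : ∀ {ds i j} → AllPairs _>_ ds → i < j → j < length ds → get ds j < get ds i
descending-get {x ∷ ds} {zero} {suc j} (a ∷ d) p (s<s q) = go a q
  where
  go : ∀ {ds j} → All (x >_) ds → j < length ds → get ds j < x
  go {j = zero} (p ∷ a) q = p
  go {j = suc j} (p ∷ a) (s<s q) = go a q
descending-get {x ∷ ds} {suc i} {suc j} (a ∷ d) (s<s p) (s<s q) = descending-get d p q

last-ascent : ∀ {i w} → FirstAsc i w → 2+ i ≡ length w → ∃[ ds ] ∃[ z ] (w ≡ ds ++ z ∷ [] × Linked _≥_ ds × length ds ≡ suc i)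
last-ascent {w = x ∷ y ∷ []} (here p) e = x ∷ [] , y , refl , [-] , refl
last-ascent (there q a) e with last-ascent a (suc-injective e)
... | [] , z , _ , l , ()
... | y ∷ ds , z , refl , l , n = _ ∷ y ∷ ds , z , refl , q ∷ l , cong suc n

Monk : ℕ → Perm → ℕ → Point → Set
Monk N w k r = r k ℤ.* S w r ≡ ΣL (range 1 N) (λ j → sop k j (λ u → S u r) w)

-- The first P positions descend, so only the transposition with the last position can lead to a
-- cover; it multiplies the dominant monomial by x_{k+1}.
monk-base : ∀ ds z k r → InS (suc (length ds)) (ds ++ z ∷ []) → AllPairs _>_ ds → All (_< z) ds → k < length ds
  → Distinct (suc (length ds)) r → Monk (suc (length ds)) (ds ++ z ∷ []) (suc k) r
monk-base ds z k r s d b k<P dr = sym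
  (trans (Σ-remove f (unique-range 1 N) (∈-range {1} z<s ≤-refl))
  (trans (cong₂ ℤ._+_ topTerm (trans (Σ-cong (range 1 N ∖ N) others) (Σ-0 (range 1 N ∖ N))))
  (ℤP.+-identityʳ _)))
  where
  open FK
  P = length ds
  N = suc P
  w = ds ++ z ∷ []
  F : Perm → ℤ
  F u = S u r
  f : ℕ → ℤ
  f j = sop (suc k) j F w
  raised = codes-rot k ds z k<P d b
  k<N : suc k < N
  k<N = s≤s k<P
  at-w : ∀ {j} → j < P → app w (suc j) ≡ get ds j
  at-w {j} p = trans (app-in w (subst (j <_) (sym (length-snoc ds z)) (m<n⇒m<1+n p))) (get-snoc ds z j (<⇒≢ p))
  srot : InS N (rot k ds z)
  srot = subst (InS N) (mulT-rot k ds z k<P) (inS-mulT z<s k<N ≤-refl s)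
  topTerm : f N ≡ r (suc k) ℤ.* S w r
  topTerm = trans (sop-< F w k<N) (trans (op-yes (suc k) N F w (trans (cong len (mulT-rot k ds z k<P)) (proj₂ (proj₂ raised))))
    (trans (cong F (mulT-rot k ds z k<P))
    (trans (S-dominant _ (len-eq srot) (enough-start (rot k ds z)) (inS-unique srot) (proj₁ (proj₂ raised)) r dr)
    (trans (proj₁ raised r)
    (cong (r (suc k) ℤ.*_) (sym (S-dominant _ (len-eq s) (enough-start w) (inS-unique s) (codes-top d b) r dr)))))))
  others : ∀ j → j ∈ range 1 N ∖ N → f j ≡ 0ℤ
  others j p with ∖-∈ (range 1 N) p
  others zero p | p₁ , n = ⊥-elim (<⇒≱ z<s (proj₁ (range-∈ {1} {N} p₁)))
  others (suc j) p | p₁ , n with <-cmp (suc k) (suc j)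
  ... | tri< h _ _ = trans (sop-< F w h) (op-desc F s z<s h (<⇒≤ (s≤s j<P)) (subst₂ _<_ (sym (at-w j<P)) (sym (at-w k<P)) (descending-get d (s<s⁻¹ h) j<P)))
    where
    j<P : j < P
    j<P = ≤∧≢⇒< (s≤s⁻¹ (s≤s⁻¹ (proj₂ (range-∈ {1} {N} p₁)))) (n ∘ cong suc)
  ... | tri≈ _ refl _ = sop-≡ (suc k) F w
  ... | tri> _ _ h = trans (sop-> F w h) (cong ℤ.-_ (op-desc F s z<s h (<⇒≤ k<N) (subst₂ _<_ (sym (at-w k<P)) (sym (at-w (<-trans (s<s⁻¹ h) k<P))) (descending-get d (s<s⁻¹ h) k<P))))

unique-init : ∀ (ds : List ℕ) {v} → Unique (ds ++ v) → Unique ds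
unique-init [] u = []
unique-init (x ∷ ds) (n ∷ u) = ++⁻ˡ ds n ∷ unique-init ds u

all-get : ∀ {Q : ℕ → Set} ds → (∀ j → j < length ds → Q (get ds j)) → All Q ds
all-get [] h = []
all-get (x ∷ ds) h = h 0 z<s ∷ all-get ds (λ j p → h (suc j) (s<s p))

-- The fixed position P + 1 makes the sum complete, since no cover by t_kj with k ≤ P reaches
-- further. The induction swaps at first ascents below P, which keeps this position fixed, and ends
-- when the first ascent is the last possible one: then w descends on 1, ..., P.
monk : ∀ f {P w} → InS (suc P) w → FixesAbove P w → suc P * suc P < f + len w
  → ∀ k r → 1 ≤ k → k ≤ P → Distinct (suc P) r → Monk (suc P) w k r
monk zero {P} {w} s fx e = ⊥-elim (<⇒≱ e (subst (λ n → len w ≤ n * n) (len-eq s) (len-≤ w)))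
monk (suc f) {P} {w} s fx e k r 1≤k k≤P d with ascents w
... | none l _ = ⊥-elim (linked-no-asc l (lastAsc P refl))
  where
  lastAsc : ∀ p → p ≡ P → AscAt (pred p) w
  lastAsc zero refl = ⊥-elim (<⇒≱ 1≤k k≤P)
  lastAsc (suc p) refl = app-asc w p (subst (suc p <_) (sym (len-eq s)) ≤-refl)
    (subst (app w (suc p) <_) (sym (fx (2+ p) ≤-refl)) (s≤s (fixes-≤ (valid s) fx ≤-refl)))
... | first i a with 2+ i ≤? P
...   | yes q = MonkStep.monk-down w i s (m≤n⇒m≤1+n q) asc r d
        (λ k' ρ p _ p' dρ → monk f sv fv (subst (suc P * suc P <_) (trans (sym (+-suc f (len w))) (cong (f +_) (sym lv))) e) k' ρ p (s≤s⁻¹ p') dρ)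
        k 1≤k (s≤s k≤P) (s≤s (proj₂ (transp-range {P} {suc i} {2+ i} z<s (<⇒≤ q) z<s q 1≤k k≤P)))
  where
  asc = asc-app w i (FirstAsc⇒AscAt a)
  sv = inS-mulT z<s ≤-refl (m≤n⇒m≤1+n q) s
  fv : FixesAbove P (mulT w (suc i) (2+ i))
  fv = fixes-mulT {w = w} z<s ≤-refl q fx
  lv : len (mulT w (suc i) (2+ i)) ≡ suc (len w)
  lv = len-adj-asc s z<s (m≤n⇒m≤1+n q) asc
...   | no nq with last-ascent a (trans (≤-antisym (subst (2+ i ≤_) (len-eq s) (ascAt-< (FirstAsc⇒AscAt a))) (≰⇒> nq)) (sym (len-eq s)))
...     | ds , z , refl , l , n with suc-injective (trans (sym (length-snoc ds z)) (len-eq s))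
...       | refl with k
...         | zero = ⊥-elim (<⇒≱ z<s 1≤k)
...         | suc k' = monk-base ds z k' r s (descending (unique-init ds (inS-unique s)) l) below k≤P d
  where
  P' = length ds
  w' = ds ++ z ∷ []
  z≡ : z ≡ suc P'
  z≡ = trans (sym (get-snoc-last ds z)) (trans (sym (app-in w' (subst (P' <_) (sym (len-eq s)) ≤-refl))) (fx (suc P') ≤-refl))
  below : All (_< z) ds
  below = all-get ds (λ j p → subst₂ _<_
    (trans (app-in w' (subst (j <_) (sym (len-eq s)) (m<n⇒m<1+n p))) (get-snoc ds z j (<⇒≢ p)))
    (sym z≡) (s≤s (fixes-≤ (valid s) fx p)))

-- Pieri's rule

h : ℕ → ℕ → Point → ℤ
h zero k r = 1ℤ
h (suc m) zero r = 0ℤ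
h (suc m) (suc k) r = h (suc m) k r ℤ.+ r (suc k) ℤ.* h m (suc k) r

dn : ℕ → List ℕ
dn zero = []
dn (suc k) = suc k ∷ dn k

up : ℕ → ℕ → List ℕ
up k zero = []
up k (suc d) = suc k ∷ up (suc k) d

up-range : ∀ k d → up k d ≡ range (suc k) d
up-range k d = trans (go k d (suc k +_) (λ i → refl)) (sym (range-≡ (suc k) d))
  where
  go : ∀ k d (f : ℕ → ℕ) → (∀ i → f i ≡ suc k + i) → up k d ≡ applyUpTo f d
  go k zero f e = refl
  go k (suc d) f e = cong₂ _∷_ (sym (trans (e 0) (+-identityʳ _))) (go (suc k) d (f ∘ suc) (λ i → trans (e (suc i)) (+-suc (suc k) i)))

∈-dn : ∀ {k i} → i ∈ dn k → 1 ≤ i × i ≤ k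
∈-dn {suc k} (here refl) = s≤s z≤n , ≤-refl
∈-dn {suc k} (there p) with ∈-dn p
... | q , t = q , m≤n⇒m≤1+n t

∈-up : ∀ {k d i} → i ∈ up k d → k < i × i ≤ k + d
∈-up {k} {d} {i} p with range-∈ {suc k} {d} (subst (i ∈_) (up-range k d) p)
... | q , t = q , s≤s⁻¹ t

up-∈ : ∀ {k d i} → k < i → i ≤ k + d → i ∈ up k d
up-∈ {k} {d} {i} p q = subst (i ∈_) (sym (up-range k d)) (∈-range p (s≤s q))

unique-dn : ∀ k → Unique (dn k)
unique-dn zero = []
unique-dn (suc k) = All.tabulate (λ p e → <-irrefl (sym e) (s≤s (proj₂ (∈-dn p)))) ∷ unique-dn k

unique-up : ∀ k d → Unique (up k d)
unique-up k d = subst Unique (sym (up-range k d)) (unique-range (suc k) d)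

Σ-up-split : ∀ k d f → ΣL (up 0 (k + d)) f ≡ ΣL (dn k) f ℤ.+ ΣL (up k d) f
Σ-up-split zero d f = sym (ℤP.+-identityˡ _)
Σ-up-split (suc k) d f = trans (cong (λ n → ΣL (up 0 n) f) (sym (+-suc k d)))
  (trans (Σ-up-split k (suc d) f) (lem (f (suc k)) (ΣL (dn k) f) (ΣL (up (suc k) d) f)))
  where
  lem : ∀ a b c → b ℤ.+ (a ℤ.+ c) ≡ (a ℤ.+ b) ℤ.+ c
  lem = solve-∀

-- An intermediate value at an intermediate position c would make t_cb, t_ac, t_cb three ascending
-- factors of t_ab, raising the length by at least three.
cover-gap : ∀ {N w a b c} → InS N w → 1 ≤ a → a < c → c < b → b ≤ N → len (mulT w a b) ≡ suc (len w)
  → app w a < app w c → app w c < app w b → ⊥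
cover-gap {N} {w} {a} {b} {c} s 1≤a a<c c<b b≤N e p q =
  <-irrefl (trans (sym e) (cong len w₃≡)) (<-trans (≤-<-trans l₁ l₂) l₃)
  where
  1≤c = ≤-trans 1≤a (<⇒≤ a<c)
  1≤b = ≤-trans 1≤c (<⇒≤ c<b)
  c≤N = ≤-trans (<⇒≤ c<b) b≤N
  a<b = <-trans a<c c<b
  a≢c = <⇒≢ a<c
  a≢b = <⇒≢ a<b
  w₁ = mulT w c b
  w₂ = mulT w₁ a c
  w₃ = mulT w₂ c b
  s₁ = inS-mulT 1≤c c<b b≤N s
  s₂ = inS-mulT 1≤a a<c c≤N s₁
  s₃ = inS-mulT 1≤c c<b b≤N s₂
  w₁a = app-mulT-o w c b 1≤c 1≤b a≢c a≢b
  w₁c = app-mulT-a w c b 1≤c 1≤b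
  w₁b = app-mulT-b w c b 1≤c 1≤b
  w₂c = trans (app-mulT-b w₁ a c 1≤a 1≤c) w₁a
  w₂b = trans (app-mulT-o w₁ a c 1≤a 1≤c (a≢b ∘ sym) (<⇒≢ c<b ∘ sym)) w₁b
  l₁ : len w < len w₁
  l₁ = len-asc s 1≤c c<b b≤N q
  l₂ : len w₁ < len w₂
  l₂ = len-asc s₁ 1≤a a<c c≤N (subst₂ _<_ (sym w₁a) (sym w₁c) (<-trans p q))
  l₃ : len w₂ < len w₃
  l₃ = len-asc s₂ 1≤c c<b b≤N (subst₂ _<_ (sym w₂c) (sym w₂b) p)
  w₃≡ : mulT w a b ≡ w₃
  w₃≡ = mulT-ext s 1≤a a<b b≤N (len-eq s₃) λ j →
    trans (app-mulT w₂ c b 1≤c 1≤b j) (trans (app-mulT w₁ a c 1≤a 1≤c (transp c b j)) (trans (app-mulT w c b 1≤c 1≤b (transp a c (transp c b j)))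
    (cong (app w) (trans (transp-conj c b a c (transp c b j))
      (trans (cong₂ (λ x y → transp x y (transp c b (transp c b j))) (transp-o a≢c a≢b) (transp-a c b))
        (cong (transp a b) (transp-invol c b j)))))))

-- If j were beyond P + 1, the fixed point P + 1 would lie between c and j both in position and in
-- value.
cover-fixes : ∀ {N P w c j} → InS N w → FixesAbove P w → 1 ≤ c → c ≤ P → c < j → j ≤ N
  → len (mulT w c j) ≡ suc (len w) → j ≤ suc P
cover-fixes {N} {P} {w} {c} {j} s fx 1≤c c≤P c<j j≤N e with j ≤? suc P
... | yes p = p
... | no n = ⊥-elim (cover-gap {c = suc P} s 1≤c (s≤s c≤P) (≰⇒> n) j≤N e
  (subst (app w c <_) (sym (fx (suc P) ≤-refl)) (s≤s (fixes-≤ (valid s) fx c≤P)))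
  (subst₂ _<_ (sym (fx (suc P) ≤-refl)) (sym (fx j (<-trans (n<1+n P) (≰⇒> n)))) (≰⇒> n)))

-- P + m ≤ N is the room for the chain: a cover moves at most one position beyond P, so P may grow
-- by one as m drops by one. Induction at the covers of w shows that θ acts on the sums of length m
-- as h_m(k) times θ on Schubert polynomials, and Monk's rule turns the latter into x_k.
pieri : ∀ m k d {N P w} r → k + d ≡ N → InS N w → FixesAbove P w → P + m ≤ N → k ≤ P → Distinct N r
  → h m k r ℤ.* S w r ≡ H m (dn k) (up k d) (λ u → S u r) w
pieri zero k d r e s fx q kP dr = ℤP.*-identityˡ _
pieri (suc m) zero d {w = w} r e s fx q kP dr = ℤP.*-zeroˡ (S w r)
pieri (suc m) (suc k) d {zero} {P} r () s fx q kP dr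
pieri (suc m) (suc k) d {suc N₁} {P} {w} r e s fx q kP dr = sym
  (trans (Words.H-rec F I m c A s 1≤c c≤N above (unique-up c d) below (unique-dn k))
  (trans (cong₂ ℤ._+_ (sym (pieri (suc m) k (suc d) r (trans (+-suc k d) e) s fx q (<⇒≤ kP) dr)) θ≡)
    (lem (h (suc m) k r) (r c) (h m c r) (S w r))))
  where
  N = suc N₁
  c = suc k
  I = dn k
  A = up c d
  F : Perm → ℤ
  F u = S u r
  1≤c = s≤s z≤n
  P<N : P < N
  P<N = ≤-trans (≤-trans (≤-reflexive (+-comm 1 P)) (+-monoʳ-≤ P z<s)) q
  c≤N = ≤-trans kP (<⇒≤ P<N)
  above : Above N c A
  above x x∈ with ∈-up {c} {d} x∈
  ... | p , t = p , subst (x ≤_) e t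
  below : Below c I
  below i i∈ with ∈-dn i∈
  ... | p , t = p , s≤s t
  q' : suc P + m ≤ N
  q' = subst (_≤ N) (+-suc P m) q
  lem : ∀ a x b y → a ℤ.* y ℤ.+ b ℤ.* (x ℤ.* y) ≡ (a ℤ.+ x ℤ.* b) ℤ.* y
  lem = solve-∀
  fx' : FixesAbove (suc P) w
  fx' j p = fx j (<-trans (n<1+n P) p)
  G = H m (c ∷ I) A F
  commute : ∀ a b → 1 ≤ a → a < b → b ≤ N → (len (mulT w a b) ≡ suc (len w) → b ≤ suc P)
    → op a b G w ≡ h m c r ℤ.* op a b F w
  commute a b p t u cov = trans (op-cong a b G (λ v → h m c r ℤ.* F v) w
      (λ z → sym (pieri m c d r e (inS-mulT p t u s) (fixes-mulT {w = w} p t (cov z) fx') q' (m≤n⇒m≤1+n kP) dr)))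
    (op-* a b (h m c r) F w)
  monk-split : r c ℤ.* S w r ≡ θ c A I F w
  monk-split = trans (monk (suc (N * N)) s (λ j p → fx j (≤-trans P<N p)) (m≤m+n (suc (N * N)) (len w)) c r 1≤c (≤-trans kP (s≤s⁻¹ P<N)) dr)
    (trans (cong (λ l → ΣL l f) (trans (sym (up-range 0 N)) (cong (up 0) (sym e))))
    (trans (Σ-up-split c d f) (trans (cong₂ ℤ._+_ (cong₂ ℤ._+_ (sop-≡ c F w) (Σ-cong I low)) (Σ-cong A high))
    (trans (cong (λ z → (0ℤ ℤ.+ z) ℤ.+ ΣL A (λ j → op c j F w)) (trans (Σ-* I ℤ.-1ℤ (λ i → op i c F w)) (ℤP.-1*i≡-i _)))
      (arrange (ΣL I (λ i → op i c F w)) (ΣL A (λ j → op c j F w)))))))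
    where
    f : ℕ → ℤ
    f j = sop c j F w
    low : ∀ i → i ∈ I → f i ≡ ℤ.-1ℤ ℤ.* op i c F w
    low i i∈ = trans (sop-> F w (proj₂ (below i i∈))) (sym (ℤP.-1*i≡-i _))
    high : ∀ j → j ∈ A → f j ≡ op c j F w
    high j j∈ = sop-< F w (proj₁ (above j j∈))
    arrange : ∀ a b → (0ℤ ℤ.+ (ℤ.- a)) ℤ.+ b ≡ b ℤ.- a
    arrange = solve-∀
  θ≡ : θ c A I G w ≡ h m c r ℤ.* (r c ℤ.* S w r)
  θ≡ = trans (cong₂ ℤ._-_
      (trans (Σ-cong A (λ j j∈ → let c<j , j≤N = above j j∈ in commute c j 1≤c c<j j≤N (cover-fixes s fx 1≤c kP c<j j≤N))) (Σ-* A (h m c r) (λ j → op c j F w)))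
      (trans (Σ-cong I (λ i i∈ → let 1≤i , i<c = below i i∈ in commute i c 1≤i i<c c≤N (λ _ → m≤n⇒m≤1+n kP))) (Σ-* I (h m c r) (λ i → op i c F w))))
    (trans (factor (h m c r) (ΣL A (λ j → op c j F w)) (ΣL I (λ i → op i c F w))) (cong (h m c r ℤ.*_) (sym monk-split)))
    where
    factor : ∀ a x y → a ℤ.* x ℤ.- a ℤ.* y ≡ a ℤ.* (x ℤ.- y)
    factor = solve-∀

h-cong : ∀ m k {r r' : Point} → (∀ j → j ≤ k → r j ≡ r' j) → h m k r ≡ h m k r'
h-cong zero k e = refl
h-cong (suc m) zero e = refl
h-cong (suc m) (suc k) e = cong₂ ℤ._+_ (h-cong (suc m) k (λ j p → e j (m≤n⇒m≤1+n p)))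
  (cong₂ ℤ._*_ (e (suc k) ≤-refl) (h-cong m (suc k) e))

-- Induction on the degree. Symmetry in degrees m and m + 1 determines how h_{m+1} in k + 1
-- variables changes under the swap, and the unfolded degree m + 2 needs nothing more.
h-symmetric : ∀ m k r → h m (2+ k) (swapP (suc k) r) ≡ h m (2+ k) r
h-symmetric zero k r = refl
h-symmetric (suc zero) k r
  rewrite transp-a (suc k) (2+ k) | transp-b (suc k) (2+ k)
    | h-cong 1 k {swapP (suc k) r} {r} (λ j p → cong r (transp-o (<⇒≢ (s≤s p)) (<⇒≢ (m≤n⇒m≤1+n (s≤s p))))) =
  lem (h 1 k r) (r (suc k)) (r (2+ k))
  where
  lem : ∀ b x y → (b ℤ.+ y ℤ.* 1ℤ) ℤ.+ x ℤ.* 1ℤ ≡ (b ℤ.+ x ℤ.* 1ℤ) ℤ.+ y ℤ.* 1ℤ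
  lem = solve-∀
h-symmetric (2+ m) k r = lem (h (2+ m) k r) (r (suc k)) (r (2+ k)) (h (suc m) (suc k) r) (h (suc m) (suc k) r') (h m (2+ k) r)
  (h (suc m) (2+ k) r') (h m (2+ k) r') (h (2+ m) k r') (r' (suc k)) (r' (2+ k))
  (h-cong (2+ m) k (λ j p → cong r (transp-o (<⇒≢ (s≤s p)) (<⇒≢ (m≤n⇒m≤1+n (s≤s p))))))
  (cong r (transp-a (suc k) (2+ k))) (cong r (transp-b (suc k) (2+ k)))
  (h-symmetric (suc m) k r) (h-symmetric m k r) {refl}
  where
  r' = swapP (suc k) r
  lem : ∀ b x y p p' q t q' b' x' y' → b' ≡ b → x' ≡ y → y' ≡ x → t ≡ p ℤ.+ y ℤ.* q → q' ≡ q
    → {e : t ≡ p' ℤ.+ y' ℤ.* q'}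
    → (b' ℤ.+ x' ℤ.* p') ℤ.+ y' ℤ.* t ≡ (b ℤ.+ x ℤ.* p) ℤ.+ y ℤ.* (p ℤ.+ y ℤ.* q)
  lem b x y p p' q t q' b' x' y' refl refl refl e₁ refl {e} =
    trans (cong₂ (λ u v → (b ℤ.+ y ℤ.* u) ℤ.+ x ℤ.* v) (trans (l₂ p' (x ℤ.* q)) (cong (ℤ._- (x ℤ.* q)) (trans (sym e) e₁))) e₁)
      (l₃ b x y p q)
    where
    l₂ : ∀ a c → a ≡ (a ℤ.+ c) ℤ.- c
    l₂ = solve-∀
    l₃ : ∀ b x y p q → (b ℤ.+ y ℤ.* ((p ℤ.+ y ℤ.* q) ℤ.- x ℤ.* q)) ℤ.+ x ℤ.* (p ℤ.+ y ℤ.* q) ≡ (b ℤ.+ x ℤ.* p) ℤ.+ y ℤ.* (p ℤ.+ y ℤ.* q)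
    l₃ = solve-∀

-- Expand the symmetric h_{m+1} in k + 2 variables by its last variable, at r and at the swapped
-- point, and compare.
h-∂ : ∀ m k r → X k r ℤ.* h m (2+ k) r ≡ h (suc m) (suc k) r ℤ.- h (suc m) (suc k) (swapP (suc k) r)
h-∂ m k r = lem (r (suc k)) (r (2+ k)) (h m (2+ k) r) (h (suc m) (suc k) r) (h (suc m) (suc k) (swapP (suc k) r))
  (trans (cong₂ (λ u v → h (suc m) (suc k) (swapP (suc k) r) ℤ.+ u ℤ.* v) (cong r (sym (transp-b (suc k) (2+ k)))) (sym (h-symmetric m k r)))
    (h-symmetric (suc m) k r))
  where
  lem : ∀ x y t a a' → a' ℤ.+ x ℤ.* t ≡ a ℤ.+ y ℤ.* t → (x ℤ.- y) ℤ.* t ≡ a ℤ.- a'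
  lem x y t a a' e = trans (l₁ x y t a') (trans (cong (λ z → z ℤ.- a' ℤ.- y ℤ.* t) e) (l₂ a a' (y ℤ.* t)))
    where
    l₁ : ∀ x y t a' → (x ℤ.- y) ℤ.* t ≡ (a' ℤ.+ x ℤ.* t) ℤ.- a' ℤ.- y ℤ.* t
    l₁ = solve-∀
    l₂ : ∀ a a' t → (a ℤ.+ t) ℤ.- a' ℤ.- t ≡ a ℤ.- a'
    l₂ = solve-∀

-- The cycle r[k,m] and its Schubert polynomial

rc : ℕ → ℕ → ℕ → ℕ
rc k m j = if j ≡ᵇ k then k + m else (if (k <ᵇ j) ∧ (j ≤ᵇ k + m) then j ∸ 1 else j)

rc-at : ∀ k m → rc k m k ≡ k + m
rc-at k m rewrite ≡ᵇ-yes {k} {k} refl = refl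

rc-in : ∀ {k m j} → k < j → j ≤ k + m → rc k m j ≡ j ∸ 1
rc-in {k} {m} {j} p q rewrite ≡ᵇ-no (<⇒≢ p ∘ sym) | <ᵇ-yes p | ≤ᵇ-yes q = refl

rc-low : ∀ {k m j} → j < k → rc k m j ≡ j
rc-low p rewrite ≡ᵇ-no (<⇒≢ p) | <ᵇ-no (<⇒≤ p) = refl

rc-high : ∀ {k m j} → k + m < j → rc k m j ≡ j
rc-high {k} {m} {j} p rewrite ≡ᵇ-no (<⇒≢ (≤-<-trans (m≤m+n k m) p) ∘ sym) | <ᵇ-yes (≤-<-trans (m≤m+n k m) p) | ≤ᵇ-no p = refl

length-rcyc : ∀ n k m → length (rcyc n k m) ≡ n
length-rcyc n k m = length-map-range (rc k m) 1 n

app-rcyc : ∀ n k m → 1 ≤ k → k + m ≤ n → ∀ j → app (rcyc n k m) j ≡ rc k m j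
app-rcyc n (suc k) m _ q zero = refl
app-rcyc n k m p q (suc j) with suc j ≤? n
... | yes t = app-map-range (rc k m) n z<s t
... | no t = trans (app-out (rcyc n k m) (subst (_< suc j) (sym (length-rcyc n k m)) (≰⇒> t))) (sym (rc-high {k} (≤-<-trans q (≰⇒> t))))

rc-step : ∀ k m j → rc k (suc m) j ≡ rc (suc k) m (transp k (suc k) j)
rc-step k m j with transp k (suc k) j | transp-view k (suc k) j
... | _ | at-a refl = trans (rc-at k (suc m)) (trans (+-suc k m) (sym (rc-at (suc k) m)))
... | _ | at-b refl = trans (rc-in {k} ≤-refl (subst (suc k ≤_) (sym (+-suc k m)) (m≤m+n (suc k) m))) (sym (rc-low {suc k} ≤-refl))
... | _ | off p q with <-cmp j k
...   | tri< t _ _ = trans (rc-low {k} t) (sym (rc-low {suc k} (m<n⇒m<1+n t)))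
...   | tri≈ _ t _ = ⊥-elim (p t)
...   | tri> _ _ t with j ≤? k + suc m
...     | yes u = trans (rc-in {k} t u) (sym (rc-in {suc k} (≤∧≢⇒< t (q ∘ sym)) (subst (j ≤_) (+-suc k m) u)))
...     | no u = trans (rc-high {k} (≰⇒> u)) (sym (rc-high {suc k} (subst (_< j) (+-suc k m) (≰⇒> u))))

rcyc-mulT : ∀ {n k m} → InS n (rcyc n (suc k) m) → 1 ≤ k → suc k + m ≤ n → mulT (rcyc n (suc k) m) k (suc k) ≡ rcyc n k (suc m)
rcyc-mulT {n} {k} {m} s p q = mulT-ext s p ≤-refl (≤-trans (m≤m+n (suc k) m) q) (length-rcyc n k (suc m))
  (λ j → trans (app-rcyc n k (suc m) p (subst (_≤ n) (sym (+-suc k m)) q) j)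
    (trans (rc-step k m j) (sym (app-rcyc n (suc k) m z<s q (transp k (suc k) j)))))

rcyc-asc : ∀ {n k m} → 1 ≤ k → suc k + m ≤ n → app (rcyc n (suc k) m) k < app (rcyc n (suc k) m) (suc k)
rcyc-asc {n} {k} {m} p q = subst₂ _<_
  (sym (trans (app-rcyc n (suc k) m z<s q k) (rc-low {suc k} ≤-refl)))
  (sym (trans (app-rcyc n (suc k) m z<s q (suc k)) (rc-at (suc k) m)))
  (m≤m+n (suc k) m)

AllPairs≤-get : ∀ w → (∀ i j → i < j → j < length w → get w i ≤ get w j) → AllPairs _≤_ w
AllPairs≤-get [] e = []
AllPairs≤-get (x ∷ w) e = all-get w (λ j p → e 0 (suc j) z<s (s<s p)) ∷ AllPairs≤-get w (λ i j p q → e (suc i) (suc j) (s<s p) (s<s q))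

countBelow-none : ∀ {x w} → All (x ≤_) w → countBelow x w ≡ 0
countBelow-none [] = refl
countBelow-none {x} {y ∷ w} (p ∷ a) = trans (countBelow-skip w p) (countBelow-none a)

codes-ascending : ∀ {w} → AllPairs _≤_ w → All (_≡ 0) (codes w)
codes-ascending [] = []
codes-ascending (a ∷ d) = countBelow-none a ∷ codes-ascending d

len-ascending : ∀ {w} → AllPairs _≤_ w → len w ≡ 0
len-ascending [] = refl
len-ascending (a ∷ d) = cong₂ _+_ (countBelow-none a) (len-ascending d)

inS-rcyc : ∀ m {n k} → 1 ≤ k → k + m ≤ n → InS n (rcyc n k m) × len (rcyc n k m) ≡ m
inS-rcyc zero {n} {k} p q = inS (length-rcyc n k 0) v , len-ascending (AllPairs≤-get (rcyc n k 0) mono)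
  where
  fix : ∀ j → app (rcyc n k 0) j ≡ j
  fix j with <-cmp j k
  ... | tri< t _ _ = trans (app-rcyc n k 0 p q j) (rc-low {k} t)
  ... | tri≈ _ refl _ = trans (app-rcyc n k 0 p q j) (trans (rc-at k 0) (+-identityʳ k))
  ... | tri> _ _ t = trans (app-rcyc n k 0 p q j) (rc-high {k} (subst (_< j) (sym (+-identityʳ k)) t))
  v : Valid (rcyc n k 0)
  v .inv j = j
  v .app-inv = fix
  v .inv-app = fix
  mono : ∀ i j → i < j → j < length (rcyc n k 0) → get (rcyc n k 0) i ≤ get (rcyc n k 0) j
  mono i j t u = subst₂ _≤_ (trans (sym (fix (suc i))) (app-in (rcyc n k 0) (<-trans t u))) (trans (sym (fix (suc j))) (app-in (rcyc n k 0) u)) (s≤s (<⇒≤ t))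
inS-rcyc (suc m) {n} {k} p q with inS-rcyc m {n} {suc k} z<s (subst (_≤ n) (+-suc k m) q)
... | s , l = subst (InS n) e (inS-mulT p ≤-refl k<n s)
  , trans (cong len (sym e)) (trans (len-adj-asc s p k<n (rcyc-asc p q')) (cong suc l))
  where
  q' = subst (_≤ n) (+-suc k m) q
  k<n = ≤-trans (m≤m+n (suc k) m) q'
  e = rcyc-mulT s p q'

evM-zeros : ∀ {e} → All (_≡ 0) e → ∀ r → evM e r ≡ 1ℤ
evM-zeros [] r = refl
evM-zeros (refl ∷ a) r = trans (ℤP.*-identityˡ _) (evM-zeros a (r ∘ suc))

linked-zeros : ∀ {m e} → All (_≡ 0) e → Linked _≥_ (m ∷ e)
linked-zeros [] = [-]
linked-zeros (refl ∷ a) = z≤n ∷ linked-zeros a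

h-1 : ∀ m r → h m 1 r ≡ r 1 ℤ.^ m
h-1 zero r = refl
h-1 (suc m) r = trans (ℤP.+-identityˡ _) (cong (r 1 ℤ.*_) (h-1 m r))

-- The one-line notation m + 1, 1, ..., m, m + 2, ... ascends after its first entry, so the code is
-- (m, 0, ..., 0) and the polynomial is the monomial x₁^m.
S-rcyc-1 : ∀ {n} m r → 1 + m ≤ n → Distinct n r → S (rcyc n 1 m) r ≡ h m 1 r
S-rcyc-1 {n} m r q d = go (rcyc n 1 m) refl
  where
  sl = inS-rcyc m {n} {1} ≤-refl q
  rc-≤ : ∀ i → 1 ≤ i → rc 1 m (suc i) ≤ suc i
  rc-≤ i p with suc i ≤? 1 + m
  ... | yes t = subst (_≤ suc i) (sym (rc-in {1} (s≤s p) t)) (n≤1+n i)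
  ... | no t = ≤-reflexive (rc-high {1} (≰⇒> t))
  rc-mono : ∀ i j → 1 ≤ i → i < j → rc 1 m (suc i) ≤ rc 1 m (suc j)
  rc-mono i j p t with suc j ≤? 1 + m
  ... | yes u = subst₂ _≤_ (sym (rc-in {1} (s≤s p) (≤-trans (s≤s (<⇒≤ t)) u))) (sym (rc-in {1} (s≤s (≤-trans p (<⇒≤ t))) u)) (<⇒≤ t)
  ... | no u = ≤-trans (rc-≤ i p) (≤-trans (s≤s (<⇒≤ t)) (≤-reflexive (sym (rc-high {1} (≰⇒> u)))))
  at : ∀ {j} → j < n → get (rcyc n 1 m) j ≡ rc 1 m (suc j)
  at {j} t = trans (sym (app-in (rcyc n 1 m) (subst (j <_) (sym (length-rcyc n 1 m)) t))) (app-rcyc n 1 m ≤-refl q (suc j))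
  go : ∀ w → w ≡ rcyc n 1 m → S w r ≡ h m 1 r
  go [] e = ⊥-elim (<⇒≱ (≤-trans (m≤m+n 1 m) q) (≤-reflexive (trans (sym (length-rcyc n 1 m)) (cong length (sym e)))))
  go (x ∷ w) e = trans (S-dominant (suc (length (x ∷ w) * length (x ∷ w))) (trans (cong length e) (length-rcyc n 1 m)) (enough-start (x ∷ w)) (subst Unique (sym e) (inS-unique (proj₁ sl))) (linked-zeros zeros) r d)
    (trans (cong₂ (λ u v → r 1 ℤ.^ u ℤ.* v) cb≡ (evM-zeros zeros (r ∘ suc))) (trans (ℤP.*-identityʳ _) (sym (h-1 m r))))
    where
    lw : suc (length w) ≡ n
    lw = trans (cong length e) (length-rcyc n 1 m)
    asc : AllPairs _≤_ w
    asc = AllPairs≤-get w (λ i j t u → subst₂ _≤_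
      (sym (trans (cong (λ l → get l (suc i)) e) (at (subst (suc i <_) lw (s≤s (<-trans t u))))))
      (sym (trans (cong (λ l → get l (suc j)) e) (at (subst (suc j <_) lw (s≤s u)))))
      (rc-mono (suc i) (suc j) z<s (s≤s t)))
    zeros = codes-ascending asc
    -- The first code entry is the whole length, already known to be m, as the other entries vanish.
    cb≡ : countBelow x w ≡ m
    cb≡ = trans (sym (+-identityʳ _)) (trans (cong (countBelow x w +_) (sym (len-ascending asc))) (trans (cong len e) (proj₂ sl)))

-- Induction on the first position with m varying: r[k+1,m] s_k = r[k,m+1] is longer by one, and ∂_k
-- sends h_{m+1}(k) to h_m(k+1).
S-rcyc : ∀ {n} k m r → suc k + m ≤ n → Distinct n r → S (rcyc n (suc k) m) r ≡ h m (suc k) r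
S-rcyc zero m r q d = S-rcyc-1 m r q d
S-rcyc {n} (suc k) m r q d = cancelˡ _ _ (X≢0 i≤ d)
  (trans (S-rule k s i≤ (rcyc-asc {n} {suc k} {m} z<s q) r d)
  (trans (cong₂ ℤ._-_ (prev r d) (prev (swapP (suc k) r) (distinct-swap i≤ d))) (sym (h-∂ m k r))))
  where
  i≤ = ≤-trans (m≤m+n (2+ k) m) q
  s = proj₁ (inS-rcyc m {n} {2+ k} z<s q)
  prev : ∀ ρ → Distinct n ρ → S (mulT (rcyc n (2+ k) m) (suc k) (2+ k)) ρ ≡ h (suc m) (suc k) ρ
  prev ρ dρ = trans (cong (λ v → S v ρ) (rcyc-mulT s z<s q)) (S-rcyc k (suc m) ρ (subst (_≤ n) (cong suc (sym (+-suc k m))) q) dρ)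

-- Tower heights

larger : Perm → ℕ → ℕ → ℕ
larger w y zero = 0
larger w y (suc m) = (if y <ᵇ app w (suc m) then 1 else 0) + larger w y m

larger-yes : ∀ w y m → y < app w (suc m) → larger w y (suc m) ≡ suc (larger w y m)
larger-yes w y m p rewrite <ᵇ-yes p = refl

larger-no : ∀ w y m → app w (suc m) ≤ y → larger w y (suc m) ≡ larger w y m
larger-no w y m p rewrite <ᵇ-no p = refl

larger-mono : ∀ w y {m m'} → m ≤ m' → larger w y m ≤ larger w y m'
larger-mono w y {m} {zero} p = ≤-reflexive (cong (larger w y) (n≤0⇒n≡0 p))
larger-mono w y {m} {suc m'} p with m≤n⇒m<n∨m≡n p
... | inj₁ q = ≤-trans (larger-mono w y (s≤s⁻¹ q)) (m≤n+m _ _)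
... | inj₂ refl = ≤-refl

larger-cong : ∀ {w v} y y' m → (∀ t → 1 ≤ t → t ≤ m → (y <ᵇ app w t) ≡ (y' <ᵇ app v t)) → larger w y m ≡ larger v y' m
larger-cong y y' zero e = refl
larger-cong {w} {v} y y' (suc m) e = cong₂ (λ b n → (if b then 1 else 0) + n) (e (suc m) z<s ≤-refl)
  (larger-cong {w} {v} y y' m (λ t p q → e t p (m≤n⇒m≤1+n q)))

<ᵇ-suc : ∀ {p x} → x ≢ suc p → (p <ᵇ x) ≡ (suc p <ᵇ x)
<ᵇ-suc {p} {x} n with suc p <? x
... | yes q rewrite <ᵇ-yes q = <ᵇ-yes (<-trans (n<1+n p) q)
... | no q rewrite <ᵇ-no (≮⇒≥ q) = <ᵇ-no (s≤s⁻¹ (≤∧≢⇒< (≮⇒≥ q) n))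

-- Raising the threshold from p to p + 1 can lose only the position of the value p + 1. It lies
-- outside the counted range here and inside it in `larger-in`.
larger-out : ∀ {w} p m j → Valid w → app w j ≡ suc p → m < j → larger w p m ≡ larger w (suc p) m
larger-out {w} p m j v e q = larger-cong {w} {w} p (suc p) m
  (λ t _ u → <ᵇ-suc (λ e' → <⇒≢ (≤-<-trans u q) (app-inj v (trans e' (sym e)))))

larger-in : ∀ {w} p m j → Valid w → app w j ≡ suc p → 1 ≤ j → j ≤ m → larger w p m ≡ suc (larger w (suc p) m)
larger-in p zero j v e 1≤j q = ⊥-elim (<⇒≱ 1≤j q)
larger-in {w} p (suc m) j v e 1≤j q with m≤n⇒m<n∨m≡n q
... | inj₁ q' rewrite <ᵇ-suc {p} {app w (suc m)} (λ e' → <⇒≢ q' (app-inj v (trans e (sym e')))) | larger-in {w} p m j v e 1≤j (s≤s⁻¹ q') = +-suc _ _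
... | inj₂ refl = trans (larger-yes w p m (≤-reflexive (sym e))) (cong suc (trans (larger-out {w} p m (suc m) v e ≤-refl) (sym (larger-no w (suc p) m (≤-reflexive e)))))

app-pos : ∀ {w} → Valid w → ∀ {j} → 1 ≤ j → 1 ≤ app w j
app-pos {w} v {suc j} _ with app w (suc j) in e
... | zero = ⊥-elim (0≢1+n (app-inj v {0} {suc j} (sym e)))
... | suc _ = s≤s z≤n

inv-pos : ∀ {w} (v : Valid w) {y} → 1 ≤ y → 1 ≤ inv v y
inv-pos {w} v {suc y} _ with inv v (suc y) in e
... | zero = ⊥-elim (0≢1+n (trans (sym (cong (app w) e)) (app-inv v (suc y))))
... | suc _ = s≤s z≤n

larger-0 : ∀ {w} → Valid w → ∀ m → larger w 0 m ≡ m
larger-0 v zero = refl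
larger-0 {w} v (suc m) = trans (larger-yes w 0 m (app-pos v z<s)) (cong suc (larger-0 v m))

heightOf : ∀ {w} → Valid w → ℕ → ℕ
heightOf {w} v y = larger w y (pred (inv v y))

heightOf-at : ∀ {w} (v : Valid w) j → heightOf v (app w (suc j)) ≡ larger w (app w (suc j)) j
heightOf-at {w} v j = cong (larger w (app w (suc j)) ∘ pred) (inv-app v (suc j))

δ : ℕ → ℕ → ℕ
δ a b = if a ≡ᵇ b then 1 else 0

δ-≢ : ∀ {a b} → a ≢ b → δ a b ≡ 0
δ-≢ n rewrite ≡ᵇ-no n = refl

δ-≡ : ∀ a → δ a a ≡ 1
δ-≡ a rewrite ≡ᵇ-yes {a} {a} refl = refl

slideFrom-next : ∀ s p h T → p + h < s → slideFrom s p (h ∷ T) ≡ h ∷ slideFrom s (suc p) T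
slideFrom-next s p h T q rewrite <ᵇ-yes q = refl

slideFrom-stop : ∀ p h T → slideFrom (p + h) p (h ∷ T) ≡ suc h ∷ T
slideFrom-stop p h T rewrite <ᵇ-no (≤-refl {p + h}) | ≡ᵇ-yes {p + h} refl = refl

slideFrom-shift : ∀ s p h T → suc s < p + h → slideFrom s p (h ∷ T) ≡ h ∷ slideFrom (suc s) (suc p) T
slideFrom-shift s p h T q rewrite <ᵇ-no (<⇒≤ (<-trans (n<1+n s) q)) | ≡ᵇ-no (<⇒≢ (<-trans (n<1+n s) q)) | ≡ᵇ-no (<⇒≢ q) with 1 ≤ᵇ h
... | true = refl
... | false = refl

slideFrom-[]-next : ∀ s p k → p < s → get (slideFrom s p []) k ≡ get (0 ∷ slideFrom s (suc p) []) k
slideFrom-[]-next s p k q = cong (λ l → get l k) (trans (cong (λ n → map (λ _ → 0) (upTo n) ++ 1 ∷ []) (+-∸-assoc 1 q))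
  (cong (λ l → 0 ∷ l ++ 1 ∷ []) (trans (LP.map-applyUpTo suc (λ _ → 0) (s ∸ suc p)) (sym (LP.map-upTo (λ _ → 0) (s ∸ suc p))))))

slideFrom-[] : ∀ s p k → p ≤ s → get (slideFrom s p []) k ≡ get (slideFrom s p (0 ∷ [])) k
slideFrom-[] s p k q with m≤n⇒m<n∨m≡n q
... | inj₁ r = trans (slideFrom-[]-next s p k r) (cong (λ l → get l k) (sym (slideFrom-next s p 0 [] (subst (_< s) (sym (+-identityʳ p)) r))))
... | inj₂ refl = cong (λ l → get l k) (trans (cong (λ n → map (λ _ → 0) (upTo n) ++ 1 ∷ []) (n∸n≡0 p))
    (sym (trans (cong (λ s → slideFrom s p (0 ∷ [])) (sym (+-identityʳ p))) (slideFrom-stop p 0 []))))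

module SlideStep {v : Perm} (V : Valid v) (i : ℕ) (asc : app v (suc i) < app v (2+ i)) where

  Hv : ℕ → ℕ
  Hv = heightOf V

  -- On arriving at tower p the current value is p + #{t < i : v(t) ≥ p}.
  mutual
    heights-any : ∀ d p T → suc p + d ≡ app v (suc i) → (∀ k → get T k ≡ Hv (suc p + k))
      → ∀ k → get (slideFrom (suc p + larger v p i) (suc p) T) k ≡ Hv (suc p + k) + δ (suc p + k) (app v (suc i))
    heights-any d p [] e HT k = trans (slideFrom-[] _ (suc p) k (m≤m+n (suc p) _))
      (heights-cons d p 0 [] e (λ { zero → HT 0 ; (suc k) → HT (suc k) }) k)
    heights-any d p (x ∷ T) e HT k = heights-cons d p x T e HT k

    -- The position of the value p + 1 decides. At i + 1, the slide stops and raises this tower.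
    -- Before i + 1, the tower is too low and is passed. After i + 1, both v(i+1) and v(i+2) exceed
    -- p + 1 and precede it, so the tower is at least two higher than the count and the value
    -- shifts. The distance d to v(i+1) ensures that the slide gets there.
    heights-cons : ∀ d p x T → suc p + d ≡ app v (suc i) → (∀ k → get (x ∷ T) k ≡ Hv (suc p + k))
      → ∀ k → get (slideFrom (suc p + larger v p i) (suc p) (x ∷ T)) k ≡ Hv (suc p + k) + δ (suc p + k) (app v (suc i))
    heights-cons d p x T e HT with <-cmp (inv V (suc p)) (suc i)
    ... | tri≈ _ j≡ _ = λ k → trans (cong (λ l → get l k) (trans (cong (λ s → slideFrom (suc p + s) (suc p) (x ∷ T)) c≡) (slideFrom-stop (suc p) x T))) (result k)
      where
      at : app v (suc i) ≡ suc p
      at = trans (cong (app v) (sym j≡)) (app-inv V (suc p))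
      x≡ : x ≡ larger v (suc p) i
      x≡ = trans (HT 0) (trans (cong Hv (+-identityʳ (suc p))) (cong (λ j → larger v (suc p) (pred j)) j≡))
      c≡ : larger v p i ≡ x
      c≡ = trans (larger-out {v} p i (suc i) V at ≤-refl) (sym x≡)
      result : ∀ k → get (suc x ∷ T) k ≡ Hv (suc p + k) + δ (suc p + k) (app v (suc i))
      result zero = trans (trans (cong suc (HT 0)) (+-comm 1 _)) (cong (Hv (suc p + 0) +_) (sym (trans (cong₂ δ (+-identityʳ (suc p)) at) (δ-≡ (suc p)))))
      result (suc k) = trans (HT (suc k)) (trans (sym (+-identityʳ _)) (cong (Hv (suc p + suc k) +_)
        (sym (δ-≢ (λ z → <⇒≢ (m<m+n (suc p) {suc k} z<s) (sym (trans z at)))))))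
    ... | tri< j< _ _ = go d e
      where
      c≡ : larger v p i ≡ suc (larger v (suc p) i)
      c≡ = larger-in {v} p i (inv V (suc p)) V (app-inv V (suc p)) (inv-pos V z<s) (s≤s⁻¹ j<)
      x≤ : x ≤ larger v (suc p) i
      x≤ = subst (_≤ larger v (suc p) i) (sym (trans (HT 0) (cong Hv (+-identityʳ (suc p)))))
        (larger-mono v (suc p) (≤-trans (pred[n]≤n {inv V (suc p)}) (s≤s⁻¹ j<)))
      s≡ : suc p + larger v p i ≡ 2+ p + larger v (suc p) i
      s≡ = trans (cong (suc p +_) c≡) (+-suc (suc p) _)
      next : suc p + x < suc p + larger v p i
      next = +-monoʳ-< (suc p) (subst (x <_) (sym c≡) (s≤s x≤))
      go : ∀ d → suc p + d ≡ app v (suc i) → ∀ k → get (slideFrom (suc p + larger v p i) (suc p) (x ∷ T)) k ≡ Hv (suc p + k) + δ (suc p + k) (app v (suc i))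
      go zero e k = ⊥-elim (<⇒≢ j< (app-inj V (trans (app-inv V (suc p)) (trans (sym (+-identityʳ (suc p))) e))))
      go (suc d) e k = trans (cong (λ l → get l k) (trans (slideFrom-next _ (suc p) x T next) (cong (λ s → x ∷ slideFrom s (2+ p) T) s≡)))
        (heights-rest d p x T e HT k)
    ... | tri> _ _ j> = go d e
      where
      p<vi : suc p < app v (suc i)
      p<vi = ≤∧≢⇒< (subst (suc p ≤_) e (m≤m+n (suc p) d)) (λ z → <⇒≢ j> (app-inj V (trans (sym z) (sym (app-inv V (suc p))))))
      j≢ : 2+ i ≢ inv V (suc p)
      j≢ z = <⇒≢ (<-trans p<vi asc) (sym (trans (cong (app v) z) (app-inv V (suc p))))
      c≡ : larger v p i ≡ larger v (suc p) i
      c≡ = larger-out {v} p i (inv V (suc p)) V (app-inv V (suc p)) (<-trans (n<1+n i) j>)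
      x≥ : suc (suc (larger v (suc p) i)) ≤ x
      x≥ = subst₂ _≤_ (trans (larger-yes v (suc p) (suc i) (<-trans p<vi asc)) (cong suc (larger-yes v (suc p) i p<vi)))
        (sym (trans (HT 0) (cong Hv (+-identityʳ (suc p))))) (larger-mono v (suc p) (pred-mono-≤ (≤∧≢⇒< j> j≢)))
      shift : suc (suc p + larger v p i) < suc p + x
      shift = subst (_≤ suc p + x) (trans (+-suc (suc p) _) (cong suc (trans (+-suc (suc p) _) (cong (λ z → suc (suc p + z)) (sym c≡))))) (+-monoʳ-≤ (suc p) x≥)
      go : ∀ d → suc p + d ≡ app v (suc i) → ∀ k → get (slideFrom (suc p + larger v p i) (suc p) (x ∷ T)) k ≡ Hv (suc p + k) + δ (suc p + k) (app v (suc i))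
      go zero e k = ⊥-elim (<⇒≢ p<vi (trans (sym (+-identityʳ (suc p))) e))
      go (suc d) e k = trans (cong (λ l → get l k) (trans (slideFrom-shift _ (suc p) x T shift) (cong (λ z → x ∷ slideFrom (2+ p + z) (2+ p) T) c≡)))
        (heights-rest d p x T e HT k)

    heights-rest : ∀ d p x T → suc p + suc d ≡ app v (suc i) → (∀ k → get (x ∷ T) k ≡ Hv (suc p + k))
      → ∀ k → get (x ∷ slideFrom (2+ p + larger v (suc p) i) (2+ p) T) k ≡ Hv (suc p + k) + δ (suc p + k) (app v (suc i))
    heights-rest d p x T e HT zero = trans (HT 0) (trans (sym (+-identityʳ _)) (cong (Hv (suc p + 0) +_)
      (sym (δ-≢ (λ z → <⇒≢ (m<m+n (suc p) {suc d} z<s) (trans (sym (+-identityʳ (suc p))) (trans z (sym e))))))))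
    heights-rest d p x T e HT (suc k) =
      trans (heights-any d (suc p) T (trans (sym (+-suc (suc p) d)) e) (λ k → trans (HT (suc k)) (cong Hv (+-suc (suc p) k))) k)
        (cong (λ z → Hv z + δ z (app v (suc i))) (sym (+-suc (suc p) k)))

  slide-heights : ∀ T → (∀ k → get T k ≡ Hv (suc k)) → ∀ k → get (slide (suc i) T) k ≡ Hv (suc k) + δ (suc k) (app v (suc i))
  -- All i values at the positions up to i are positive, so the initial value i + 1 has the form
  -- required at the first tower.
  slide-heights T HT k = trans (cong (λ z → get (slideFrom (suc z) 1 T) k) (sym (larger-0 V i)))
    (heights-any (pred (app v (suc i))) 0 T (suc-pred (app v (suc i)) {{>-nonZero (app-pos V z<s)}}) HT k)

  module _ {w : Perm} (e : ∀ j → app w j ≡ app v (transp (suc i) (2+ i) j)) where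

    larger-low : ∀ y {m} → m ≤ i → larger w y m ≡ larger v y m
    larger-low y {m} q = larger-cong {w} {v} y y m (λ t _ r → cong (y <ᵇ_)
      (trans (e t) (cong (app v) (transp-o (<⇒≢ (s≤s (≤-trans r q))) (<⇒≢ (m≤n⇒m≤1+n (s≤s (≤-trans r q))))))))

    w-a : app w (suc i) ≡ app v (2+ i)
    w-a = trans (e (suc i)) (cong (app v) (transp-a (suc i) (2+ i)))

    w-b : app w (2+ i) ≡ app v (suc i)
    w-b = trans (e (2+ i)) (cong (app v) (transp-b (suc i) (2+ i)))

    larger-high : ∀ y d → larger w y (d + 2+ i) ≡ larger v y (d + 2+ i)
    larger-high y zero = trans (cong₂ (λ x z → (if y <ᵇ x then 1 else 0) + z) w-b (cong₂ (λ x z → (if y <ᵇ x then 1 else 0) + z) w-a (larger-low y ≤-refl)))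
      (+-exchange (if y <ᵇ app v (suc i) then 1 else 0) (if y <ᵇ app v (2+ i) then 1 else 0) (larger v y i))
    larger-high y (suc d) = cong₂ (λ x z → (if y <ᵇ x then 1 else 0) + z)
      (trans (e (suc d + 2+ i)) (cong (app v) (transp-o (<⇒≢ (≤-trans (n≤1+n (2+ i)) (s≤s (m≤n+m _ d))) ∘ sym) (<⇒≢ (s≤s (m≤n+m _ d)) ∘ sym))))
      (larger-high y d)

    -- Only the value v(i+1), which moves behind the larger v(i+2), gains an inversion.
    heightOf-swap : (W : Valid w) → ∀ y → 1 ≤ y → heightOf W y ≡ Hv y + δ y (app v (suc i))
    heightOf-swap W y 1≤y = trans (cong (larger w y ∘ pred) invW) (cases (inv V y) refl (transp-view (suc i) (2+ i) (inv V y)))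
      where
      invW : inv W y ≡ transp (suc i) (2+ i) (inv V y)
      invW = app-inj W (trans (app-inv W y) (sym (trans (e (transp (suc i) (2+ i) (inv V y))) (trans (cong (app v) (transp-invol (suc i) (2+ i) (inv V y))) (app-inv V y)))))
      cases : ∀ j {j'} → j ≡ inv V y → TranspView (suc i) (2+ i) j j' → larger w y (pred j') ≡ larger v y (pred (inv V y)) + δ y (app v (suc i))
      cases j j≡ (at-a refl) rewrite sym j≡ =
        trans (larger-yes w y i (subst₂ _<_ y≡ (sym w-a) asc))
        (trans (cong suc (larger-low y ≤-refl)) (trans (+-comm 1 _) (cong (larger v y i +_) (sym (trans (cong (δ y) y≡) (δ-≡ y))))))
        where
        y≡ : app v (suc i) ≡ y
        y≡ = trans (cong (app v) j≡) (app-inv V y)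
      cases j j≡ (at-b refl) rewrite sym j≡ =
        trans (larger-low y ≤-refl) (trans (sym (larger-no v y i (<⇒≤ (subst (app v (suc i) <_) y≡ asc))))
        (trans (sym (+-identityʳ _)) (cong (larger v y (suc i) +_) (sym (δ-≢ (λ z → <⇒≢ asc (sym (trans y≡ z))))))))
        where
        y≡ : app v (2+ i) ≡ y
        y≡ = trans (cong (app v) j≡) (app-inv V y)
      cases j j≡ (off n m) with <-cmp j (suc i)
      ... | tri< q _ _ = trans (cong (larger w y) (cong pred j≡)) (trans (larger-low y (subst (λ j → pred j ≤ i) j≡ (≤-trans (pred[n]≤n {j}) (s≤s⁻¹ q))))
        (trans (sym (+-identityʳ _)) (cong (larger v y (pred (inv V y)) +_) (sym (δ-≢ y≢)))))
        where
        y≢ : y ≢ app v (suc i)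
        y≢ z = n (trans j≡ (app-inj V (trans (app-inv V y) z)))
      ... | tri≈ _ q _ = ⊥-elim (n q)
      ... | tri> _ _ q = trans (cong (larger w y) (cong pred j≡)) (trans (subst (λ k → larger w y k ≡ larger v y k) k≡ (larger-high y (pred (inv V y) ∸ 2+ i)))
        (trans (sym (+-identityʳ _)) (cong (larger v y (pred (inv V y)) +_) (sym (δ-≢ y≢)))))
        where
        y≢ : y ≢ app v (suc i)
        y≢ z = n (trans j≡ (app-inj V (trans (app-inv V y) z)))
        k≡ : pred (inv V y) ∸ 2+ i + 2+ i ≡ pred (inv V y)
        k≡ = m∸n+n≡m (subst (λ j → 2+ i ≤ pred j) j≡ (pred-mono-≤ (≤∧≢⇒< q (m ∘ sym))))

data Descents (w : List ℕ) : Set where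
  no-descent : Linked _≤_ w → (∀ n → firstDescentFrom n w ≡ nothing) → Descents w
  descent : ∀ i → suc i < length w → get w (suc i) < get w i → (∀ n → firstDescentFrom n w ≡ just (n + i)) → Descents w

descents : ∀ w → Descents w
descents [] = no-descent [] (λ n → refl)
descents (x ∷ []) = no-descent [-] (λ n → refl)
descents (x ∷ y ∷ w) with y <? x | descents (y ∷ w)
... | yes p | _ = descent 0 (s≤s z<s) p (λ n →
  trans (cong (λ b → if b then just n else firstDescentFrom (suc n) (y ∷ w)) (<ᵇ-yes p)) (cong just (sym (+-identityʳ n))))
... | no ¬p | descent i a b e = descent (suc i) (s≤s a) b (λ n →
  trans (cong (λ b → if b then just n else firstDescentFrom (suc n) (y ∷ w)) (<ᵇ-no (≮⇒≥ ¬p))) (trans (e (suc n)) (cong just (sym (+-suc n i)))))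
... | no ¬p | no-descent l e = no-descent (≮⇒≥ ¬p ∷ l) (λ n →
  trans (cong (λ b → if b then just n else firstDescentFrom (suc n) (y ∷ w)) (<ᵇ-no (≮⇒≥ ¬p))) (e (suc n)))

redWordF-just : ∀ {f w i} → firstDescentFrom 1 w ≡ just i → redWordF (suc f) w ≡ redWordF f (mulT w i (suc i)) ++ i ∷ []
redWordF-just e rewrite e = refl

descending-0 : ∀ {w} (V : Valid w) → Linked _≤_ w → ∀ k → heightOf V (suc k) ≡ 0
descending-0 {w} V l k = noneAbove (pred (inv V (suc k))) ≤-refl
  where
  1≤j = inv-pos V {suc k} z<s
  pairs : ∀ {w} → AllPairs _≤_ w → ∀ {i j} → i < j → j < length w → get w i ≤ get w j
  pairs (a ∷ d) {zero} {suc j} p (s<s q) = go a q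
    where
    go : ∀ {x w j} → All (x ≤_) w → j < length w → x ≤ get w j
    go {j = zero} (p ∷ a) q = p
    go {j = suc j} (p ∷ a) (s<s q) = go a q
  pairs (a ∷ d) {suc i} {suc j} (s<s p) (s<s q) = pairs d p q
  mono : ∀ {i j} → i < j → app w (suc i) ≤ app w (suc j)
  mono {i} {j} p with suc j ≤? length w
  ... | yes q = subst₂ _≤_ (sym (app-in w (<-trans p q))) (sym (app-in w q)) (pairs (Linked⇒AllPairs ≤-trans l) p q)
  ... | no q = subst (app w (suc i) ≤_) (sym (app-out w (≰⇒> q))) (fixes-≤ V (λ x r → app-out w (≤-trans (≰⇒> q) (<⇒≤ r))) (<⇒≤ (s≤s p)))
  noneAbove : ∀ m → m ≤ pred (inv V (suc k)) → larger w (suc k) m ≡ 0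
  noneAbove zero _ = refl
  noneAbove (suc m) q = trans (larger-no w (suc k) m (subst (app w (suc m) ≤_)
      (trans (cong (app w) (suc-pred _ {{>-nonZero 1≤j}})) (app-inv V (suc k))) (mono q)))
    (noneAbove m (≤-trans (n≤1+n m) q))

-- The reduced word ends with a descent of w, so the last slide goes into the diagram of a
-- permutation that ascends there, where `SlideStep` applies.
tower-heights : ∀ f {w} (V : Valid w) → len w ≡ f → ∀ k → get (slideWord (redWordF f w) []) k ≡ heightOf V (suc k)
tower-heights f {w} V lw k with descents w
tower-heights zero {w} V lw k | no-descent l e = sym (descending-0 V l k)
tower-heights (suc f) {w} V lw k | no-descent l e = ⊥-elim (0≢1+n (trans (sym (len-ascending (Linked⇒AllPairs ≤-trans l))) lw))
tower-heights f {w} V lw k | descent i a b e = go f lw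
  where
  u = mulT w (suc i) (2+ i)
  U = valid-mulT z<s z<s V
  desc : app w (2+ i) < app w (suc i)
  desc = subst₂ _<_ (sym (app-in w a)) (sym (app-in w (<-trans (n<1+n i) a))) b
  asc : app u (suc i) < app u (2+ i)
  asc = subst₂ _<_ (sym (app-mulT-a w (suc i) (2+ i) z<s z<s)) (sym (app-mulT-b w (suc i) (2+ i) z<s z<s)) desc
  lu : len w ≡ suc (len u)
  lu = len-adj-desc (inS refl V) z<s a desc
  w≡ : ∀ j → app w j ≡ app u (transp (suc i) (2+ i) j)
  w≡ j = sym (trans (app-mulT w (suc i) (2+ i) z<s z<s (transp (suc i) (2+ i) j)) (cong (app w) (transp-invol (suc i) (2+ i) j)))
  go : ∀ f → len w ≡ f → get (slideWord (redWordF f w) []) k ≡ heightOf V (suc k)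
  go zero z = ⊥-elim (0≢1+n (trans (sym z) lu))
  go (suc f) z = trans (cong (λ l → get l k) (trans (cong (λ α → slideWord α []) (redWordF-just {f} {w} (e 1))) (LP.foldl-++ (λ D j → slide j D) [] (redWordF f u) (suc i ∷ []))))
    (trans (SlideStep.slide-heights U i asc (slideWord (redWordF f u) []) (tower-heights f U (suc-injective (trans (sym lu) z))) k)
      (sym (SlideStep.heightOf-swap U i asc {w} w≡ V (suc k) z<s)))

height-tower : ∀ {w} → Valid w → ∀ j → 1 ≤ j → height (tower w) (app w j) ≡ larger w (app w j) (pred j)
height-tower {w} V (suc j) p = trans (cong (get (tower w)) (sym (cong pred (suc-pred (app w (suc j)) {{nz}}))))
  (trans (tower-heights (len w) V refl (pred (app w (suc j)))) (trans (cong (heightOf V) (suc-pred (app w (suc j)) {{nz}})) (heightOf-at V j)))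
  where
  nz = >-nonZero (app-pos V {suc j} z<s)

-- Fixed points at the end of the one-line notation

len-snoc : ∀ w z → All (_≤ z) w → len (w ++ z ∷ []) ≡ len w
len-snoc [] z [] = refl
len-snoc (x ∷ w) z (p ∷ a) = cong₂ _+_ (trans (countBelow-snoc x w z) (cong (λ b → (if b then 1 else 0) + countBelow x w) (<ᵇ-no p))) (len-snoc w z a)

pad-snoc : ∀ (w : Perm) c → w ++ range (suc (length w)) (suc c) ≡ (w ++ range (suc (length w)) c) ++ suc (length w + c) ∷ []
pad-snoc w c = trans (cong (w ++_) (trans (range-≡ (suc (length w)) (suc c)) (trans (sym (LP.applyUpTo-∷ʳ (suc (length w) +_) c))
  (cong (_++ suc (length w + c) ∷ []) (sym (range-≡ (suc (length w)) c)))))) (sym (LP.++-assoc w (range (suc (length w)) c) (suc (length w + c) ∷ [])))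

length-++-range : ∀ (w : Perm) c → length (w ++ range (suc (length w)) c) ≡ length w + c
length-++-range w c = trans (LP.length-++ w) (cong (length w +_) (length-range (suc (length w)) c))

valid-≈ : ∀ {w u} → (∀ j → app u j ≡ app w j) → Valid w → Valid u
valid-≈ e v .inv = inv v
valid-≈ e v .app-inv y = trans (e (inv v y)) (app-inv v y)
valid-≈ e v .inv-app x = trans (cong (inv v) (e x)) (inv-app v x)

valid-++-range : ∀ {w} c → Valid w → Valid (w ++ range (suc (length w)) c)
valid-++-range {w} c = valid-≈ (app-++-range w c)

valid-bounded : ∀ {w} → Valid w → All (_< suc (length w)) w
valid-bounded {w} v = all-get w (λ j p → s≤s (subst (_≤ length w) (app-in w p) (fixes-≤ v (λ x q → app-out w q) p)))

bounded-++-range : ∀ {w} c → Valid w → All (_< suc (length w + c)) (w ++ range (suc (length w)) c)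
bounded-++-range {w} c v = subst (λ n → All (_< suc n) (w ++ range (suc (length w)) c)) (length-++-range w c) (valid-bounded (valid-++-range c v))

len-++-range : ∀ {w} c → Valid w → len (w ++ range (suc (length w)) c) ≡ len w
len-++-range {w} zero v = cong len (LP.++-identityʳ w)
len-++-range {w} (suc c) v = trans (cong len (pad-snoc w c)) (trans (len-snoc _ _ (All.map <⇒≤ (bounded-++-range c v))) (len-++-range c v))

valid⇒unique : ∀ {w} → Valid w → Unique w
valid⇒unique v = inS-unique (inS refl v)

S-++-range : ∀ {w} c → Valid w → ∀ r → Distinct (length w + c) r → S (w ++ range (suc (length w)) c) r ≡ S w r
S-++-range {w} zero v r d = cong (λ u → S u r) (LP.++-identityʳ w)
S-++-range {w} (suc c) v r d = trans (cong (λ u → S u r) (pad-snoc w c))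
  (trans (S-snoc _ (length-++-range w c) (enough-start (w ++ range (suc (length w)) c)) (valid⇒unique (valid-++-range c v)) (bounded-++-range c v) r (subst (λ n → Distinct n r) (+-suc (length w) c) d))
    (S-++-range c v r (distinct-≤ (+-monoʳ-≤ (length w) (n≤1+n c)) d)))

_≈_ : Perm → Perm → Set
w ≈ u = ∀ j → app w j ≡ app u j

≈-pad : ∀ {w u} → length w ≤ length u → w ≈ u → u ≡ w ++ range (suc (length w)) (length u ∸ length w)
≈-pad {w} {u} p e = app-ext _ _ (sym (trans (length-++-range w _) (m+[n∸m]≡n p))) (λ j → trans (sym (e j)) (sym (app-++-range w _ j)))

len-≈ : ∀ {w u} → Valid w → Valid u → w ≈ u → len w ≡ len u
len-≈ {w} {u} v v' e with ≤-total (length w) (length u)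
... | inj₁ p = sym (trans (cong len (≈-pad p e)) (len-++-range _ v))
... | inj₂ p = trans (cong len (≈-pad p (λ j → sym (e j)))) (len-++-range _ v')

S-≈ : ∀ {w u} → Valid w → Valid u → w ≈ u → ∀ K r → length w ≤ K → length u ≤ K → Distinct K r → S w r ≡ S u r
S-≈ {w} {u} v v' e K r p q d with ≤-total (length w) (length u)
... | inj₁ t = sym (trans (cong (λ x → S x r) (≈-pad t e)) (S-++-range _ v r (distinct-≤ (subst (_≤ K) (sym (m+[n∸m]≡n t)) q) d)))
... | inj₂ t = trans (cong (λ x → S x r) (≈-pad t (λ j → sym (e j)))) (S-++-range _ v' r (distinct-≤ (subst (_≤ K) (sym (m+[n∸m]≡n t)) p) d))

mulT-≈ : ∀ {w u} a b → 1 ≤ a → 1 ≤ b → w ≈ u → mulT w a b ≈ mulT u a b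
mulT-≈ {w} {u} a b p q e j = trans (app-mulT w a b p q j) (trans (e (transp a b j)) (sym (app-mulT u a b p q j)))

inS-pad : ∀ {w} N → length w ≤ N → Valid w → InS N (pad w N)
inS-pad {w} N p v = inS (trans (length-pad w N) (m≤n⇒m⊔n≡n p)) (valid-≈ (app-pad w N) v)

-- A cover described by values alone, independently of the list chosen as one-line notation; `cover`
-- obtains it after padding to a length that contains b.
record Cover (w : Perm) (a b : ℕ) : Set where
  field
    asc : app w a < app w b
    gap : ∀ c → a < c → c < b → app w a < app w c → app w c < app w b → ⊥

cover : ∀ {w a b} → Valid w → 1 ≤ a → a < b → len (mulT w a b) ≡ suc (len w) → Cover w a b
cover {w} {a} {b} v p q e = record
  { asc = subst₂ _<_ (app-pad w N a) (app-pad w N b) (cover-asc s p q b≤N e')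
  ; gap = λ c ac cb x y → cover-gap s p ac cb b≤N e' (subst₂ _<_ (sym (app-pad w N a)) (sym (app-pad w N c)) x) (subst₂ _<_ (sym (app-pad w N c)) (sym (app-pad w N b)) y)
  }
  where
  N = length w ⊔ b
  b≤N = m≤n⊔m (length w) b
  1≤b = ≤-trans p (<⇒≤ q)
  s : InS N (pad w N)
  s = inS-pad N (m≤m⊔n (length w) b) v
  e' : len (mulT (pad w N) a b) ≡ suc (len (pad w N))
  e' = trans (len-≈ (valid-mulT p 1≤b (valid s)) (valid-mulT p 1≤b v) (mulT-≈ {pad w N} {w} a b p 1≤b (app-pad w N)))
    (trans e (cong suc (len-≈ {w} {pad w N} v (valid s) (λ j → sym (app-pad w N j)))))

-- Tracking labels

χ : ℕ → ℕ → ℕ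
χ x y = if x <ᵇ y then 1 else 0

module LabelStep {w : Perm} (v : Valid w) {k a b : ℕ} (1≤a : 1 ≤ a) (a≤k : a ≤ k) (k<b : k < b)
  (cov : Cover w a b) where

  open Cover cov
  w' = mulT w a b
  a<b = ≤-<-trans a≤k k<b
  1≤b = ≤-trans 1≤a (<⇒≤ a<b)
  v' : Valid w'
  v' = valid-mulT 1≤a 1≤b v
  s = app w a
  l = app w b

  w'a : app w' a ≡ l
  w'a = app-mulT-a w a b 1≤a 1≤b
  w'b : app w' b ≡ s
  w'b = app-mulT-b w a b 1≤a 1≤b
  w'o : ∀ {t} → t ≢ a → t ≢ b → app w' t ≡ app w t
  w'o {t} = app-mulT-o w a b {t} 1≤a 1≤b

  suc-pred-a = suc-pred a {{>-nonZero 1≤a}}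
  suc-pred-b = suc-pred b {{>-nonZero 1≤b}}

  larger-below : ∀ x {m} → m < a → larger w' x m ≡ larger w x m
  larger-below x q = larger-cong {w'} {w} x x _ (λ t _ r → cong (x <ᵇ_) (w'o (<⇒≢ (≤-<-trans r q)) (<⇒≢ (<-trans (≤-<-trans r q) a<b))))

  pred<a : pred a < a
  pred<a = ≤-reflexive suc-pred-a
  pred<b : pred b < b
  pred<b = ≤-reflexive suc-pred-b

  larger-a : ∀ u x → larger u x a ≡ χ x (app u a) + larger u x (pred a)
  larger-a u x = subst (λ z → larger u x z ≡ χ x (app u z) + larger u x (pred z)) suc-pred-a refl
  larger-b : ∀ u x → larger u x b ≡ χ x (app u b) + larger u x (pred b)
  larger-b u x = subst (λ z → larger u x z ≡ χ x (app u z) + larger u x (pred z)) suc-pred-b refl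

  -- Up to a position from a to b - 1 the two permutations differ only at a, where l replaces s.
  -- Each side is given the value it lacks, which avoids a subtraction.
  larger-middle : ∀ x d → d + a < b → χ x s + larger w' x (d + a) ≡ χ x l + larger w x (d + a)
  larger-middle x zero q = trans (cong (χ x s +_) (trans (larger-a w' x) (cong₂ _+_ (cong (χ x) w'a) (larger-below x pred<a))))
    (trans (+-exchange (χ x s) (χ x l) (larger w x (pred a))) (cong (χ x l +_) (sym (larger-a w x))))
  larger-middle x (suc d) q = trans (cong (λ z → χ x s + (χ x z + larger w' x (d + a))) (w'o (<⇒≢ (s≤s (m≤n+m a d)) ∘ sym) (<⇒≢ q)))
    (trans (+-exchange (χ x s) t (larger w' x (d + a))) (trans (cong (t +_) (larger-middle x d (<-trans (n<1+n _) q))) (+-exchange t (χ x l) (larger w x (d + a)))))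
    where
    t = χ x (app w (suc d + a))

  between : ∀ {m} → a ≤ m → m < b → ∃[ d ] (m ≡ d + a)
  between {m} p q = m ∸ a , sym (m∸n+n≡m p)

  larger-beyond : ∀ x d → larger w' x (d + b) ≡ larger w x (d + b)
  larger-beyond x zero = trans (larger-b w' x) (trans (cong (λ z → χ x z + larger w' x (pred b)) w'b) (trans mid (sym (larger-b w x))))
    where
    mid : χ x s + larger w' x (pred b) ≡ χ x l + larger w x (pred b)
    mid with between {pred b} (pred-mono-≤ a<b) pred<b
    ... | d , e = subst (λ z → χ x s + larger w' x z ≡ χ x l + larger w x z) (sym e) (larger-middle x d (subst (_< b) e pred<b))
  larger-beyond x (suc d) = cong₂ _+_ (cong (χ x) (w'o (<⇒≢ (≤-trans a<b (m≤n⇒m≤1+n (m≤n+m b d))) ∘ sym) (<⇒≢ (s≤s (m≤n+m b d)) ∘ sym))) (larger-beyond x d)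

  -- Beyond b the same values have been counted. Between a and b the exchange would matter only for
  -- s < w(c) < l, which a cover excludes.
  larger-other : ∀ c → a < c → c ≢ b → larger w' (app w c) (pred c) ≡ larger w (app w c) (pred c)
  larger-other c a<c c≢b with <-cmp c b
  ... | tri≈ _ e _ = ⊥-elim (c≢b e)
  ... | tri> _ _ b<c = subst (λ m → larger w' (app w c) m ≡ larger w (app w c) m) (m∸n+n≡m (pred-mono-≤ b<c)) (larger-beyond (app w c) (pred c ∸ b))
  ... | tri< c<b _ _ with between {pred c} (pred-mono-≤ a<c) (≤-<-trans (pred[n]≤n {c}) c<b)
  ...   | d , e = subst (λ m → larger w' (app w c) m ≡ larger w (app w c) m) (sym e)
      (+-cancelˡ-≡ (χ (app w c) s) _ _ (trans (larger-middle (app w c) d (subst (_< b) e (≤-<-trans (pred[n]≤n {c}) c<b))) (cong (_+ larger w (app w c) (d + a)) χ≡)))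
    where
    χ≡ : χ (app w c) l ≡ χ (app w c) s
    χ≡ with app w c <? s
    ... | yes p = cong (λ z → if z then 1 else 0) (trans (<ᵇ-yes (<-trans p asc)) (sym (<ᵇ-yes p)))
    ... | no p = cong (λ z → if z then 1 else 0) (trans (<ᵇ-no (≮⇒≥ (λ q → gap c a<c c<b (≤∧≢⇒< (≮⇒≥ p) (λ e → <⇒≢ a<c (app-inj v e))) q))) (sym (<ᵇ-no (≮⇒≥ p))))

  -- Strictly between a and b a value exceeds s exactly when it exceeds l; the additional unit is l
  -- itself, now at position a.
  larger-raise : ∀ d → d + a < b → larger w' s (d + a) + larger w l (pred a) ≡ suc (larger w s (pred a)) + larger w l (d + a)
  larger-raise zero q = trans (cong (_+ larger w l (pred a)) (trans (larger-a w' s) (cong₂ _+_ (trans (cong (χ s) w'a) (cong (λ z → if z then 1 else 0) (<ᵇ-yes asc))) (larger-below s pred<a))))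
    (cong (suc (larger w s (pred a)) +_) (sym (trans (larger-a w l) (cong (λ z → (if z then 1 else 0) + larger w l (pred a)) (<ᵇ-no (<⇒≤ asc))))))
  larger-raise (suc d) q = trans (+-assoc (χ s (app w' (suc d + a))) (larger w' s (d + a)) (larger w l (pred a)))
    (trans (cong₂ _+_ χ≡ (larger-raise d (<-trans (n<1+n _) q)))
    (+-exchange (χ l (app w (suc d + a))) (suc (larger w s (pred a))) (larger w l (d + a))))
    where
    t = suc d + a
    a<t : a < t
    a<t = s≤s (m≤n+m a d)
    χ≡ : χ s (app w' t) ≡ χ l (app w t)
    χ≡ with l <? app w t
    ... | yes p = cong (λ z → if z then 1 else 0) (trans (trans (cong (s <ᵇ_) (w'o (<⇒≢ a<t ∘ sym) (<⇒≢ q))) (<ᵇ-yes (<-trans asc p))) (sym (<ᵇ-yes p)))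
    ... | no p = cong (λ z → if z then 1 else 0) (trans (trans (cong (s <ᵇ_) (w'o (<⇒≢ a<t ∘ sym) (<⇒≢ q)))
        (<ᵇ-no (≮⇒≥ (λ z → gap t a<t q z (≤∧≢⇒< (≮⇒≥ p) (λ e → <⇒≢ q (app-inj v e))))))) (sym (<ᵇ-no (≮⇒≥ p))))

  Dₛ = larger w s (pred a)
  Dₗ = larger w l (pred b)
  Dₗ' = larger w l (pred a)

  -- With r = Dₗ - Dₗ', tower s rises by r + 1 while tower l falls by r.
  raise : larger w' s (pred b) + Dₗ' ≡ suc Dₛ + Dₗ
  raise with between {pred b} (pred-mono-≤ a<b) pred<b
  ... | d , e = subst (λ m → larger w' s m + Dₗ' ≡ suc Dₛ + larger w l m) (sym e) (larger-raise d (subst (_< b) e pred<b))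

  Dₗ'≤Dₗ : Dₗ' ≤ Dₗ
  Dₗ'≤Dₗ = larger-mono w l (pred-mono-≤ (<⇒≤ a<b))

  height-s : height (tower w) s ≡ Dₛ
  height-s = height-tower v a 1≤a
  height-l : height (tower w) l ≡ Dₗ
  height-l = height-tower v b 1≤b
  height-l' : height (tower w') l ≡ Dₗ'
  height-l' = trans (cong (height (tower w')) (sym w'a)) (trans (height-tower v' a 1≤a) (trans (cong (λ z → larger w' z (pred a)) w'a) (larger-below l pred<a)))

-- The cell (x , y) carries a label whose transposition had second position b, and all
-- later transpositions have first position at most A. The lower bound on y guarantees
-- that the cell is among those removed whenever position b is used again.
record Tracks (w : Perm) (A : ℕ) (cell : Cell) (b : ℕ) : Set where
  constructor tracks
  field
    column : proj₁ cell ≡ app w b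
    low : larger w (app w b) (pred A) ≤ proj₂ cell
    high : proj₂ cell < larger w (app w b) (pred b)

moveCell : Perm → ℕ → ℕ → Cell → Cell
moveCell w a b (x , y) =
  let D = height (tower w) ; D' = height (tower (mulT w a b)) ; s = app w a ; l = app w b ; r = D l ∸ D' l in
  if (x ≡ᵇ l) ∧ ((D l ∸ r) ≤ᵇ y) ∧ (y <ᵇ D l) then (s , D s + 1 + (y ∸ (D l ∸ r))) else (x , y)

-- For c ≠ b the column keeps its value and height. For c = b the invariant puts the cell among the
-- removed ones: Dₗ' counts positions before a, and a ≤ A. It is then carried to tower s, the value
-- now at b. The lower bound survives because the first positions never increase.
move-tracks : ∀ {w A k a b cell c} → Valid w → 1 ≤ a → a ≤ k → k < b → Cover w a b → a ≤ A → k < c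
  → Tracks w A cell c → Tracks (mulT w a b) a (moveCell w a b cell) c
move-tracks {w} {A} {k} {a} {b} {x , y} {c} v 1≤a a≤k k<b cov a≤A k<c (tracks refl lo hi) = go (c ≟ b)
  where
  open LabelStep v 1≤a a≤k k<b cov
  bottom : height (tower w) l ∸ (height (tower w) l ∸ height (tower w') l) ≡ Dₗ'
  bottom = trans (cong₂ (λ p q → p ∸ (p ∸ q)) height-l height-l') (m∸[m∸n]≡n Dₗ'≤Dₗ)
  go : Dec (c ≡ b) → Tracks w' a (moveCell w a b (app w c , y)) c
  go (no c≢b) = subst (λ z → Tracks w' a z c) (sym stay) (tracks (sym at)
      (subst (λ z → larger w' z (pred a) ≤ y) (sym at) (≤-trans (≤-reflexive (larger-below (app w c) pred<a)) (≤-trans (larger-mono w (app w c) (pred-mono-≤ a≤A)) lo)))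
      (subst (λ z → y < larger w' z (pred c)) (sym at) (subst (y <_) (sym (larger-other c (≤-<-trans a≤k k<c) c≢b)) hi)))
    where
    at : app w' c ≡ app w c
    at = w'o (<⇒≢ (≤-<-trans a≤k k<c) ∘ sym) c≢b
    stay : moveCell w a b (app w c , y) ≡ (app w c , y)
    stay rewrite ≡ᵇ-no (c≢b ∘ app-inj v {c} {b}) = refl
  go (yes refl) = subst (λ z → Tracks w' a z b) (sym moved) (tracks (sym w'b)
      (subst (λ z → larger w' z (pred a) ≤ y') (sym w'b) (≤-trans (≤-reflexive (larger-below s pred<a)) (≤-trans (m≤m+n Dₛ 1) (m≤m+n (Dₛ + 1) (y ∸ Dₗ')))))
      (subst (λ z → y' < larger w' z (pred b)) (sym w'b) (+-cancelʳ-< Dₗ' y' (larger w' s (pred b))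
        (subst₂ _<_ (trans (cong (λ z → Dₛ + 1 + z) (sym (m∸n+n≡m lo'))) (sym (+-assoc (Dₛ + 1) (y ∸ Dₗ') Dₗ'))) (sym (trans raise (cong (_+ Dₗ) (+-comm 1 Dₛ)))) (+-monoʳ-< (Dₛ + 1) hi)))))
    where
    y' = Dₛ + 1 + (y ∸ Dₗ')
    lo' : Dₗ' ≤ y
    lo' = ≤-trans (larger-mono w l (pred-mono-≤ a≤A)) lo
    moved : moveCell w a b (app w b , y) ≡ (s , y')
    moved rewrite ≡ᵇ-yes {app w b} refl | bottom | height-l | height-s | ≤ᵇ-yes lo' | <ᵇ-yes hi = refl

new-tracks : ∀ {w k a b} → Valid w → 1 ≤ a → a ≤ k → k < b → Cover w a b
  → Tracks (mulT w a b) a (app w a , height (tower w) (app w a)) b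
new-tracks {w} {k} {a} {b} v 1≤a a≤k k<b cov = tracks (sym w'b)
  (subst₂ (λ z y → larger w' z (pred a) ≤ y) (sym w'b) (sym height-s) (≤-reflexive (larger-below s pred<a)))
  (subst₂ (λ z y → y < larger w' z (pred b)) (sym w'b) (sym height-s)
    (+-cancelʳ-≤ Dₗ' (suc Dₛ) (larger w' s (pred b)) (≤-trans (+-monoʳ-≤ (suc Dₛ) Dₗ'≤Dₗ) (≤-reflexive (sym raise)))))
  where open LabelStep v 1≤a a≤k k<b cov

label-columns : ∀ c {k w A cells bs} → Valid w → SatChain k w c → Linked _≥_ (A ∷ map proj₁ c)
  → Pointwise (Tracks w A) cells bs → All (k <_) bs
  → Valid (endPerm w c) × map proj₁ (labelCellsFrom w cells c) ≡ map (app (endPerm w c)) (bs ++ map proj₂ c)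
label-columns [] {w = w} {A} v _ _ t _ = v , trans (columns t) (cong (map (app w)) (sym (LP.++-identityʳ _)))
  where
  columns : ∀ {cells bs} → Pointwise (Tracks w A) cells bs → map proj₁ cells ≡ map (app w) bs
  columns [] = refl
  columns (p ∷ t) = cong₂ _∷_ (Tracks.column p) (columns t)
label-columns ((a , b) ∷ c) {k} {w} {A} {cells} {bs} v (1≤a , a≤k , k<b , e , sat) (a≤A ∷ l) t above =
  proj₁ rec , trans (proj₂ rec) (cong (map (app (endPerm (mulT w a b) c))) (LP.++-assoc bs (b ∷ []) (map proj₂ c)))
  where
  cov = cover v 1≤a (≤-<-trans a≤k k<b) e
  step : ∀ {cells bs} → Pointwise (Tracks w A) cells bs → All (k <_) bs
    → Pointwise (Tracks (mulT w a b) a) (map (moveCell w a b) cells ++ (app w a , height (tower w) (app w a)) ∷ []) (bs ++ b ∷ [])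
  step [] [] = new-tracks v 1≤a a≤k k<b cov ∷ []
  step (p ∷ t) (q ∷ r) = move-tracks v 1≤a a≤k k<b cov a≤A q p ∷ step t r
  rec = label-columns c {k} {mulT w a b} {a} {labelStep w a b cells} {bs ++ b ∷ []} (valid-mulT 1≤a (≤-trans 1≤a (≤-trans a≤k (<⇒≤ k<b))) v) sat l (step t above) (all-snoc above k<b)

label-columns₀ : ∀ {k w} c → Valid w → SatChain k w c → Linked _≥_ (map proj₁ c)
  → Valid (endPerm w c) × map proj₁ (labelCells w c) ≡ map (app (endPerm w c)) (map proj₂ c)
label-columns₀ [] v sat l = v , refl
label-columns₀ c@((a , b) ∷ _) v sat l = label-columns c {A = a} v sat (≤-refl ∷ l) [] []

-- Condition (ii) says that the second positions b₁, …, b_m are distinct.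
inRChain⇔ : ∀ {k m w} c → Valid w
  → InRChain k m w c ⇔ (SatChain k w c × length c ≡ m × Linked _≥_ (map proj₁ c) × Unique (map proj₂ c))
inRChain⇔ c v = mk⇔
  (λ { (s , e , l , u) → s , e , l , Unique.map⁻ (subst Unique (proj₂ (label-columns₀ c v s l)) u) })
  (λ { (s , e , l , u) → s , e , l , subst Unique (sym (proj₂ (label-columns₀ c v s l))) (Unique.map⁺ (app-inj (proj₁ (label-columns₀ c v s l))) u) })

-- Enumeration of chains

branch : (Perm → List Chain) → Perm → ℕ → ℕ → List Chain
branch f w a b = if len (mulT w a b) ≡ᵇ suc (len w) then map ((a , b) ∷_) (f (mulT w a b)) else []

-- Follows the recursion of `H` clause by clause, so that summing over this list gives `H`.
chains : ℕ → List ℕ → List ℕ → Perm → List Chain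
chains zero I A w = [] ∷ []
chains (suc m) [] A w = []
chains (suc m) (c ∷ I) A w = chains (suc m) I A w ++ concatMap (λ j → branch (chains m (c ∷ I) (A ∖ j)) w c j) A

sumOver : (Perm → ℤ) → Perm → List Chain → ℤ
sumOver F w L = sumℤ (map (λ c → F (endPerm w c)) L)

sumOver-++ : ∀ F w L L' → sumOver F w (L ++ L') ≡ sumOver F w L ℤ.+ sumOver F w L'
sumOver-++ F w [] L' = sym (ℤP.+-identityˡ _)
sumOver-++ F w (c ∷ L) L' = trans (cong (λ z → F (endPerm w c) ℤ.+ z) (sumOver-++ F w L L')) (sym (ℤP.+-assoc (F (endPerm w c)) _ _))

branch-yes : ∀ f w a b → len (mulT w a b) ≡ suc (len w) → branch f w a b ≡ map ((a , b) ∷_) (f (mulT w a b))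
branch-yes f w a b e rewrite ≡ᵇ-yes e = refl

branch-no : ∀ f w a b → len (mulT w a b) ≢ suc (len w) → branch f w a b ≡ []
branch-no f w a b e rewrite ≡ᵇ-no e = refl

sumOver-branch : ∀ F f w a b → sumOver F w (branch f w a b) ≡ op a b (λ v → sumOver F v (f v)) w
sumOver-branch F f w a b with len (mulT w a b) ≟ suc (len w)
... | yes e = trans (cong (sumOver F w) (branch-yes f w a b e)) (trans (cong sumℤ (sym (LP.map-∘ (f (mulT w a b))))) (sym (op-yes a b (λ v → sumOver F v (f v)) w e)))
... | no n = trans (cong (sumOver F w) (branch-no f w a b n)) (sym (op-no a b (λ v → sumOver F v (f v)) w n))

sumOver-chains : ∀ F m I A w → sumOver F w (chains m I A w) ≡ H m I A F w
sumOver-chains F zero I A w = ℤP.+-identityʳ _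
sumOver-chains F (suc m) [] A w = refl
sumOver-chains F (suc m) (c ∷ I) A w = trans (sumOver-++ F w (chains (suc m) I A w) _)
  (cong₂ ℤ._+_ (sumOver-chains F (suc m) I A w) (go A))
  where
  f : ℕ → List Chain
  f j = branch (chains m (c ∷ I) (A ∖ j)) w c j
  go : ∀ B → sumOver F w (concatMap f B) ≡ ΣL B (λ j → op c j (H m (c ∷ I) (A ∖ j) F) w)
  go [] = refl
  go (j ∷ B) = trans (sumOver-++ F w (f j) (concatMap f B)) (cong₂ ℤ._+_
    (trans (sumOver-branch F (chains m (c ∷ I) (A ∖ j)) w c j)
      (op-cong c j (λ v → sumOver F v (chains m (c ∷ I) (A ∖ j) v)) (H m (c ∷ I) (A ∖ j) F) w (λ _ → sumOver-chains F m (c ∷ I) (A ∖ j) (mulT w c j)))) (go B))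

∈-concatMap : ∀ {f : ℕ → List Chain} A {c} → c ∈ concatMap f A → ∃[ j ] (j ∈ A × c ∈ f j)
∈-concatMap {f} (j ∷ A) p with ∈-++⁻ (f j) p
... | inj₁ q = j , here refl , q
... | inj₂ q with ∈-concatMap A q
...   | i , r , t = i , there r , t

concatMap-∈ : ∀ {f : ℕ → List Chain} A {c j} → j ∈ A → c ∈ f j → c ∈ concatMap f A
concatMap-∈ (j ∷ A) (here refl) q = ∈-++⁺ˡ q
concatMap-∈ {f} (i ∷ A) (there p) q = ∈-++⁺ʳ (f i) (concatMap-∈ A p q)

∈-branch : ∀ {f w a b c} → c ∈ branch f w a b → len (mulT w a b) ≡ suc (len w) × ∃[ c' ] (c' ∈ f (mulT w a b) × c ≡ (a , b) ∷ c')
∈-branch {f} {w} {a} {b} {c} p with len (mulT w a b) ≟ suc (len w)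
... | yes e = e , ∈-map⁻ ((a , b) ∷_) (subst (c ∈_) (branch-yes f w a b e) p)
... | no n with subst (c ∈_) (branch-no f w a b n) p
...   | ()

-- K is the bound of the K-Bruhat order, k the largest first position still allowed. Prefixing k to
-- the first positions expresses that bound within the monotonicity condition.
record Counted (K m k : ℕ) (A : List ℕ) (w : Perm) (c : Chain) : Set where
  constructor counted
  field
    saturated : SatChain K w c
    long : length c ≡ m
    decreasing : Linked _≥_ (k ∷ map proj₁ c)
    distinct : Unique (map proj₂ c)
    within : All (_∈ A) (map proj₂ c)

linked-≤ : ∀ {k k' l} → k ≤ k' → Linked _≥_ (k ∷ l) → Linked _≥_ (k' ∷ l)
linked-≤ p [-] = [-]
linked-≤ p (q ∷ l) = ≤-trans q p ∷ l

chains-sound : ∀ {K} m k A {w c} → k ≤ K → (∀ x → x ∈ A → K < x) → c ∈ chains m (dn k) A w → Counted K m k A w c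
chains-sound zero k A kK AK (here refl) = counted _ refl [-] [] []
chains-sound (suc m) (suc k) A {w} {c} kK AK p with ∈-++⁻ (chains (suc m) (dn k) A w) p
... | inj₁ q with chains-sound (suc m) k A (<⇒≤ kK) AK q
...   | counted s l d u i = counted s l (linked-≤ (n≤1+n k) d) u i
chains-sound (suc m) (suc k) A {w} {c} kK AK p | inj₂ q with ∈-concatMap A q
... | j , j∈ , r with ∈-branch {chains m (suc k ∷ dn k) (A ∖ j)} {w} r
...   | e , c' , r' , refl with chains-sound m (suc k) (A ∖ j) kK (λ x x∈ → AK x (proj₁ (∖-∈ A x∈))) r'
...     | counted s l d u i = counted (s≤s z≤n , kK , AK j j∈ , e , s) (cong suc l) (≤-refl ∷ d)
            (All.map (λ x∈ j≡ → proj₂ (∖-∈ A x∈) (sym j≡)) i ∷ u) (j∈ ∷ All.map (λ x∈ → proj₁ (∖-∈ A x∈)) i)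

chains-complete : ∀ {K} m k A {w c} → Counted K m k A w c → c ∈ chains m (dn k) A w
chains-complete zero k A {c = []} _ = here refl
chains-complete (suc m) zero A {c = (a , b) ∷ c} (counted (1≤a , _) _ (a≤0 ∷ _) _ _) = ⊥-elim (<⇒≱ 1≤a a≤0)
chains-complete (suc m) (suc k) A {w} {(a , b) ∷ c} (counted (1≤a , a≤K , K<b , e , s) l (a≤k ∷ d) (n ∷ u) (b∈ ∷ i)) with m≤n⇒m<n∨m≡n a≤k
... | inj₁ a<k = ∈-++⁺ˡ (chains-complete (suc m) k A (counted (1≤a , a≤K , K<b , e , s) l (s≤s⁻¹ a<k ∷ d) (n ∷ u) (b∈ ∷ i)))
... | inj₂ refl = ∈-++⁺ʳ (chains (suc m) (dn k) A w) (concatMap-∈ A b∈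
    (subst ((a , b) ∷ c ∈_) (sym (branch-yes (chains m (dn (suc k)) (A ∖ b)) w a b e)) (∈-map⁺ ((a , b) ∷_)
      (chains-complete m (suc k) (A ∖ b) (counted s (suc-injective l) d u (All.zipWith (λ { (x∈ , b≢) → ∈-∖ A x∈ (b≢ ∘ sym) }) (i , n)))))))

-- Recovers the branch j from a chain in it, which shows that different branches are disjoint.
-- Chains in a branch are nonempty; 0 is a default.
headSecond : Chain → ℕ
headSecond [] = 0
headSecond ((_ , b) ∷ _) = b

unique-concatMap : ∀ {f : ℕ → List Chain} A → Unique A → (∀ j → Unique (f j)) → (∀ j c → c ∈ f j → headSecond c ≡ j) → Unique (concatMap f A)
unique-concatMap [] u v k = []
unique-concatMap {f} (j ∷ A) (n ∷ u) v k = Unique.++⁺ (v j) (unique-concatMap A u v k)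
  (λ { {c} (p , q) → let i , i∈ , r = ∈-concatMap A q in All.lookup n i∈ (trans (sym (k j c p)) (k i c r)) })

chains-unique : ∀ {K} m k A {w} → k ≤ K → (∀ x → x ∈ A → K < x) → Unique A → Unique (chains m (dn k) A w)
chains-unique zero k A kK AK u = [] ∷ []
chains-unique (suc m) zero A kK AK u = []
chains-unique {K} (suc m) (suc k) A {w} kK AK u = Unique.++⁺ (chains-unique (suc m) k A (<⇒≤ kK) AK u)
  (unique-concatMap A u each (λ j c p → head≡ j c (∈-branch {chains m (dn (suc k)) (A ∖ j)} {w} p)))
  (λ { {c} (p , q) → clash c (chains-sound (suc m) k A (<⇒≤ kK) AK p) (∈-concatMap A q) })
  where
  f : ℕ → List Chain
  f j = branch (chains m (dn (suc k)) (A ∖ j)) w (suc k) j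
  each : ∀ j → Unique (f j)
  each j with len (mulT w (suc k) j) ≟ suc (len w)
  ... | yes e = subst Unique (sym (branch-yes (chains m (dn (suc k)) (A ∖ j)) w (suc k) j e))
      (Unique.map⁺ LP.∷-injectiveʳ (chains-unique m (suc k) (A ∖ j) kK (λ x x∈ → AK x (proj₁ (∖-∈ A x∈))) (∖-unique j u)))
  ... | no n = subst Unique (sym (branch-no (chains m (dn (suc k)) (A ∖ j)) w (suc k) j n)) []
  head≡ : ∀ j c → len (mulT w (suc k) j) ≡ suc (len w) × ∃[ c' ] (c' ∈ chains m (dn (suc k)) (A ∖ j) (mulT w (suc k) j) × c ≡ (suc k , j) ∷ c') → headSecond c ≡ j
  head≡ j c (_ , c' , _ , refl) = refl
  -- A chain of the first part starts at a first position at most k, a chain of the second at k + 1.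
  clash : ∀ c → Counted K (suc m) k A w c → ∃[ j ] (j ∈ A × c ∈ f j) → ⊥
  clash c z (j , _ , q) with ∈-branch {chains m (dn (suc k)) (A ∖ j)} {w} q
  clash c (counted _ _ (k< ∷ _) _ _) (j , _ , q) | _ , c' , _ , refl = <-irrefl refl k<

-- Passing between different one-line notations of the same permutations

satChain-≈ : ∀ {k w u} c → Valid w → Valid u → w ≈ u → SatChain k w c → SatChain k u c
satChain-≈ [] v v' e s = _
satChain-≈ {w = w} {u} ((a , b) ∷ c) v v' e (1≤a , a≤k , k<b , l , s) =
  1≤a , a≤k , k<b , trans (len-≈ V' V (λ j → sym (me j))) (trans l (cong suc (len-≈ v v' e))) , satChain-≈ c V V' me s
  where
  1≤b = ≤-trans 1≤a (≤-trans a≤k (<⇒≤ k<b))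
  V = valid-mulT 1≤a 1≤b v
  V' = valid-mulT 1≤a 1≤b v'
  me = mulT-≈ {w} {u} a b 1≤a 1≤b e

endPerm-≈ : ∀ {k w u} c → SatChain k w c → Valid w → Valid u → w ≈ u → Valid (endPerm w c) × Valid (endPerm u c) × endPerm w c ≈ endPerm u c
endPerm-≈ [] s v v' e = v , v' , e
endPerm-≈ {w = w} {u} ((a , b) ∷ c) (1≤a , a≤k , k<b , l , s) v v' e =
  endPerm-≈ c s (valid-mulT 1≤a 1≤b v) (valid-mulT 1≤a 1≤b v') (mulT-≈ {w} {u} a b 1≤a 1≤b e)
  where
  1≤b = ≤-trans 1≤a (≤-trans a≤k (<⇒≤ k<b))

length-endPerm : ∀ {k N w} c → SatChain k w c → All (_≤ N) (map proj₂ c) → length w ≤ N → length (endPerm w c) ≤ N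
length-endPerm [] s i p = p
length-endPerm {N = N} {w} ((a , b) ∷ c) (1≤a , a≤k , k<b , l , s) (q ∷ i) p = length-endPerm c s i
  (subst (_≤ N) (sym (length-mulT w a b)) (⊔-lub p (⊔-lub (≤-trans a≤k (≤-trans (<⇒≤ k<b) q)) q)))

-- A cover that skipped P + 1 would have this fixed point as an intermediate value, so each step
-- extends the range of moved positions by at most one.
chain-bounded : ∀ {k P w} c → k ≤ P → Valid w → FixesAbove P w → SatChain k w c → All (_≤ P + length c) (map proj₂ c)
chain-bounded [] kP v fx s = []
chain-bounded {k} {P} {w} ((a , b) ∷ c) kP v fx (1≤a , a≤k , k<b , e , s) =
  subst (b ≤_) (sym (+-suc P (length c))) (≤-trans b≤ (s≤s (m≤m+n P (length c))))
  ∷ subst (λ n → All (_≤ n) (map proj₂ c)) (sym (+-suc P (length c)))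
      (chain-bounded c (m≤n⇒m≤1+n kP) (valid-mulT 1≤a (≤-trans 1≤a (<⇒≤ a<b)) v)
        (fixes-mulT {w = w} 1≤a a<b b≤ (λ j p → fx j (<-trans (n<1+n P) p))) s)
  where
  a<b = ≤-<-trans a≤k k<b
  b≤ : b ≤ suc P
  b≤ with b ≤? suc P
  ... | yes p = p
  ... | no n = ⊥-elim (Cover.gap (cover v 1≤a a<b e) (suc P) (s≤s (≤-trans a≤k kP)) (≰⇒> n)
    (subst (app w a <_) (sym (fx (suc P) ≤-refl)) (s≤s (fixes-≤ v fx (≤-trans a≤k kP))))
    (subst₂ _<_ (sym (fx (suc P) ≤-refl)) (sym (fx b (<-trans (n<1+n P) (≰⇒> n)))) (≰⇒> n)))

-- From a rearrangement of 1, ..., n to a permutation with its inverse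

get-∈ : ∀ {w j} → j < length w → get w j ∈ w
get-∈ {x ∷ w} {zero} p = here refl
get-∈ {x ∷ w} {suc j} (s<s p) = there (get-∈ p)

get-injective : ∀ {w} → Unique w → ∀ i j → i < length w → j < length w → get w i ≡ get w j → i ≡ j
get-injective (n ∷ u) zero zero p q e = refl
get-injective (n ∷ u) zero (suc j) p (s<s q) e = ⊥-elim (All.lookup n (get-∈ q) e)
get-injective (n ∷ u) (suc i) zero (s<s p) q e = ⊥-elim (All.lookup n (get-∈ p) (sym e))
get-injective (n ∷ u) (suc i) (suc j) (s<s p) (s<s q) e = cong suc (get-injective u i j p q e)

module _ {n : ℕ} {ω : Perm} (perm : IsPerm n ω) where

  length-isPerm : length ω ≡ n
  length-isPerm = trans (↭-length perm) (length-range 1 n)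

  InRange : ℕ → Set
  InRange y = 1 ≤ y × y ≤ n

  private
    -- The disjunction remembers whether x was found in the list or is y itself; the other inverse
    -- law has to distinguish these origins.
    preimage : ∀ y → ∃[ x ] (app ω x ≡ y × ((InRange y × InRange x) ⊎ (¬ InRange y × x ≡ y)))
    preimage zero = 0 , refl , inj₂ ((λ ()) , refl)
    preimage (suc y) with suc y ≤? n
    ... | no ¬p = suc y , app-out ω (subst (_< suc y) (sym length-isPerm) (≰⇒> ¬p)) , inj₂ (¬p ∘ proj₂ , refl)
    ... | yes p with ∈-get (∈-resp-↭ (↭-sym perm) (∈-range {1} z<s (s≤s p)))
    ...   | i , q , e = suc i , trans (app-in ω q) e , inj₁ ((s≤s z≤n , p) , (s≤s z≤n , subst (i <_) length-isPerm q))

    app-range : ∀ {x} → InRange x → InRange (app ω x)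
    app-range {suc x} (_ , p) with range-∈ {1} {n} (∈-resp-↭ perm (subst (_∈ ω) (sym (app-in ω q)) (get-∈ q)))
      where
      q : x < length ω
      q = subst (x <_) (sym length-isPerm) p
    ... | a , b = a , s≤s⁻¹ b

    unique-ω : Unique ω
    unique-ω = Permutationₛ.Unique-resp-↭ (setoid ℕ) (↭⇒↭ₛ (↭-sym perm)) (unique-range 1 n)

    preimage-app : ∀ x → proj₁ (preimage (app ω x)) ≡ x
    preimage-app x with preimage (app ω x)
    preimage-app zero | _ , e , inj₁ ((() , _) , _)
    preimage-app zero | _ , e , inj₂ (_ , e') = e'
    preimage-app (suc x) | x' , e , r with suc x ≤? n
    ... | no ¬p with r
    ...   | inj₂ (_ , e') = trans e' (app-out ω (subst (_< suc x) (sym length-isPerm) (≰⇒> ¬p)))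
    ...   | inj₁ ((_ , q) , _) = ⊥-elim (¬p (subst (_≤ n) (app-out ω (subst (_< suc x) (sym length-isPerm) (≰⇒> ¬p))) q))
    preimage-app (suc x) | x' , e , inj₂ (nr , _) | yes p = ⊥-elim (nr (app-range (s≤s z≤n , p)))
    preimage-app (suc x) | suc x' , e , inj₁ (_ , (_ , q)) | yes p = cong suc (get-injective unique-ω x' x p₁ p₂ (trans (sym (app-in ω p₁)) (trans e (app-in ω p₂))))
      where
      p₁ = subst (x' <_) (sym length-isPerm) q
      p₂ = subst (x <_) (sym length-isPerm) p

  valid-isPerm : Valid ω
  valid-isPerm .inv y = proj₁ (preimage y)
  valid-isPerm .app-inv y = proj₁ (proj₂ (preimage y))
  valid-isPerm .inv-app = preimage-app

-- Assembly of the product formula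

sumℤ-cong : ∀ (L : List Chain) {f g : Chain → ℤ} → (∀ c → c ∈ L → f c ≡ g c) → sumℤ (map f L) ≡ sumℤ (map g L)
sumℤ-cong [] e = refl
sumℤ-cong (c ∷ L) e = cong₂ ℤ._+_ (e c (here refl)) (sumℤ-cong L (λ c p → e c (there p)))

theorem6p2 : (n k m : ℕ) → 1 ≤ n → 1 ≤ k → 1 ≤ m → k + m ≤ n
    → (ω : Perm) → IsPerm n ω
    → ∃[ L ] (Unique L
              × (∀ (c : Chain) → (c ∈ L ⇔ InRChain k m ω c))
              × (schub ω *P schub (rcyc n k m) ≈P sumP (map (λ c → schub (endPerm ω c)) L)))
theorem6p2 n zero m _ () _ _ ω perm
theorem6p2 n k@(suc k') m _ _ _ k+m≤n ω perm =
  L , chains-unique m k A ≤-refl AK (unique-up k d)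
  , (λ c → mk⇔ (sound c) (complete c))
  , ev⇒≈P N (schub ω *P schub (rcyc n k m)) (sumP (map (λ c → schub (endPerm ω c)) L)) product
  where
  -- Room for m steps, each of which moves at most one new position beyond n.
  N = n + m
  d = N ∸ k
  k≤n : k ≤ n
  k≤n = ≤-trans (m≤m+n k m) k+m≤n
  n≤N : n ≤ N
  n≤N = m≤m+n n m
  k+d : k + d ≡ N
  k+d = m+[n∸m]≡n (≤-trans k≤n n≤N)
  V = valid-isPerm perm
  lω = length-isPerm perm
  -- Products with transpositions inside 1, ..., N keep the length of W, while the list of ω may
  -- grow along a chain. Chains and Schubert polynomials are carried over between the two notations.
  W = pad ω N
  sW : InS N W
  sW = inS-pad N (subst (_≤ N) (sym lω) n≤N) V
  ω≈W : ω ≈ W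
  ω≈W j = sym (app-pad ω N j)
  A = up k d
  AK : ∀ x → x ∈ A → k < x
  AK x p = proj₁ (∈-up p)
  L = chains m (dn k) A W
  fixω : FixesAbove n ω
  fixω j p = app-out ω (subst (_< j) (sym lω) p)
  fixW : FixesAbove n W
  fixW j p = trans (app-pad ω N j) (fixω j p)
  to-ω : ∀ {c} → c ∈ L → SatChain k ω c × All (_≤ N) (map proj₂ c)
  to-ω {c} p with chains-sound m k A ≤-refl AK p
  ... | counted s _ _ _ i = satChain-≈ c (valid sW) V (λ j → sym (ω≈W j)) s , All.map (λ {x} x∈ → subst (x ≤_) k+d (proj₂ (∈-up x∈))) i
  sound : ∀ c → c ∈ L → InRChain k m ω c
  sound c p with chains-sound m k A ≤-refl AK p
  ... | counted s l dec u _ = Equivalence.from (inRChain⇔ c V) (proj₁ (to-ω p) , l , Linked.tail dec , u)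
  complete : ∀ c → InRChain k m ω c → c ∈ L
  complete c p with Equivalence.to (inRChain⇔ c V) p
  ... | s , l , dec , u = chains-complete m k A (counted (satChain-≈ c V (valid sW) ω≈W s) l (start c s dec) u (All.zipWith inA (seconds c s , bounded)))
    where
    start : ∀ c → SatChain k ω c → Linked _≥_ (map proj₁ c) → Linked _≥_ (k ∷ map proj₁ c)
    start [] s dec = [-]
    start (_ ∷ _) (_ , a≤k , _) dec = a≤k ∷ dec
    seconds : ∀ {w} c → SatChain k w c → All (k <_) (map proj₂ c)
    seconds [] s = []
    seconds ((a , b) ∷ c) (_ , _ , k<b , _ , s) = k<b ∷ seconds c s
    bounded : All (_≤ N) (map proj₂ c)
    bounded = subst (λ x → All (_≤ n + x) (map proj₂ c)) l (chain-bounded c k≤n V fixω s)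
    inA : ∀ {b} → k < b × b ≤ N → b ∈ A
    inA {b} (p , q) = up-∈ p (subst (b ≤_) (sym k+d) q)
  product : ∀ r → Distinct N r → ev (schub ω *P schub (rcyc n k m)) r ≡ ev (sumP (map (λ c → schub (endPerm ω c)) L)) r
  product r dr =
    begin
      ev (schub ω *P schub (rcyc n k m)) r
    ≡⟨ ev-*P (schub ω) (schub (rcyc n k m)) r ⟩
      S ω r ℤ.* S (rcyc n k m) r
    ≡⟨ cong₂ ℤ._*_ (S-≈ V (valid sW) ω≈W N r (subst (_≤ N) (sym lω) n≤N) (≤-reflexive (len-eq sW)) dr)
                   (S-rcyc k' m r k+m≤n (distinct-≤ n≤N dr)) ⟩
      S W r ℤ.* h m k r
    ≡⟨ ℤP.*-comm (S W r) (h m k r) ⟩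
      h m k r ℤ.* S W r
    ≡⟨ pieri m k d r k+d sW fixW ≤-refl k≤n dr ⟩
      H m (dn k) A (λ u → S u r) W
    ≡⟨ sumOver-chains (λ u → S u r) m (dn k) A W ⟨
      sumℤ (map (λ c → S (endPerm W c) r) L)
    ≡⟨ sumℤ-cong L (λ c p → ends c p) ⟨
      sumℤ (map (λ c → S (endPerm ω c) r) L)
    ≡⟨ cong sumℤ (LP.map-∘ L) ⟩
      sumℤ (map (λ p → ev p r) (map (λ c → schub (endPerm ω c)) L))
    ≡⟨ ev-sumP (map (λ c → schub (endPerm ω c)) L) r ⟨
      ev (sumP (map (λ c → schub (endPerm ω c)) L)) r
    ∎
    where
    open ≡-Reasoning
    ends : ∀ c → c ∈ L → S (endPerm ω c) r ≡ S (endPerm W c) r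
    ends c p with chains-sound m k A ≤-refl AK p | to-ω p
    ... | counted sW' _ _ _ _ | s , i with endPerm-≈ {u = W} c s V (valid sW) ω≈W
    ...   | v₁ , v₂ , e = S-≈ v₁ v₂ e N r (length-endPerm c s i (subst (_≤ N) (sym lω) n≤N)) (length-endPerm c sW' i (≤-reflexive (len-eq sW))) dr
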